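{- Suppose there is a randomized polynomial-time algorithm that, on input a formula $F(X,Y)$ such that $\forall X\,\exists Y\,F(X,Y)$ is a tautology and in which $y_i\in Y$ is uniquely defined in terms of $(X,Y^{1:i-1})$ by a circuit of size polynomial in $|F|$, returns a Skolem function for $y_i$. Then $\mathrm{NP}=\mathrm{RP}$.
   Context: $F(X,Y)$ is a Boolean formula over input variables $X=\{X_1,\dots,X_n\}$ (possibly $n=0$) and output variables $Y=\{Y_1,\dots,Y_m\}$ (here $y_i$ denotes $Y_i$); $|F|$ is its size; $Y^{1:i-1}=\{Y_1,\dots,Y_{i-1}\}$. For $Z\subseteq (X\cup Y)\setminus\{Y_i\}$, the variable $Y_i$ is uniquely defined in terms of $Z$ if $F(X,Y)\wedge F(\hat X,\hat Y)\wedge (Z=\hat Z)\implies Y_i=\hat Y_i$ holds, where $\hat X,\hat Y$ are fresh copies of $X,Y$ and $\hat Z$ is the corresponding copy of $Z$. It is uniquely defined in terms of $(X,Y^{1:i-1})$ by a circuit of size $s$ if there is a circuit of size $s$ computing $Y_i$ from $(X,Y^{1:i-1})$ on all satisfying assignments of $F$. Skolem functions for $F$ are Boolean functions $\Psi=\langle\psi_1,\dots,\psi_m\rangle$ such that $\exists Y\,F(X,Y)\equiv F(X,\Psi(X))$; $\psi_i$ is the Skolem function for $Y_i$, and $\psi_i$ may be written in terms of other $Y$ variables provided there are no cyclic dependencies. For $Y_i$ uniquely defined in terms of $(X,Y^{1:i-1})$, a Skolem function for $Y_i$ is a circuit on $(X,Y^{1:i-1})$ that agrees with $Y_i$ on all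 satisfying assignments of $F$. -}

module Defs where

open import Level using (0ℓ)
open import Data.Bool.Base using (Bool; true; false; not; _∧_; _∨_)
open import Data.Fin.Base using (Fin; Fin′; toℕ; inject)
open import Data.List.Base using (List; []; _∷_; _++_; length; replicate)
import Data.List.Base as List
open import Data.List.Relation.Unary.All using (All)
open import Data.List.Relation.Unary.Unique.Propositional using (Unique)
open import Data.Maybe using (Maybe; just; nothing; Is-just; to-witness)
open import Data.Nat.Base using (ℕ; zero; suc; _+_; _*_; _^_; _≤_)
open import Data.Product using (Σ-syntax; ∃-syntax; _×_; _,_)
open import Data.Vec.Base using (Vec; []; _∷_; lookup; tabulate; toList)
import Data.Vec.Base as Vec
open import Function.Bundles using (_⇔_)
open import Relation.Binary.PropositionalEquality using (_≡_)
open import Relation.Unary using (Pred; _∈_)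

-- Coefficient lists, constant term first.
Poly : Set
Poly = List ℕ

⟦_⟧ : Poly → ℕ → ℕ
⟦ []    ⟧ n = 0
⟦ a ∷ p ⟧ n = a + n * ⟦ p ⟧ n

Word : Set
Word = List Bool

-- `nothing` is the blank.
Symbol : Set
Symbol = Maybe Bool

data Move : Set where
  left stay right : Move

-- A two-way infinite tape: the cells to the left of the head (nearest
-- first), the scanned cell, and the cells to the right (nearest first).
-- All cells not listed are blank.
record Tape : Set where
  constructor tape
  field
    before : List Symbol
    head   : Symbol
    after  : List Symbol

open Tape

blankTape : Tape
blankTape = tape [] nothing []

move : Move → Tape → Tape
move stay  t                    = t
move left  (tape []      h rs)  = tape [] nothing (h ∷ rs)
move left  (tape (l ∷ ls) h rs) = tape ls l (h ∷ rs)
move right (tape ls h [])       = tape (h ∷ ls) nothing []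
move right (tape ls h (r ∷ rs)) = tape (h ∷ ls) r rs

act : Symbol × Move → Tape → Tape
act (s , m) t = move m (record t { head = s })

load : Word → Tape
load []      = blankTape
load (b ∷ w) = tape [] (just b) (List.map just w)

unblank : List Symbol → Word
unblank []             = []
unblank (nothing ∷ _)  = []
unblank (just b  ∷ ss) = b ∷ unblank ss

-- The maximal blank-free word that starts at the head.
contents : Tape → Word
contents t = unblank (head t ∷ after t)

-- Tape 0 holds the input, tape 1 the auxiliary input (a certificate or
-- random bits), tape 2 the output; there are any number of further work
-- tapes.  The machine halts when `δ` returns `nothing`.
record TM : Set where
  field
    states    : ℕ
    workTapes : ℕ
    start     : Fin states
    δ         : Fin states → Vec Symbol (3 + workTapes) →
                Maybe (Fin states × Vec (Symbol × Move) (3 + workTapes))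

module _ (M : TM) where
  open TM M

  Config : Set
  Config = Fin states × Vec Tape (3 + workTapes)

  initial : Word → Word → Config
  initial x r =
    start , load x ∷ load r ∷ blankTape ∷ Vec.replicate workTapes blankTape

  output : Config → Word
  output (_ , _ ∷ _ ∷ t ∷ _) = contents t

  step : Config → Maybe Config
  step (s , ts) with δ s (Vec.map head ts)
  ... | nothing         = nothing
  ... | just (s′ , acts) = just (s′ , Vec.zipWith act acts ts)

  -- The output, provided the machine halts within the given number of steps.
  run : ℕ → Config → Maybe Word
  run t c with step c
  run t       c | nothing = just (output c)
  run zero    c | just _  = nothing
  run (suc t) c | just c′ = run t c′

record PolyTimeTM : Set where
  field
    machine : TM
    time    : Poly
    halts   : ∀ x r →
      Is-just (run machine (⟦ time ⟧ (length x + length r)) (initial machine x r))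

-- The result of running the machine on input x and auxiliary input r.
infix 8 _⟨_,_⟩
_⟨_,_⟩ : PolyTimeTM → Word → Word → Word
M ⟨ x , r ⟩ = to-witness (PolyTimeTM.halts M x r)

Accepts : PolyTimeTM → Word → Word → Set
Accepts M x r = M ⟨ x , r ⟩ ≡ true ∷ []

-- For uniformly random r ∈ {0,1}^ℓ, P r holds with probability ≥ a / b:
-- some duplicate-free list of strings satisfying P has ≥ (a / b) · 2^ℓ entries.
Pr[_]≥_/_ : ∀ {ℓ} → Pred (Vec Bool ℓ) 0ℓ → ℕ → ℕ → Set
Pr[_]≥_/_ {ℓ} P a b =
  ∃[ rs ] Unique rs × All P rs × a * 2 ^ ℓ ≤ b * length rs

Language : Set₁
Language = Pred Word 0ℓ

NP : Pred Language 0ℓ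
NP L =
  Σ[ M ∈ PolyTimeTM ] Σ[ q ∈ Poly ] ∀ x →
    x ∈ L ⇔ (Σ[ w ∈ Vec Bool (⟦ q ⟧ (length x)) ] Accepts M x (toList w))

-- The error condition "if x ∉ L then no r is accepted" is stated
-- contrapositively, which is the form that is meaningful constructively
-- for an L that is not assumed to be decidable.
RP : Pred Language 0ℓ
RP L =
  Σ[ M ∈ PolyTimeTM ] Σ[ q ∈ Poly ] ∀ x →
    let Accepting : Pred (Vec Bool (⟦ q ⟧ (length x))) 0ℓ
        Accepting r = Accepts M x (toList r)
    in (x ∈ L → Pr[ Accepting ]≥ 1 / 2) × (∀ r → r ∈ Accepting → x ∈ L)

-- Formulas F(X,Y) with |X| = n and |Y| = m.
data Formula (n m : ℕ) : Set where
  X     : Fin n → Formula n m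
  Y     : Fin m → Formula n m
  const : Bool → Formula n m
  neg   : Formula n m → Formula n m
  and   : Formula n m → Formula n m → Formula n m
  or    : Formula n m → Formula n m → Formula n m

∣_∣ : ∀ {n m} → Formula n m → ℕ
∣ X _ ∣     = 1
∣ Y _ ∣     = 1
∣ const _ ∣ = 1
∣ neg F ∣   = 1 + ∣ F ∣
∣ and F G ∣ = 1 + ∣ F ∣ + ∣ G ∣
∣ or F G ∣  = 1 + ∣ F ∣ + ∣ G ∣

eval : ∀ {n m} → Formula n m → Vec Bool n → Vec Bool m → Bool
eval (X j)     x y = lookup x j
eval (Y j)     x y = lookup y j
eval (const b) x y = b
eval (neg F)   x y = not (eval F x y)
eval (and F G) x y = eval F x y ∧ eval G x y
eval (or F G)  x y = eval F x y ∨ eval G x y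

data Gate (k : ℕ) : Set where
  const : Bool → Gate k
  neg   : Fin k → Gate k
  and   : Fin k → Fin k → Gate k
  or    : Fin k → Fin k → Gate k

-- A circuit over k available wires either designates one of them as its
-- output or adds a gate, whose wire becomes wire 0 of the remaining circuit
-- while the earlier wires are shifted up by one.
data Circuit (k : ℕ) : Set where
  out : Fin k → Circuit k
  _▸_ : Gate k → Circuit (suc k) → Circuit k

infixr 5 _▸_

size : ∀ {k} → Circuit k → ℕ
size (out _) = 0
size (_ ▸ C) = suc (size C)

evalGate : ∀ {k} → Gate k → Vec Bool k → Bool
evalGate (const b) ρ = b
evalGate (neg i)   ρ = not (lookup ρ i)
evalGate (and i j) ρ = lookup ρ i ∧ lookup ρ j
evalGate (or i j)  ρ = lookup ρ i ∨ lookup ρ j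

evalCircuit : ∀ {k} → Circuit k → Vec Bool k → Bool
evalCircuit (out i) ρ = lookup ρ i
evalCircuit (g ▸ C) ρ = evalCircuit C (evalGate g ρ ∷ ρ)

-- For i : Fin m, the toℕ i output variables preceding Y i.
preceding : ∀ {m} → Vec Bool m → (i : Fin m) → Vec Bool (toℕ i)
preceding y i = tabulate λ (j : Fin′ i) → lookup y (inject j)

Total : ∀ {n m} → Formula n m → Set
Total F = ∀ x → ∃[ y ] eval F x y ≡ true

-- The circuit, reading X and the outputs before Y i, agrees with Y i on all
-- satisfying assignments of F.
Computes : ∀ {n m} → Formula n m → (i : Fin m) → Circuit (n + toℕ i) → Set
Computes F i C = ∀ x y → eval F x y ≡ true →
  evalCircuit C (x Vec.++ preceding y i) ≡ lookup y i

UniquelyDefinedBySize≤ : ∀ {n m} → Formula n m → Fin m → ℕ → Set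
UniquelyDefinedBySize≤ F i s = ∃[ C ] size C ≤ s × Computes F i C

-- For a Y i that is uniquely defined in terms of X and the outputs before
-- it, a Skolem function is the same thing as a circuit computing it.
IsSkolem : ∀ {n m} → Formula n m → (i : Fin m) → Circuit (n + toℕ i) → Set
IsSkolem = Computes

unary : ℕ → Word
unary n = replicate n true ++ false ∷ []

index : ∀ {k} → Fin k → Word
index i = unary (toℕ i)

encodeFormula : ∀ {n m} → Formula n m → Word
encodeFormula (X j)     = false ∷ false ∷ false ∷ index j
encodeFormula (Y j)     = false ∷ false ∷ true  ∷ index j
encodeFormula (const b) = false ∷ true  ∷ b     ∷ []
encodeFormula (neg F)   = true  ∷ false ∷ encodeFormula F
encodeFormula (and F G) = true  ∷ true  ∷ false ∷ encodeFormula F ++ encodeFormula G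
encodeFormula (or F G)  = true  ∷ true  ∷ true  ∷ encodeFormula F ++ encodeFormula G

encodeInput : ∀ {n m} → Formula n m → Fin m → Word
encodeInput {n} {m} F i = unary n ++ unary m ++ index i ++ encodeFormula F

encodeGate : ∀ {k} → Gate k → Word
encodeGate (const b) = false ∷ false ∷ b ∷ []
encodeGate (neg i)   = false ∷ true  ∷ index i
encodeGate (and i j) = true  ∷ false ∷ index i ++ index j
encodeGate (or i j)  = true  ∷ true  ∷ index i ++ index j

encodeCircuit : ∀ {k} → Circuit k → Word
encodeCircuit (out i) = false ∷ index i
encodeCircuit (g ▸ C) = true ∷ encodeGate g ++ encodeCircuit C

-- "A circuit of size polynomial in |F|" constrains a family of inputs, not a
-- single one, so the promise is relative to a polynomial p.  A randomized
-- algorithm has to be correct with probability at least 2/3 on each input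
-- satisfying the promise.
record RandomizedSynthesizer (p : Poly) : Set where
  field
    algorithm  : PolyTimeTM
    randomBits : Poly
    correct    : ∀ {n m} (F : Formula n m) (i : Fin m) →
      Total F →
      UniquelyDefinedBySize≤ F i (⟦ p ⟧ ∣ F ∣) →
      let w = encodeInput F i
          ReturnsSkolem : Pred (Vec Bool (⟦ randomBits ⟧ (length w))) 0ℓ
          ReturnsSkolem r = ∃[ C ] IsSkolem F i C ×
            algorithm ⟨ w , toList r ⟩ ≡ encodeCircuit C
      in Pr[ ReturnsSkolem ]≥ 2 / 3

{-# OPTIONS --safe #-}
-- Random weights on the positions of a certificate z isolate, with probability
-- at least 3/4, a certificate of minimal weight (Mulmuley, Vazirani, Vazirani).
-- For the minimal weight W, the formula "z is a certificate of weight W and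
-- Y₀ = ⋁ⱼ (Xⱼ ∧ zⱼ)" is total, and Y₀ is uniquely defined by the disjunction of
-- the Xⱼ with zⱼ = 1.  A Skolem function for Y₀, evaluated at the unit vectors,
-- gives all of z, so one call of the synthesizer per value of W suffices; since
-- 3/4 · 2/3 = 1/2, no amplification is needed.  The machine tries all values of W
-- with the same random bits and checks each candidate for z, so it never accepts
-- wrongly.
--
-- Machines are obtained from programs over stacks.  The property "z is a
-- certificate of weight W" is decided by such a program, so the Cook–Levin
-- formula only has to describe runs of stack machines.
module Submission where

open import Defs
open import Data.Bool.Base using (Bool; true; false; not; _∧_; _∨_; if_then_else_)
open import Data.Empty using (⊥; ⊥-elim)
open import Data.Fin.Base using (Fin; zero; suc; toℕ; punchIn; fromℕ<; splitAt; _↑ˡ_; _↑ʳ_; combine; remQuot)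
open import Data.Fin.Patterns using (1F; 2F; 3F; 4F; 5F; 6F; 7F; 8F)
import Data.Fin.Properties as Fin
open import Data.List.Base using (List; []; _∷_; _++_; length; reverse; drop; take; replicate)
import Data.List.Base as List
import Data.List.Properties as List
open import Data.List.Relation.Unary.All using (All; []; _∷_)
import Data.List.Relation.Unary.All as All
import Data.List.Relation.Unary.All.Properties as AllP
open import Data.List.Relation.Unary.AllPairs using ([]; _∷_)
open import Data.List.Relation.Unary.Unique.Propositional using (Unique)
import Data.List.Relation.Unary.Unique.Propositional.Properties as UniqueP
open import Data.List.Membership.Propositional using () renaming (_∈_ to _∈ˡ_)
open import Data.List.Membership.Propositional.Properties using (∈-map⁻)
open import Data.Maybe.Base using (Maybe; just; nothing)
import Data.Maybe.Base as Maybe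
import Data.Maybe
import Data.Bool.Base as BoolBase
import Data.Bool.Properties as Bool
import Data.Maybe.Relation.Unary.Any
open import Data.Nat.Base using (ℕ; zero; suc; _≤ᵇ_; _<ᵇ_; _≡ᵇ_; _+_; _*_; _∸_; _^_; _⊔_; _⊓_; _≤_; _<_; z≤n; s≤s)
open import Data.Nat.Properties
open import Data.Nat.Tactic.RingSolver using (solve-∀)
open import Data.Product using (Σ-syntax; ∃-syntax; ∃₂; _×_; _,_; proj₁; proj₂)
open import Data.Sum.Base using (_⊎_; inj₁; inj₂)
open import Data.Unit.Base using (⊤; tt)
open import Data.Vec.Base using (Vec; []; _∷_; lookup; tabulate; updateAt; insertAt; removeAt; toList)
import Data.Vec.Base as Vec
import Data.Vec.Properties as Vec
open import Level using (0ℓ)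
open import Relation.Unary using (Pred; _≐_)
open import Function.Bundles using (Equivalence; mk⇔)
open import Function.Base using (_∘_; id; case_of_)
open import Relation.Binary.PropositionalEquality using (_≡_; _≢_; refl; sym; trans; cong; cong₂; subst; subst₂; ≢-sym; module ≡-Reasoning)
open import Relation.Nullary using (¬_; Dec; yes; no)

-- Polynomials

-- Why `X` occurs at all: a question without inputs would yield one bit of `z` per call, and the
-- errors of the calls would add up. Letting the answer depend on a selector `X` puts all bits into
-- one circuit, so that a single error of 1/3 pays for the whole certificate.
--
-- Only `Y₀` has to be uniquely defined. The tableau cells beside it may be ambiguous, so nothing is
-- asked of the reduction except that satisfying assignments describe accepting runs. No output
-- precedes `Y₀`, hence the circuit reads `X` alone; and the constraints on the run do not mention
-- `X`, hence one accepted certificate makes the formula total.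
--
-- The promise on the circuit size is met by the identity polynomial, because the question itself
-- contains a conjunction with one member per certificate bit.
--
-- The constant 3/4: a weight is read from a chunk of `8ℓ` bits, where `ℓ` is the length of the
-- certificate. It stays at most `8ℓ`, so that it can be written in unary, and it is uniform on at
-- least `4ℓ` values. Each of the `ℓ` positions then spoils uniqueness with probability at most
-- `1 / 4ℓ`.

data PolyExpr : Set where
  K    : ℕ → PolyExpr
  N    : PolyExpr
  _⊕_  : PolyExpr → PolyExpr → PolyExpr
  _⊗_  : PolyExpr → PolyExpr → PolyExpr

infixl 6 _⊕_
infixl 7 _⊗_

⟪_⟫ : PolyExpr → ℕ → ℕ
⟪ K a ⟫ n   = a
⟪ N ⟫ n     = n
⟪ e ⊕ f ⟫ n = ⟪ e ⟫ n + ⟪ f ⟫ n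
⟪ e ⊗ f ⟫ n = ⟪ e ⟫ n * ⟪ f ⟫ n

_⟨∘⟩_ : PolyExpr → PolyExpr → PolyExpr
K a     ⟨∘⟩ g = K a
N       ⟨∘⟩ g = g
(e ⊕ f) ⟨∘⟩ g = (e ⟨∘⟩ g) ⊕ (f ⟨∘⟩ g)
(e ⊗ f) ⟨∘⟩ g = (e ⟨∘⟩ g) ⊗ (f ⟨∘⟩ g)

⟪∘⟫ : ∀ e g n → ⟪ e ⟨∘⟩ g ⟫ n ≡ ⟪ e ⟫ (⟪ g ⟫ n)
⟪∘⟫ (K a) g n   = refl
⟪∘⟫ N g n       = refl
⟪∘⟫ (e ⊕ f) g n = cong₂ _+_ (⟪∘⟫ e g n) (⟪∘⟫ f g n)
⟪∘⟫ (e ⊗ f) g n = cong₂ _*_ (⟪∘⟫ e g n) (⟪∘⟫ f g n)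

-- There is no subtraction among the constructors. Monotonicity lets a cost be evaluated at an upper
-- bound of the actual size, so that costs compose by `_⟨∘⟩_`.
⟪⟫-mono : ∀ e {m n} → m ≤ n → ⟪ e ⟫ m ≤ ⟪ e ⟫ n
⟪⟫-mono (K a) m≤n   = ≤-refl
⟪⟫-mono N m≤n       = m≤n
⟪⟫-mono (e ⊕ f) m≤n = +-mono-≤ (⟪⟫-mono e m≤n) (⟪⟫-mono f m≤n)
⟪⟫-mono (e ⊗ f) m≤n = *-mono-≤ (⟪⟫-mono e m≤n) (⟪⟫-mono f m≤n)

addP : Poly → Poly → Poly
addP []      q       = q
addP (a ∷ p) []      = a ∷ p
addP (a ∷ p) (b ∷ q) = (a + b) ∷ addP p q

⟦addP⟧ : ∀ p q n → ⟦ addP p q ⟧ n ≡ ⟦ p ⟧ n + ⟦ q ⟧ n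
⟦addP⟧ []      q       n = refl
⟦addP⟧ (a ∷ p) []      n = sym (+-identityʳ _)
⟦addP⟧ (a ∷ p) (b ∷ q) n rewrite ⟦addP⟧ p q n = eq a b n (⟦ p ⟧ n) (⟦ q ⟧ n)
  where
  eq : ∀ a b n p q → a + b + n * (p + q) ≡ a + n * p + (b + n * q)
  eq = solve-∀

mulP : Poly → Poly → Poly
mulP []      q = []
mulP (a ∷ p) q = addP (List.map (a *_) q) (0 ∷ mulP p q)

⟦scale⟧ : ∀ a q n → ⟦ List.map (a *_) q ⟧ n ≡ a * ⟦ q ⟧ n
⟦scale⟧ a []      n = sym (*-zeroʳ a)
⟦scale⟧ a (b ∷ q) n rewrite ⟦scale⟧ a q n = eq a b n (⟦ q ⟧ n)
  where
  eq : ∀ a b n q → a * b + n * (a * q) ≡ a * (b + n * q)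
  eq = solve-∀

⟦mulP⟧ : ∀ p q n → ⟦ mulP p q ⟧ n ≡ ⟦ p ⟧ n * ⟦ q ⟧ n
⟦mulP⟧ []      q n = refl
⟦mulP⟧ (a ∷ p) q n
  rewrite ⟦addP⟧ (List.map (a *_) q) (0 ∷ mulP p q) n | ⟦scale⟧ a q n | ⟦mulP⟧ p q n
  = eq a n (⟦ p ⟧ n) (⟦ q ⟧ n)
  where
  eq : ∀ a n p q → a * q + n * (p * q) ≡ (a + n * p) * q
  eq = solve-∀

toPoly : PolyExpr → Poly
toPoly (K a)   = a ∷ []
toPoly N       = 0 ∷ 1 ∷ []
toPoly (e ⊕ f) = addP (toPoly e) (toPoly f)
toPoly (e ⊗ f) = mulP (toPoly e) (toPoly f)

⟦toPoly⟧ : ∀ e n → ⟦ toPoly e ⟧ n ≡ ⟪ e ⟫ n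
⟦toPoly⟧ (K a) n = trans (cong (a +_) (*-zeroʳ n)) (+-identityʳ a)
⟦toPoly⟧ N n     = eq n
  where
  eq : ∀ n → n * (1 + n * 0) ≡ n
  eq = solve-∀
⟦toPoly⟧ (e ⊕ f) n
  rewrite ⟦addP⟧ (toPoly e) (toPoly f) n | ⟦toPoly⟧ e n | ⟦toPoly⟧ f n = refl
⟦toPoly⟧ (e ⊗ f) n
  rewrite ⟦mulP⟧ (toPoly e) (toPoly f) n | ⟦toPoly⟧ e n | ⟦toPoly⟧ f n = refl

fromPoly : Poly → PolyExpr
fromPoly []      = K 0
fromPoly (a ∷ p) = K a ⊕ N ⊗ fromPoly p

⟪fromPoly⟫ : ∀ p n → ⟪ fromPoly p ⟫ n ≡ ⟦ p ⟧ n
⟪fromPoly⟫ []      n = refl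
⟪fromPoly⟫ (a ∷ p) n = cong (λ v → a + n * v) (⟪fromPoly⟫ p n)

-- Structured programs over k stacks.  `new j` allocates an empty stack at
-- index j and requires it to be empty again at the end; `at j` runs a program
-- that does not see the stack at index j.
data Stmt : ℕ → Set where
  skip   : ∀ {k} → Stmt k
  push   : ∀ {k} → Bool → Fin k → Stmt k
  pop    : ∀ {k} → Fin k → Stmt k
  _⨟_    : ∀ {k} → Stmt k → Stmt k → Stmt k
  branch : ∀ {k} → Fin k → (Symbol → Stmt k) → Stmt k
  while  : ∀ {k} → Fin k → Stmt k → Stmt k
  new    : ∀ {k} → Fin (suc k) → Stmt (suc k) → Stmt k
  at     : ∀ {k} → Fin (suc k) → Stmt k → Stmt (suc k)

infixr 4 _⨟_

top : Word → Symbol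
top = List.head

infix 3 _⊢_⇓_[_]

-- The cost is the exact number of steps of the compiled machine: a sequence pays one for the jump
-- between its parts, a round of `while` pays one for the test and one for the jump back, and `new`
-- and `at` are free because they only change the addressing.
data _⊢_⇓_[_] : ∀ {k} → Stmt k → Vec Word k → Vec Word k → ℕ → Set where
  skip   : ∀ {k} {ρ : Vec Word k} → skip ⊢ ρ ⇓ ρ [ 0 ]
  push   : ∀ {k b} {i : Fin k} {ρ} → push b i ⊢ ρ ⇓ updateAt ρ i (b ∷_) [ 1 ]
  pop    : ∀ {k} {i : Fin k} {ρ} → pop i ⊢ ρ ⇓ updateAt ρ i (drop 1) [ 1 ]
  _⨟_    : ∀ {k} {S T : Stmt k} {ρ ρ′ ρ″ a b} →
           S ⊢ ρ ⇓ ρ′ [ a ] → T ⊢ ρ′ ⇓ ρ″ [ b ] → S ⨟ T ⊢ ρ ⇓ ρ″ [ suc (a + b) ]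
  branch : ∀ {k} {i : Fin k} {f ρ ρ′ a} →
           f (top (lookup ρ i)) ⊢ ρ ⇓ ρ′ [ a ] → branch i f ⊢ ρ ⇓ ρ′ [ suc a ]
  stop   : ∀ {k} {i : Fin k} {S ρ} → top (lookup ρ i) ≡ nothing → while i S ⊢ ρ ⇓ ρ [ 1 ]
  again     : ∀ {k} {i : Fin k} {S ρ ρ′ ρ″ a b c} → top (lookup ρ i) ≡ just c →
           S ⊢ ρ ⇓ ρ′ [ a ] → while i S ⊢ ρ′ ⇓ ρ″ [ b ] →
           while i S ⊢ ρ ⇓ ρ″ [ 2 + (a + b) ]
  new    : ∀ {k} {j : Fin (suc k)} {S ρ ρ′ a} →
           S ⊢ insertAt ρ j [] ⇓ insertAt ρ′ j [] [ a ] → new j S ⊢ ρ ⇓ ρ′ [ a ]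
  at     : ∀ {k} {j : Fin (suc k)} {S : Stmt k} {ρ ρ′ a} →
           lookup ρ j ≡ lookup ρ′ j → S ⊢ removeAt ρ j ⇓ removeAt ρ′ j [ a ] →
           at j S ⊢ ρ ⇓ ρ′ [ a ]

data PunchView {n} (j : Fin (suc n)) : Fin (suc n) → Set where
  same  : PunchView j j
  other : ∀ i → PunchView j (punchIn j i)

punchView : ∀ {n} (j i : Fin (suc n)) → PunchView j i
punchView zero zero = same
punchView zero (suc i) = other i
punchView {suc n} (suc j) zero = other zero
punchView {suc n} (suc j) (suc i) with punchView j i
... | same    = same
... | other i = other (suc i)

lookup-removeAt : ∀ {A : Set} {n} (xs : Vec A (suc n)) j i →
  lookup (removeAt xs j) i ≡ lookup xs (punchIn j i)
lookup-removeAt (x ∷ xs)     zero    i       = refl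
lookup-removeAt (x ∷ y ∷ xs) (suc j) zero    = refl
lookup-removeAt (x ∷ y ∷ xs) (suc j) (suc i) = lookup-removeAt (y ∷ xs) j i

-- A step pushes at most one bit, so time bounds space. This is why the output of a program needs no
-- length bound of its own.
growth : ∀ {k} {S : Stmt k} {ρ ρ′ a} → S ⊢ ρ ⇓ ρ′ [ a ] →
  ∀ i → length (lookup ρ′ i) ≤ length (lookup ρ i) + a
growth skip i = m≤m+n _ 0
growth {S = push b j} {ρ = ρ} push i with i Fin.≟ j
... | yes refl rewrite Vec.lookup∘updateAt i {b ∷_} ρ = ≤-reflexive (+-comm 1 _)
... | no i≢j   rewrite Vec.lookup∘updateAt′ i j {b ∷_} i≢j ρ = m≤m+n _ 1
growth {S = pop j} {ρ = ρ} pop i with i Fin.≟ j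
... | yes refl rewrite Vec.lookup∘updateAt i {drop 1} ρ | List.length-drop 1 (lookup ρ i) =
  ≤-trans (m∸n≤m _ 1) (m≤m+n _ 1)
... | no i≢j   rewrite Vec.lookup∘updateAt′ i j {drop 1} i≢j ρ = m≤m+n _ 1
growth (_⨟_ {ρ = ρ} {a = a} {b} D E) i = begin
  _                             ≤⟨ growth E i ⟩
  _ + b                         ≤⟨ +-monoˡ-≤ b (growth D i) ⟩
  length (lookup ρ i) + a + b   ≡⟨ +-assoc (length (lookup ρ i)) a b ⟩
  length (lookup ρ i) + (a + b) ≤⟨ +-monoʳ-≤ _ (n≤1+n _) ⟩
  _                             ∎
  where open ≤-Reasoning
growth (branch D) i = ≤-trans (growth D i) (+-monoʳ-≤ _ (n≤1+n _))
growth (stop _) i = m≤m+n _ 1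
growth (again {ρ = ρ} {a = a} {b} _ D E) i = begin
  _                             ≤⟨ growth E i ⟩
  _ + b                         ≤⟨ +-monoˡ-≤ b (growth D i) ⟩
  length (lookup ρ i) + a + b   ≡⟨ +-assoc (length (lookup ρ i)) a b ⟩
  length (lookup ρ i) + (a + b) ≤⟨ +-monoʳ-≤ _ (m≤n+m _ 2) ⟩
  _                             ∎
  where open ≤-Reasoning
growth (new {j = j} {ρ = ρ} {ρ′} D) i
  with growth D (punchIn j i)
... | le rewrite Vec.insertAt-punchIn ρ j [] i | Vec.insertAt-punchIn ρ′ j [] i = le
growth (at {j = j} {ρ = ρ} {ρ′} eq D) i with punchView j i
... | same rewrite eq = m≤m+n _ _
... | other i with growth D i
... | le rewrite lookup-removeAt ρ j i | lookup-removeAt ρ′ j i = le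

infix 3 _⊢_⇓_≤_

_⊢_⇓_≤_ : ∀ {k} → Stmt k → Vec Word k → Vec Word k → ℕ → Set
S ⊢ ρ ⇓ ρ′ ≤ n = ∃[ c ] (S ⊢ ρ ⇓ ρ′ [ c ]) × c ≤ n

exact : ∀ {k} {S : Stmt k} {ρ ρ′ a} → S ⊢ ρ ⇓ ρ′ [ a ] → S ⊢ ρ ⇓ ρ′ ≤ a
exact D = _ , D , ≤-refl

within : ∀ {k} {S : Stmt k} {ρ ρ′ m n} → m ≤ n → S ⊢ ρ ⇓ ρ′ ≤ m → S ⊢ ρ ⇓ ρ′ ≤ n
within m≤n (c , D , c≤m) = c , D , ≤-trans c≤m m≤n

infixr 4 _⨟≤_
_⨟≤_ : ∀ {k} {S T : Stmt k} {ρ ρ′ ρ″ a b} →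
  S ⊢ ρ ⇓ ρ′ ≤ a → T ⊢ ρ′ ⇓ ρ″ ≤ b → S ⨟ T ⊢ ρ ⇓ ρ″ ≤ suc (a + b)
(c , D , c≤) ⨟≤ (d , E , d≤) = _ , (D ⨟ E) , s≤s (+-mono-≤ c≤ d≤)

infixr 4 seq≤
-- With the intermediate store written out, the updates made by the two derivations only have to be
-- checked against it and not solved for.
seq≤ : ∀ {k} {S T : Stmt k} {ρ ρ″ a b} →
  (ρ′ : Vec Word k) → T ⊢ ρ′ ⇓ ρ″ ≤ b → S ⊢ ρ ⇓ ρ′ ≤ a → S ⨟ T ⊢ ρ ⇓ ρ″ ≤ suc (a + b)
seq≤ ρ′ E D = D ⨟≤ E

syntax seq≤ ρ′ E D = D ⨟⟨ ρ′ ⟩ E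

branch≤ : ∀ {k} {i : Fin k} {f ρ ρ′ a} →
  f (top (lookup ρ i)) ⊢ ρ ⇓ ρ′ ≤ a → branch i f ⊢ ρ ⇓ ρ′ ≤ suc a
branch≤ (c , D , c≤) = _ , branch D , s≤s c≤

again≤ : ∀ {k} {i : Fin k} {S ρ ρ′ ρ″ a b c} → top (lookup ρ i) ≡ just c →
  S ⊢ ρ ⇓ ρ′ ≤ a → while i S ⊢ ρ′ ⇓ ρ″ ≤ b → while i S ⊢ ρ ⇓ ρ″ ≤ 2 + (a + b)
again≤ eq (c , D , c≤) (d , E , d≤) = _ , again eq D E , s≤s (s≤s (+-mono-≤ c≤ d≤))

new≤ : ∀ {k} {j : Fin (suc k)} {S ρ ρ′ a} →
  S ⊢ insertAt ρ j [] ⇓ insertAt ρ′ j [] ≤ a → new j S ⊢ ρ ⇓ ρ′ ≤ a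
new≤ (c , D , c≤) = c , new D , c≤

at≤ : ∀ {k} {j : Fin (suc k)} {S : Stmt k} {ρ ρ′ a} →
  lookup ρ j ≡ lookup ρ′ j → S ⊢ removeAt ρ j ⇓ removeAt ρ′ j ≤ a → at j S ⊢ ρ ⇓ ρ′ ≤ a
at≤ eq (c , D , c≤) = c , at eq D , c≤

-- Compilation to stack machines

data Op : Set where
  keep  : Op
  push  : Bool → Op
  pop   : Op

applyAt : ∀ {n} → Op → Fin n → Vec Word n → Vec Word n
applyAt keep     i σ = σ
applyAt (push b) i σ = updateAt σ i (b ∷_)
applyAt pop      i σ = updateAt σ i (drop 1)

Instr : ℕ → Set → Set
Instr n Q = Fin n × (Symbol → Op × Q)

mapInstr : ∀ {n} {Q Q′ : Set} → (Q → Q′) → Instr n Q → Instr n Q′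
mapInstr h (i , g) = i , λ a → proj₁ (g a) , h (proj₂ (g a))

module _ {n} {Q : Set} (δ : Q → Maybe (Instr n Q)) where

  data Reach : Q → Vec Word n → ℕ → Q → Vec Word n → Set where
    here : ∀ {q σ} → Reach q σ 0 q σ
    next : ∀ {q σ i g t q′ σ′} → δ q ≡ just (i , g) →
      let (o , p) = g (top (lookup σ i)) in
      Reach p (applyAt o i σ) t q′ σ′ → Reach q σ (suc t) q′ σ′

Reach-++ : ∀ {n} {Q : Set} {δ : Q → Maybe (Instr n Q)} {q σ s q′ σ′ t q″ σ″} →
  Reach δ q σ s q′ σ′ → Reach δ q′ σ′ t q″ σ″ → Reach δ q σ (s + t) q″ σ″
Reach-++ here       R′ = R′
Reach-++ (next e R) R′ = next e (Reach-++ R R′)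

Reach-map : ∀ {n} {Q Q₂ : Set} {δ : Q → Maybe (Instr n Q)} {δ₂ : Q₂ → Maybe (Instr n Q₂)}
  (h : Q → Q₂) → (∀ q I → δ q ≡ just I → δ₂ (h q) ≡ just (mapInstr h I)) →
  ∀ {q σ t q′ σ′} → Reach δ q σ t q′ σ′ → Reach δ₂ (h q) σ t (h q′) σ′
Reach-map h e here         = here
Reach-map h e (next eq R) = next (e _ _ eq) (Reach-map h e R)

-- Saturation replaces a proof that the index is in range, so that compilation and formula schemes
-- are plain recursions; `toℕ-clamp` recovers the index where a bound is known.
clamp : ∀ {m} → ℕ → Fin (suc m)
clamp {zero}  n       = zero
clamp {suc m} zero    = zero
clamp {suc m} (suc n) = suc (clamp n)

toℕ-clamp : ∀ {m} n → toℕ (clamp {m} n) ≡ n ⊓ m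
toℕ-clamp {zero}  n       = sym (⊓-zeroʳ n)
toℕ-clamp {suc m} zero    = refl
toℕ-clamp {suc m} (suc n) = cong suc (toℕ-clamp n)

-- Control states are positions in the program. The states of a part embed by a constructor, without
-- renumbering; inside a `branch` the state remembers the symbol that chose the arm.
State : ∀ {k} → Stmt k → Set
State skip         = ⊤
State (push b i)   = Bool
State (pop i)      = Bool
State (S ⨟ T)      = State S ⊎ State T
State (branch i f) = Maybe (Σ[ a ∈ Symbol ] State (f a))
State (while i S)  = Bool ⊎ State S
State (new j S)    = State S
State (at j S)     = State S

entry : ∀ {k} (S : Stmt k) → State S
entry skip         = tt
entry (push b i)   = false
entry (pop i)      = false
entry (S ⨟ T)      = inj₁ (entry S)
entry (branch i f) = nothing
entry (while i S)  = inj₁ false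
entry (new j S)    = entry S
entry (at j S)     = entry S

-- Consecutive parts share their auxiliary stacks, since `new` leaves its stack empty; hence a
-- maximum and not a sum.
depth : ∀ {k} → Stmt k → ℕ
depth skip         = 0
depth (push b i)   = 0
depth (pop i)      = 0
depth (S ⨟ T)      = depth S ⊔ depth T
depth (branch i f) = depth (f nothing) ⊔ (depth (f (just false)) ⊔ depth (f (just true)))
depth (while i S)  = depth S
depth (new j S)    = suc (depth S)
depth (at j S)     = depth S

-- e assigns physical stacks to the k stacks of the program; the physical
-- stacks from b on are free.
compile : ∀ {m k} (S : Stmt k) → Vec (Fin (suc m)) k → ℕ → State S → Maybe (Instr (suc m) (State S))
compile skip         e b _     = nothing
compile (push c i)   e b false = just (lookup e i , λ _ → push c , true)
compile (push c i)   e b true  = nothing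
compile (pop i)      e b false = just (lookup e i , λ _ → pop , true)
compile (pop i)      e b true  = nothing
compile (S ⨟ T)      e b (inj₁ q) with compile S e b q
... | just I  = just (mapInstr inj₁ I)
-- A halted first part is left by a step that changes no stack; stack `zero` is a dummy.
... | nothing = just (zero , λ _ → keep , inj₂ (entry T))
compile (S ⨟ T)      e b (inj₂ q) = Maybe.map (mapInstr inj₂) (compile T e b q)
compile (branch i f) e b nothing  = just (lookup e i , λ a → keep , just (a , entry (f a)))
compile (branch i f) e b (just (a , q)) =
  Maybe.map (mapInstr λ p → just (a , p)) (compile (f a) e b q)
compile (while i S)  e b (inj₁ false) =
  just (lookup e i , λ { nothing → keep , inj₁ true ; (just _) → keep , inj₂ (entry S) })
compile (while i S)  e b (inj₁ true)  = nothing
compile (while i S)  e b (inj₂ q) with compile S e b q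
... | just I  = just (mapInstr inj₂ I)
... | nothing = just (zero , λ _ → keep , inj₁ false)
compile (new j S)    e b q = compile S (insertAt e j (clamp b)) (suc b) q
compile (at j S)     e b q = compile S (removeAt e j) b q

module _ {m k} (e : Vec (Fin (suc m)) k) (b : ℕ) where

  Separate : Set
  Separate = (∀ i j → lookup e i ≡ lookup e j → i ≡ j) × (∀ i → toℕ (lookup e i) < b)

  Represents : Vec Word k → Vec Word (suc m) → Set
  Represents ρ σ =
    (∀ i → lookup σ (lookup e i) ≡ lookup ρ i) × (∀ x → b ≤ toℕ x → lookup σ x ≡ [])

  -- The stacks below `b` that `e` does not name are those hidden by an enclosing `at`, which relies
  -- on their being unchanged.
  Frame : Vec Word (suc m) → Vec Word (suc m) → Set
  Frame σ σ′ = ∀ x → toℕ x < b → (∀ i → lookup e i ≢ x) → lookup σ′ x ≡ lookup σ x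

  represents-update : Separate → ∀ ρ σ i f → Represents ρ σ →
    Represents (updateAt ρ i f) (updateAt σ (lookup e i) f)
  represents-update (inj , below) ρ σ i f (rep , free) = rep′ , free′
    where
    rep′ : ∀ j → lookup (updateAt σ (lookup e i) f) (lookup e j) ≡ lookup (updateAt ρ i f) j
    rep′ j with j Fin.≟ i
    ... | yes refl = trans (Vec.lookup∘updateAt (lookup e i) σ)
                       (trans (cong f (rep i)) (sym (Vec.lookup∘updateAt i ρ)))
    ... | no j≢i   = trans (Vec.lookup∘updateAt′ _ _ (j≢i ∘ inj j i) σ)
                       (trans (rep j) (sym (Vec.lookup∘updateAt′ j i j≢i ρ)))
    free′ : ∀ x → b ≤ toℕ x → lookup (updateAt σ (lookup e i) f) x ≡ []
    free′ x b≤x = trans (Vec.lookup∘updateAt′ x _ x≢ σ) (free x b≤x)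
      where
      x≢ : x ≢ lookup e i
      x≢ refl = <⇒≱ (below i) b≤x

  frame-update : ∀ σ i f → Frame σ (updateAt σ (lookup e i) f)
  frame-update σ i f x _ x∉e = Vec.lookup∘updateAt′ x _ (x∉e i ∘ sym) σ

punch-separate : ∀ {m k} (e : Vec (Fin (suc m)) (suc k)) b j → Separate e b → Separate (removeAt e j) b
punch-separate e b j (inj , below) =
  (λ i i′ eq → Fin.punchIn-injective j i i′ (inj _ _ (begin
    lookup e (punchIn j i)   ≡⟨ lookup-removeAt e j i ⟨
    lookup (removeAt e j) i  ≡⟨ eq ⟩
    lookup (removeAt e j) i′ ≡⟨ lookup-removeAt e j i′ ⟩
    lookup e (punchIn j i′)  ∎))) ,
  (λ i → subst (λ x → toℕ x < b) (sym (lookup-removeAt e j i)) (below _))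
  where open Relation.Binary.PropositionalEquality.≡-Reasoning

insert-separate : ∀ {m k} (e : Vec (Fin (suc m)) k) b j → b ≤ m → Separate e b →
  Separate (insertAt e j (clamp b)) (suc b)
insert-separate {m} e b j b≤m (inj , below) = inj′ , below′
  where
  c = clamp b
  toℕ-c : toℕ (clamp {m} b) ≡ b
  toℕ-c = trans (toℕ-clamp b) (m≤n⇒m⊓n≡m b≤m)
  c∉e : ∀ i → lookup e i ≢ c
  c∉e i eq = <-irrefl (trans (cong toℕ eq) toℕ-c) (below i)
  inj′ : ∀ i i′ → lookup (insertAt e j c) i ≡ lookup (insertAt e j c) i′ → i ≡ i′
  inj′ i i′ eq with punchView j i | punchView j i′
  ... | same    | same    = refl
  ... | same    | other l rewrite Vec.insertAt-lookup e j c | Vec.insertAt-punchIn e j c l =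
    ⊥-elim (c∉e l (sym eq))
  ... | other l | same    rewrite Vec.insertAt-lookup e j c | Vec.insertAt-punchIn e j c l =
    ⊥-elim (c∉e l eq)
  ... | other l | other l′ rewrite Vec.insertAt-punchIn e j c l | Vec.insertAt-punchIn e j c l′ =
    cong (punchIn j) (inj l l′ eq)
  below′ : ∀ i → toℕ (lookup (insertAt e j c) i) < suc b
  below′ i with punchView j i
  ... | same    rewrite Vec.insertAt-lookup e j c | toℕ-c = ≤-refl
  ... | other l rewrite Vec.insertAt-punchIn e j c l = m≤n⇒m≤1+n (below l)

private
  ⊔ˡ : ∀ x y {b c} → (x ⊔ y) + b ≤ c → x + b ≤ c
  ⊔ˡ x y {b} le = ≤-trans (+-monoˡ-≤ b (m≤m⊔n x y)) le
  ⊔ʳ : ∀ x y {b c} → (x ⊔ y) + b ≤ c → y + b ≤ c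
  ⊔ʳ x y {b} le = ≤-trans (+-monoˡ-≤ b (m≤n⊔m x y)) le

branch-depth : ∀ {k} (f : Symbol → Stmt k) i a → depth (f a) ≤ depth (branch i f)
branch-depth f i nothing      = m≤m⊔n _ _
branch-depth f i (just false) = ≤-trans (m≤m⊔n _ _) (m≤n⊔m (depth (f nothing)) _)
branch-depth f i (just true)  =
  ≤-trans (m≤n⊔m (depth (f (just false))) _) (m≤n⊔m (depth (f nothing)) _)

frame-trans : ∀ {m k} (e : Vec (Fin (suc m)) k) b σ σ′ σ″ →
  Frame e b σ σ′ → Frame e b σ′ σ″ → Frame e b σ σ″
frame-trans e b σ σ′ σ″ F F′ x x<b x∉e = trans (F′ x x<b x∉e) (F x x<b x∉e)

-- The induction is on the derivation, so that loops need no separate measure. Since all stacks from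
-- `b` on are empty, `new` finds an empty stack at `b`; the emptiness that `new` demands at its end
-- restores this invariant.
compile-correct : ∀ {m k} {S : Stmt k} {ρ ρ′ a} → S ⊢ ρ ⇓ ρ′ [ a ] →
  ∀ (e : Vec (Fin (suc m)) k) b σ → Separate e b → depth S + b ≤ suc m → Represents e b ρ σ →
  ∃₂ λ q σ′ → Reach (compile S e b) (entry S) σ a q σ′ ×
    compile S e b q ≡ nothing × Represents e b ρ′ σ′ × Frame e b σ σ′
compile-correct skip e b σ sep d rep = _ , _ , here , refl , rep , λ _ _ _ → refl
compile-correct (push {i = i} {ρ}) e b σ sep d rep =
  _ , _ , next refl here , refl , represents-update e b sep ρ σ i _ rep , frame-update e b σ i _
compile-correct (pop {i = i} {ρ}) e b σ sep d rep =
  _ , _ , next refl here , refl , represents-update e b sep ρ σ i _ rep , frame-update e b σ i _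
compile-correct {S = S ⨟ T} (_⨟_ {a = s} {t} D E) e b σ sep d rep
  with compile-correct D e b σ sep (⊔ˡ (depth S) (depth T) d) rep
... | q , σ′ , R , hq , rep′ , fr
  with compile-correct E e b σ′ sep (⊔ʳ (depth S) (depth T) d) rep′
... | q′ , σ″ , R′ , hq′ , rep″ , fr′ =
  inj₂ q′ , σ″ ,
  subst (λ n → Reach (compile (S ⨟ T) e b) (inj₁ (entry S)) σ n (inj₂ q′) σ″) (+-suc s t)
    (Reach-++ (Reach-map inj₁ inˡ R) (next (jump hq) (Reach-map inj₂ inʳ R′))) ,
  halt , rep″ , frame-trans e b σ σ′ σ″ fr fr′
  where
  inˡ : ∀ q I → compile S e b q ≡ just I → compile (S ⨟ T) e b (inj₁ q) ≡ just (mapInstr inj₁ I)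
  inˡ q I eq with compile S e b q
  inˡ q I refl | just .I = refl
  jump : compile S e b q ≡ nothing →
    compile (S ⨟ T) e b (inj₁ q) ≡ just (zero , λ _ → keep , inj₂ (entry T))
  jump eq with compile S e b q
  jump refl | nothing = refl
  inʳ : ∀ q I → compile T e b q ≡ just I → compile (S ⨟ T) e b (inj₂ q) ≡ just (mapInstr inj₂ I)
  inʳ q I eq rewrite eq = refl
  halt : compile (S ⨟ T) e b (inj₂ q′) ≡ nothing
  halt rewrite hq′ = refl
compile-correct {S = branch i f} (branch {ρ = ρ} D) e b σ sep d rep
  with compile-correct D e b σ sep
         (≤-trans (+-monoˡ-≤ b (branch-depth f i (top (lookup ρ i)))) d) rep
... | q , σ′ , R , hq , rep′ , fr =
  just (a , q) , σ′ ,
  next refl (subst (λ c → Reach (compile (branch i f) e b) (just (c , entry (f c))) σ _ (just (a , q)) σ′)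
    (cong top (sym (proj₁ rep i))) (Reach-map (λ p → just (a , p)) inside R)) ,
  halt , rep′ , fr
  where
  a = top (lookup ρ i)
  inside : ∀ q I → compile (f a) e b q ≡ just I →
    compile (branch i f) e b (just (a , q)) ≡ just (mapInstr (λ p → just (a , p)) I)
  inside q I eq rewrite eq = refl
  halt : compile (branch i f) e b (just (a , q)) ≡ nothing
  halt rewrite hq = refl
compile-correct {S = while i S} (stop eq) e b σ sep d rep =
  inj₁ true , σ , exit , refl , rep , λ _ _ _ → refl
  where
  exit : Reach (compile (while i S) e b) (inj₁ false) σ 1 (inj₁ true) σ
  -- The constructor `next` is abstracted together with the scanned symbol, so that its successor
  -- state reduces in each case.
  exit with top (lookup σ (lookup e i)) in eq′
         | next {δ = compile (while i S) e b} {q = inj₁ false} {σ} {t = 0} {q′ = inj₁ true} {σ} refl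
  ... | nothing | k = k here
  ... | just c  | _ with () ← trans (sym eq′) (trans (cong top (proj₁ rep i)) eq)
compile-correct {S = while i S} (again {a = s} {t} {c} eq D E) e b σ sep d rep
  with compile-correct D e b σ sep d rep
... | q , σ′ , R , hq , rep′ , fr
  with compile-correct E e b σ′ sep d rep′
... | q′ , σ″ , R′ , hq′ , rep″ , fr′ =
  q′ , σ″ , enter , hq′ , rep″ , frame-trans e b σ σ′ σ″ fr fr′
  where
  δ = compile (while i S) e b
  inside : ∀ q I → compile S e b q ≡ just I → δ (inj₂ q) ≡ just (mapInstr inj₂ I)
  inside q I eq with compile S e b q
  inside q I refl | just .I = refl
  back : compile S e b q ≡ nothing → δ (inj₂ q) ≡ just (zero , λ _ → keep , inj₁ false)
  back eq with compile S e b q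
  back refl | nothing = refl
  body : Reach δ (inj₂ (entry S)) σ (suc (s + t)) q′ σ″
  body = subst (λ n → Reach δ (inj₂ (entry S)) σ n q′ σ″) (+-suc s t)
    (Reach-++ (Reach-map inj₂ inside R) (next (back hq) R′))
  enter : Reach δ (inj₁ false) σ (2 + (s + t)) q′ σ″
  enter with top (lookup σ (lookup e i)) in eq′
           | next {δ = δ} {q = inj₁ false} {σ} {t = suc (s + t)} {q′ = q′} {σ″} refl
  ... | just _  | k = k body
  ... | nothing | _ with () ← trans (sym eq′) (trans (cong top (proj₁ rep i)) eq)
compile-correct {m} {S = new j S} (new {ρ = ρ} {ρ′} D) e b σ sep d (rep , free)
  with compile-correct D (insertAt e j (clamp b)) (suc b) σ
         (insert-separate e b j b≤m sep) (≤-trans (≤-reflexive (+-suc (depth S) b)) d) (rep₀ , λ x b<x → free x (<⇒≤ b<x))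
  where
  b≤m : b ≤ m
  b≤m = ≤-pred (≤-trans (s≤s (m≤n+m b (depth S))) d)
  rep₀ : ∀ i → lookup σ (lookup (insertAt e j (clamp b)) i) ≡ lookup (insertAt ρ j []) i
  rep₀ i with punchView j i
  ... | same rewrite Vec.insertAt-lookup e j (clamp b) | Vec.insertAt-lookup ρ j [] =
    free (clamp b) (≤-reflexive (sym (trans (toℕ-clamp b) (m≤n⇒m⊓n≡m b≤m))))
  ... | other l rewrite Vec.insertAt-punchIn e j (clamp b) l | Vec.insertAt-punchIn ρ j [] l = rep l
... | q , σ′ , R , hq , (rep′ , free′) , fr =
  q , σ′ , R , hq , (rep″ , free″) , fr″
  where
  c = clamp b
  b≤m : b ≤ m
  b≤m = ≤-pred (≤-trans (s≤s (m≤n+m b (depth S))) d)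
  toℕ-c : toℕ (clamp {m} b) ≡ b
  toℕ-c = trans (toℕ-clamp b) (m≤n⇒m⊓n≡m b≤m)
  rep″ : ∀ i → lookup σ′ (lookup e i) ≡ lookup ρ′ i
  rep″ i with rep′ (punchIn j i)
  ... | eq rewrite Vec.insertAt-punchIn e j c i | Vec.insertAt-punchIn ρ′ j [] i = eq
  free″ : ∀ x → b ≤ toℕ x → lookup σ′ x ≡ []
  free″ x b≤x with m≤n⇒m<n∨m≡n b≤x
  ... | inj₁ b<x = free′ x b<x
  ... | inj₂ b≡x with Fin.toℕ-injective {i = c} {j = x} (trans toℕ-c b≡x) | rep′ j
  ... | refl | eq rewrite Vec.insertAt-lookup e j c | Vec.insertAt-lookup ρ′ j [] = eq
  fr″ : Frame e b σ σ′
  fr″ x x<b x∉e = fr x (m≤n⇒m≤1+n x<b) x∉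
    where
    x∉ : ∀ i → lookup (insertAt e j c) i ≢ x
    x∉ i eq with punchView j i
    ... | same rewrite Vec.insertAt-lookup e j c = <-irrefl (trans (cong toℕ (sym eq)) toℕ-c) x<b
    ... | other l rewrite Vec.insertAt-punchIn e j c l = x∉e l eq
compile-correct {S = at j S} (at {ρ = ρ} {ρ′} ρj D) e b σ sep d (rep , free)
  with compile-correct D (removeAt e j) b σ (punch-separate e b j sep) d (rep₀ , free)
  where
  rep₀ : ∀ i → lookup σ (lookup (removeAt e j) i) ≡ lookup (removeAt ρ j) i
  rep₀ i rewrite lookup-removeAt e j i | lookup-removeAt ρ j i = rep (punchIn j i)
... | q , σ′ , R , hq , (rep′ , free′) , fr =
  q , σ′ , R , hq , (rep″ , free′) , fr″
  where
  rep″ : ∀ i → lookup σ′ (lookup e i) ≡ lookup ρ′ i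
  rep″ i with punchView j i
  -- The hidden stack is outside the range of `removeAt e j`, so the frame condition of the inner
  -- program preserves it.
  ... | same = trans (fr (lookup e j) (proj₂ sep j) j∉) (trans (rep j) ρj)
    where
    j∉ : ∀ l → lookup (removeAt e j) l ≢ lookup e j
    j∉ l eq rewrite lookup-removeAt e j l = Fin.punchInᵢ≢i j l (proj₁ sep _ _ eq)
  ... | other l with rep′ l
  ... | eq rewrite lookup-removeAt e j l | lookup-removeAt ρ′ j l = eq
  fr″ : Frame e b σ σ′
  fr″ x x<b x∉e = fr x x<b λ l eq → x∉e (punchIn j l) (trans (sym (lookup-removeAt e j l)) eq)

-- A retract of `Fin card` is enough: a machine started at an encoded state moves only between
-- encoded states, so surplus numbers do no harm.
record Finite (A : Set) : Set where
  field
    card    : ℕ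
    encode  : A → Fin card
    decode  : Fin card → A
    decode-encode : ∀ a → decode (encode a) ≡ a


⊤-finite : Finite ⊤
⊤-finite = record { card = 1 ; encode = λ _ → zero ; decode = λ _ → tt ; decode-encode = λ _ → refl }

Bool-finite : Finite Bool
Bool-finite = record
  { card = 2
  ; encode = λ { false → zero ; true → suc zero }
  ; decode = λ { zero → false ; (suc _) → true }
  ; decode-encode = λ { false → refl ; true → refl }
  }

Fin-finite : ∀ n → Finite (Fin n)
Fin-finite n = record { card = n ; encode = id ; decode = id ; decode-encode = λ _ → refl }

retract-finite : ∀ {A B : Set} (f : A → B) (g : B → A) → (∀ a → g (f a) ≡ a) → Finite B → Finite A
retract-finite f g gf F = record
  { card = Finite.card F
  ; encode = Finite.encode F ∘ f
  ; decode = g ∘ Finite.decode F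
  ; decode-encode = λ a → trans (cong g (Finite.decode-encode F (f a))) (gf a)
  }

⊎-finite : ∀ {A B : Set} → Finite A → Finite B → Finite (A ⊎ B)
⊎-finite F G = record
  { card = Finite.card F + Finite.card G
  ; encode = λ { (inj₁ a) → Finite.encode F a ↑ˡ Finite.card G ; (inj₂ b) → Finite.card F ↑ʳ Finite.encode G b }
  ; decode = λ i → Data.Sum.Base.map (Finite.decode F) (Finite.decode G) (splitAt (Finite.card F) i)
  ; decode-encode = λ
      { (inj₁ a) → trans (cong (Data.Sum.Base.map _ _) (Fin.splitAt-↑ˡ (Finite.card F) _ _))
                     (cong inj₁ (Finite.decode-encode F a))
      ; (inj₂ b) → trans (cong (Data.Sum.Base.map _ _) (Fin.splitAt-↑ʳ (Finite.card F) _ _))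
                     (cong inj₂ (Finite.decode-encode G b)) }
  }
  where import Data.Sum.Base

×-finite : ∀ {A B : Set} → Finite A → Finite B → Finite (A × B)
×-finite F G = record
  { card = Finite.card F * Finite.card G
  ; encode = λ (a , b) → combine (Finite.encode F a) (Finite.encode G b)
  ; decode = λ i → let (x , y) = remQuot (Finite.card G) i in Finite.decode F x , Finite.decode G y
  ; decode-encode = λ (a , b) →
      trans (cong (λ (x , y) → Finite.decode F x , Finite.decode G y) (Fin.remQuot-combine (Finite.encode F a) (Finite.encode G b)))
        (cong₂ _,_ (Finite.decode-encode F a) (Finite.decode-encode G b))
  }

Maybe-finite : ∀ {A : Set} → Finite A → Finite (Maybe A)
Maybe-finite F = retract-finite
  (λ { nothing → inj₁ tt ; (just a) → inj₂ a })
  (λ { (inj₁ _) → nothing ; (inj₂ a) → just a })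
  (λ { nothing → refl ; (just _) → refl }) (⊎-finite ⊤-finite F)

Symbol-finite : ∀ {B : Symbol → Set} → (∀ a → Finite (B a)) → Finite (Σ[ a ∈ Symbol ] B a)
Symbol-finite {B} F = retract-finite {B = B nothing ⊎ (B (just false) ⊎ B (just true))}
  (λ { (nothing , x) → inj₁ x ; (just false , x) → inj₂ (inj₁ x) ; (just true , x) → inj₂ (inj₂ x) })
  (λ { (inj₁ x) → _ , x ; (inj₂ (inj₁ x)) → _ , x ; (inj₂ (inj₂ x)) → _ , x })
  (λ { (nothing , x) → refl ; (just false , x) → refl ; (just true , x) → refl })
  (⊎-finite (F _) (⊎-finite (F _) (F _)))

State-finite : ∀ {k} (S : Stmt k) → Finite (State S)
State-finite skip         = ⊤-finite
State-finite (push b i)   = Bool-finite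
State-finite (pop i)      = Bool-finite
State-finite (S ⨟ T)      = ⊎-finite (State-finite S) (State-finite T)
State-finite (branch i f) = Maybe-finite (Symbol-finite λ a → State-finite (f a))
State-finite (while i S)  = ⊎-finite Bool-finite (State-finite S)
State-finite (new j S)    = State-finite S
State-finite (at j S)     = State-finite S

-- Stack machines as Turing machines

-- A stack is held on a tape with its top under the head and nothing to the
-- left of the head.
data OnRight : Word → List Symbol → Set where
  []  : ∀ {l} → All (_≡ nothing) l → OnRight [] l
  _∷_ : ∀ b {w l} → OnRight w l → OnRight (b ∷ w) (just b ∷ l)

Holds : Word → Tape → Set
Holds w t = All (_≡ nothing) (Tape.before t) × OnRight w (Tape.head t ∷ Tape.after t)

holds-blank : Holds [] blankTape
holds-blank = [] , [] (refl ∷ [])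

holds-load : ∀ w → Holds w (load w)
holds-load []      = holds-blank
holds-load (b ∷ w) = [] , b ∷ onRight w
  where
  onRight : ∀ w → OnRight w (List.map just w)
  onRight []      = [] []
  onRight (b ∷ w) = b ∷ onRight w

holds-contents : ∀ {w t} → Holds w t → contents t ≡ w
holds-contents (_ , R) = go R
  where
  go : ∀ {w l} → OnRight w l → unblank l ≡ w
  go ([] [])         = refl
  go ([] (refl ∷ _)) = refl
  go (b ∷ R)         = cong (b ∷_) (go R)

holds-top : ∀ {w t} → Holds w t → Tape.head t ≡ top w
holds-top (_ , [] (refl ∷ _)) = refl
holds-top (_ , (b ∷ _))       = refl

holds-pop : ∀ {w t} → Holds w t → Holds (drop 1 w) (act (nothing , right) t)
holds-pop {t = tape ls h []}      (L , [] _)        = refl ∷ L , [] (refl ∷ [])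
holds-pop {t = tape ls h []}      (L , (b ∷ [] _))  = refl ∷ L , [] (refl ∷ [])
holds-pop {t = tape ls h (r ∷ rs)} (L , [] (_ ∷ R)) = refl ∷ L , [] R
holds-pop {t = tape ls h (r ∷ rs)} (L , (b ∷ R))    = refl ∷ L , R

holds-push : ∀ {w} t b → Holds w t → Holds (b ∷ w) (act (just b , stay) (act (Tape.head t , left) t))
holds-push (tape [] h rs)       b (L , R)     = [] , b ∷ R
holds-push (tape (l ∷ ls) h rs) b (_ ∷ L , R) = L , b ∷ R

module _ (M : TM) where
  open TM M

  run-next : ∀ t q ts {q′ acts} → δ q (Vec.map Tape.head ts) ≡ just (q′ , acts) →
    run M (suc t) (q , ts) ≡ run M t (q′ , Vec.zipWith act acts ts)
  run-next t q ts eq rewrite eq = refl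

  run-halt : ∀ t q ts → δ q (Vec.map Tape.head ts) ≡ nothing →
    run M t (q , ts) ≡ just (output M (q , ts))
  run-halt zero    q ts eq rewrite eq = refl
  run-halt (suc t) q ts eq rewrite eq = refl

actAt : ∀ {n} → Fin n → Symbol × Move → Vec Symbol n → Vec (Symbol × Move) n
actAt i a as = updateAt (Vec.map (_, stay) as) i (λ _ → a)

zipWith-actAt : ∀ {n} (i : Fin n) a ts →
  Vec.zipWith act (actAt i a (Vec.map Tape.head ts)) ts ≡ updateAt ts i (act a)
zipWith-actAt zero    a (t ∷ ts) = cong (act a t ∷_) (idle ts)
  where
  idle : ∀ {n} (ts : Vec Tape n) → Vec.zipWith act (Vec.map (_, stay) (Vec.map Tape.head ts)) ts ≡ ts
  idle []       = refl
  idle (t ∷ ts) = cong (t ∷_) (idle ts)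
zipWith-actAt (suc i) a (t ∷ ts) = cong (t ∷_) (zipWith-actAt i a ts)

module ToTM {w} {Q : Set} (F : Finite Q) (q₀ : Q) (δ : Q → Maybe (Instr (3 + w) Q)) where
  -- A pushed symbol is written one step after the head has moved left.
  State′ : Finite (Q × Maybe (Fin (3 + w) × Bool))
  State′ = ×-finite F (Maybe-finite (×-finite (Fin-finite _) Bool-finite))

  open Finite State′

  transition : Q × Maybe (Fin (3 + w) × Bool) → Vec Symbol (3 + w) →
    Maybe (Fin card × Vec (Symbol × Move) (3 + w))
  perform : Op × Q → Fin (3 + w) → Vec Symbol (3 + w) → Fin card × Vec (Symbol × Move) (3 + w)
  perform (keep   , q) i as = encode (q , nothing) , actAt i (lookup as i , stay) as
  perform (pop    , q) i as = encode (q , nothing) , actAt i (nothing , right) as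
  perform (push b , q) i as = encode (q , just (i , b)) , actAt i (lookup as i , left) as
  transition (q , just (i , b)) as = just (encode (q , nothing) , actAt i (just b , stay) as)
  transition (q , nothing) as = Maybe.map (λ (i , g) → perform (g (lookup as i)) i as) (δ q)

  machine : TM
  machine = record
    { states = card ; workTapes = w ; start = encode (q₀ , nothing) ; δ = transition ∘ decode }

  Hold : Vec Word (3 + w) → Vec Tape (3 + w) → Set
  Hold σ ts = ∀ i → Holds (lookup σ i) (lookup ts i)

  -- Quantifying over the remaining fuel `t` lets partial runs compose by transitivity, without any
  -- assumption on halting.
  _⇝[_]_ : Config machine → ℕ → Config machine → Set
  c ⇝[ n ] c′ = ∀ t → run machine (n + t) c ≡ run machine t c′

  hold-update : ∀ σ ts i f g → (Holds (lookup σ i) (lookup ts i) → Holds (f (lookup σ i)) (g (lookup ts i))) →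
    Hold σ ts → Hold (updateAt σ i f) (updateAt ts i g)
  hold-update σ ts i f g fg H j with j Fin.≟ i
  ... | yes refl = subst₂ Holds (sym (Vec.lookup∘updateAt i σ)) (sym (Vec.lookup∘updateAt i ts)) (fg (H i))
  ... | no j≢i   = subst₂ Holds (sym (Vec.lookup∘updateAt′ j i j≢i σ))
                     (sym (Vec.lookup∘updateAt′ j i j≢i ts)) (H j)

  one : ∀ q ts {q′ i a} → transition q (Vec.map Tape.head ts) ≡ just (q′ , actAt i a (Vec.map Tape.head ts)) →
    (encode q , ts) ⇝[ 1 ] (q′ , updateAt ts i (act a))
  one q ts {q′} {i} {a} eq t = trans
    (run-next machine t (encode q) ts (trans (cong (λ p → transition p (Vec.map Tape.head ts)) (decode-encode q)) eq))
    (cong (λ us → run machine t (q′ , us)) (zipWith-actAt i a ts))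

  -- The factor 2 is due to `push`, which takes one step to move the head and one to write.
  simulate : ∀ {q σ s q′ σ′} → Reach δ q σ s q′ σ′ → ∀ ts → Hold σ ts →
    ∃₂ λ n ts′ → n ≤ 2 * s × (encode (q , nothing) , ts) ⇝[ n ] (encode (q′ , nothing) , ts′) × Hold σ′ ts′
  simulate here ts H = 0 , ts , z≤n , (λ t → refl) , H
  simulate {q} {σ} (next {i = i} {g} {t = s} eq R) ts H = continue (g (top (lookup σ i))) refl R
    where
    as = Vec.map Tape.head ts
    see : lookup as i ≡ top (lookup σ i)
    see = trans (Vec.lookup-map i Tape.head ts) (holds-top (H i))
    first : transition (q , nothing) as ≡ just (perform (g (top (lookup σ i))) i as)
    first rewrite eq | see = refl
    continue : ∀ op → g (top (lookup σ i)) ≡ op → Reach δ (proj₂ op) (applyAt (proj₁ op) i σ) s _ _ → _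
    continue (keep , p) e R with simulate R ts H
    ... | n , ts′ , n≤ , sim , H′ = suc n , ts′ , ≤-trans (s≤s n≤) (≤-trans (n≤1+n _) (≤-reflexive (sym (*-suc 2 s)))) ,
      (λ t → trans (one (q , nothing) ts (trans first (cong (λ o → just (perform o i as)) e)) (n + t))
        (trans (cong (λ us → run machine (n + t) (_ , us)) idle) (sim t))) , H′
      where
      idle : updateAt ts i (act (lookup as i , stay)) ≡ ts
      idle = Vec.updateAt-id-local i ts (cong (λ a → record (lookup ts i) { head = a }) (Vec.lookup-map i Tape.head ts))
    continue (pop , p) e R with simulate R (updateAt ts i (act (nothing , right)))
                                  (hold-update σ ts i (drop 1) (act (nothing , right)) (holds-pop) H)
    ... | n , ts′ , n≤ , sim , H′ = suc n , ts′ , ≤-trans (s≤s n≤) (≤-trans (n≤1+n _) (≤-reflexive (sym (*-suc 2 s)))) ,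
      (λ t → trans (one (q , nothing) ts (trans first (cong (λ o → just (perform o i as)) e)) (n + t)) (sim t)) , H′
    continue (push b , p) e R
      with simulate R (updateAt (updateAt ts i (act (lookup as i , left))) i (act (just b , stay))) hold
      where
      hold : Hold (updateAt σ i (b ∷_)) (updateAt (updateAt ts i (act (lookup as i , left))) i (act (just b , stay)))
      hold = subst (Hold (updateAt σ i (b ∷_)))
        (sym (Vec.updateAt-updateAt i ts))
        (hold-update σ ts i (b ∷_) (act (just b , stay) ∘ act (lookup as i , left))
          (λ h → subst (λ a → Holds (b ∷ lookup σ i) (act (just b , stay) (act (a , left) (lookup ts i))))
            (sym (Vec.lookup-map i Tape.head ts)) (holds-push (lookup ts i) b h)) H)
    ... | n , ts′ , n≤ , sim , H′ = 2 + n , ts′ , ≤-trans (s≤s (s≤s n≤)) (≤-reflexive (sym (*-suc 2 s))) ,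
      (λ t → trans (one (q , nothing) ts (trans first (cong (λ o → just (perform o i as)) e)) (suc n + t))
        (trans (one (p , just (i , b)) (updateAt ts i (act (lookup as i , left))) refl (n + t)) (sim t))) , H′

  simulate-halt : ∀ {q σ s q′ σ′} → Reach δ q σ s q′ σ′ → δ q′ ≡ nothing → ∀ ts → Hold σ ts →
    run machine (2 * s) (encode (q , nothing) , ts) ≡ just (lookup σ′ 2F)
  simulate-halt {q} {σ} {s} {q′} {σ′} R halt ts H with simulate R ts H
  ... | n , ts′@(_ ∷ _ ∷ _ ∷ _) , n≤ , sim , H′ = begin
    run machine (2 * s) (encode (q , nothing) , ts)           ≡⟨ cong (λ t → run machine t (encode (q , nothing) , ts)) (m+[n∸m]≡n n≤) ⟨
    run machine (n + (2 * s ∸ n)) (encode (q , nothing) , ts) ≡⟨ sim _ ⟩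
    run machine (2 * s ∸ n) (encode (q′ , nothing) , ts′)     ≡⟨ run-halt machine (2 * s ∸ n) _ ts′ halted ⟩
    just (contents (lookup ts′ 2F))             ≡⟨ cong just (holds-contents (H′ 2F)) ⟩
    just (lookup σ′ 2F)                         ∎
    where
    open ≡-Reasoning
    halted : transition (decode (encode (q′ , nothing))) (Vec.map Tape.head ts′) ≡ nothing
    halted rewrite decode-encode (q′ , nothing {A = Fin (3 + w) × Bool}) | halt = refl

run-mono : ∀ M {s t c v} → s ≤ t → run M s c ≡ just v → run M t c ≡ just v
run-mono M {zero} {zero}  {c} s≤t eq = eq
run-mono M {zero} {suc t} {c} s≤t eq with step M c
... | nothing = eq
run-mono M {suc s} {suc t} {c} (s≤s s≤t) eq with step M c
... | nothing = eq
... | just c′ = run-mono M {s} {t} {c′} s≤t eq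

-- Polynomial-time functions

total : ∀ {k} → Vec Word k → ℕ
total []      = 0
total (w ∷ ρ) = length w + total ρ

-- Stack 0 of the code is a destination: the result is put in front of whatever is there, and the
-- arguments are restored. Concatenation then needs no copying (the second word is produced first),
-- and a loop accumulates its output in place.
record FP (k : ℕ) : Set where
  field
    fun  : Vec Word k → Word
    code : Stmt (suc k)
    cost : PolyExpr
    spec : ∀ ρ w → code ⊢ w ∷ ρ ⇓ (fun ρ ++ w) ∷ ρ ≤ ⟪ cost ⟫ (total ρ)

  spec₀ : ∀ ρ → code ⊢ [] ∷ ρ ⇓ fun ρ ∷ ρ ≤ ⟪ cost ⟫ (total ρ)
  spec₀ ρ = subst (λ w → code ⊢ [] ∷ ρ ⇓ w ∷ ρ ≤ ⟪ cost ⟫ (total ρ)) (List.++-identityʳ (fun ρ)) (spec ρ [])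

  fun-length : ∀ ρ → length (fun ρ) ≤ ⟪ cost ⟫ (total ρ)
  fun-length ρ with spec₀ ρ
  ... | c , D , c≤ = ≤-trans (growth D zero) c≤

open FP public

clear : ∀ {k} → Stmt (suc k)
clear = while zero (pop zero)

clear-spec : ∀ {k} w (ρ : Vec Word k) → clear ⊢ w ∷ ρ ⇓ [] ∷ ρ ≤ 3 * length w + 1
clear-spec []      ρ = exact (stop refl)
clear-spec (b ∷ w) ρ =
  within (≤-reflexive (eq (length w))) (again≤ refl (exact pop) (clear-spec w ρ))
  where
  eq : ∀ n → 2 + (1 + (3 * n + 1)) ≡ 3 * suc n + 1
  eq = solve-∀

shift : ∀ {k} → Stmt (2 + k)
shift = while zero (branch zero λ { nothing → skip ; (just c) → pop zero ⨟ push c 1F })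

shift-spec : ∀ {k} v w (ρ : Vec Word k) → shift ⊢ v ∷ w ∷ ρ ⇓ [] ∷ (v List.ʳ++ w) ∷ ρ ≤ 6 * length v + 1
shift-spec []      w ρ = within (m≤n+m _ 0) (exact (stop refl))
shift-spec (b ∷ v) w ρ = within (≤-reflexive (eq (length v)))
  (again≤ refl (branch≤ (exact pop ⨟≤ exact push)) (shift-spec v (b ∷ w) ρ))
  where
  eq : ∀ n → 2 + (4 + (6 * n + 1)) ≡ 6 * suc n + 1
  eq = solve-∀

unshift : ∀ {k} → Stmt (3 + k)
unshift = while 2F (branch 2F λ
  { nothing → skip ; (just c) → pop 2F ⨟ push c zero ⨟ push c 1F })

unshift-spec : ∀ {k} d x t (ρ : Vec Word k) →
  unshift ⊢ d ∷ x ∷ t ∷ ρ ⇓ (t List.ʳ++ d) ∷ (t List.ʳ++ x) ∷ [] ∷ ρ ≤ 8 * length t + 1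
unshift-spec d x []      ρ = exact (stop refl)
unshift-spec d x (b ∷ t) ρ = within (≤-reflexive (eq (length t)))
  (again≤ refl (branch≤ (exact pop ⨟≤ exact push ⨟≤ exact push)) (unshift-spec (b ∷ d) (b ∷ x) t ρ))
  where
  eq : ∀ n → 2 + (6 + (8 * n + 1)) ≡ 8 * suc n + 1
  eq = solve-∀

ʳ++-ʳ++ : ∀ (x d : Word) → (x List.ʳ++ []) List.ʳ++ d ≡ x ++ d
ʳ++-ʳ++ x d = begin
  (x List.ʳ++ []) List.ʳ++ d ≡⟨ List.ʳ++-defn (x List.ʳ++ []) ⟩
  reverse (reverse x) ++ d   ≡⟨ cong (_++ d) (List.reverse-involutive x) ⟩
  x ++ d                     ∎
  where open ≡-Reasoning

copy : ∀ {k} → Stmt (2 + k)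
copy = new 2F (at zero shift ⨟ unshift)

copy-spec : ∀ {k} d x (ρ : Vec Word k) → copy ⊢ d ∷ x ∷ ρ ⇓ (x ++ d) ∷ x ∷ ρ ≤ 14 * length x + 3
copy-spec d x ρ = within (≤-reflexive arith) (new≤
  (at≤ refl (shift-spec x [] ρ) ⨟≤
   subst₂ (λ v w → unshift ⊢ d ∷ [] ∷ (x List.ʳ++ []) ∷ ρ ⇓ v ∷ w ∷ [] ∷ ρ ≤ 8 * length (reverse x) + 1)
     (ʳ++-ʳ++ x d) (trans (ʳ++-ʳ++ x []) (List.++-identityʳ x)) (unshift-spec d [] (reverse x) ρ)))
  where
  eq : ∀ n → suc (6 * n + 1 + (8 * n + 1)) ≡ 14 * n + 3
  eq = solve-∀
  arith : suc (6 * length x + 1 + (8 * length (reverse x) + 1)) ≡ 14 * length x + 3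
  arith rewrite List.length-reverse x = eq (length x)

var : ∀ {k} → Fin k → FP k
var i = record
  { fun = λ ρ → lookup ρ i ; code = prog i ; cost = K 14 ⊗ N ⊕ K 3 ; spec = ok i }
  where
  prog : ∀ {k} → Fin k → Stmt (suc k)
  prog zero    = copy
  prog (suc i) = at 1F (prog i)
  ok : ∀ {k} (i : Fin k) ρ w → prog i ⊢ w ∷ ρ ⇓ (lookup ρ i ++ w) ∷ ρ ≤ 14 * total ρ + 3
  ok zero    (x ∷ ρ) w = within (+-monoˡ-≤ 3 (*-monoʳ-≤ 14 (m≤m+n (length x) _))) (copy-spec w x ρ)
  ok {suc k@(suc _)} (suc i) (x ∷ ρ) w =
    within (+-monoˡ-≤ 3 (*-monoʳ-≤ 14 (m≤n+m _ (length x)))) (at≤ refl (ok i ρ w))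

nil : ∀ {k} → FP k
nil = record { fun = λ _ → [] ; code = skip ; cost = K 0 ; spec = λ ρ w → exact skip }

cons : ∀ {k} → Bool → FP k → FP k
cons b t = record
  { fun  = λ ρ → b ∷ fun t ρ
  ; code = code t ⨟ push b zero
  ; cost = K 1 ⊕ (cost t ⊕ K 1)
  ; spec = λ ρ w → spec t ρ w ⨟≤ exact push
  }

infixr 5 _⊹_
_⊹_ : ∀ {k} → FP k → FP k → FP k
t ⊹ u = record
  { fun  = λ ρ → fun t ρ ++ fun u ρ
  ; code = code u ⨟ code t
  ; cost = K 1 ⊕ (cost u ⊕ cost t)
  ; spec = λ ρ w → spec u ρ w ⨟≤
      subst (λ v → code t ⊢ (fun u ρ ++ w) ∷ ρ ⇓ v ∷ ρ ≤ ⟪ cost t ⟫ (total ρ))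
        (sym (List.++-assoc (fun t ρ) (fun u ρ) w)) (spec t ρ (fun u ρ ++ w))
  }

dispose : ∀ {k} → FP k → PolyExpr
dispose t = K 3 ⊗ cost t ⊕ K 1

dispose-spec : ∀ {k l} (t : FP k) ρ v (σ : Vec Word l) → length v ≤ length (fun t ρ) →
  clear ⊢ v ∷ σ ⇓ [] ∷ σ ≤ ⟪ dispose t ⟫ (total ρ)
dispose-spec t ρ v σ v≤ =
  within (+-monoˡ-≤ 1 (*-monoʳ-≤ 3 (≤-trans v≤ (fun-length t ρ)))) (clear-spec v σ)

-- The body of a `let′` sees one more stack, whose contents are no longer than the time taken to
-- compute them.
inner : ∀ {k} → FP k → PolyExpr → PolyExpr
inner t c = c ⟨∘⟩ (cost t ⊕ N)

inner-≥ : ∀ {k} (t : FP k) c ρ v → length v ≤ length (fun t ρ) →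
  ⟪ c ⟫ (total (v ∷ ρ)) ≤ ⟪ inner t c ⟫ (total ρ)
inner-≥ t c ρ v v≤ = ≤-trans
  (⟪⟫-mono c (+-monoˡ-≤ (total ρ) (≤-trans v≤ (fun-length t ρ))))
  (≤-reflexive (sym (⟪∘⟫ c (cost t ⊕ N) (total ρ))))

let′ : ∀ {k} → FP k → FP (suc k) → FP k
let′ t u = record
  { fun  = λ ρ → fun u (fun t ρ ∷ ρ)
  ; code = new 1F (at zero (code t) ⨟ code u ⨟ at zero clear)
  ; cost = K 1 ⊕ (cost t ⊕ (K 1 ⊕ (inner t (cost u) ⊕ dispose t)))
  ; spec = λ ρ w → new≤
      (at≤ refl (spec₀ t ρ) ⨟≤
       within (inner-≥ t (cost u) ρ (fun t ρ) ≤-refl) (spec u (fun t ρ ∷ ρ) w) ⨟≤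
       at≤ refl (dispose-spec t ρ (fun t ρ) ρ ≤-refl))
  }

caseWord : Word → Word → (Bool → Word → Word) → Word
caseWord []      a g = a
caseWord (b ∷ w) a g = g b w

caseOf : ∀ {k} → FP k → FP k → (Bool → FP (suc k)) → FP k
caseOf t a g = record
  { fun  = λ ρ → caseWord (fun t ρ) (fun a ρ) (λ b w → fun (g b) (w ∷ ρ))
  ; code = new 1F (at zero (code t) ⨟ branch 1F arm)
  ; cost = K 1 ⊕ (cost t ⊕ (K 1 ⊕ (cost a ⊕ (K 3 ⊕ inner t (cost (g false) ⊕ cost (g true)) ⊕ dispose t))))
  ; spec = λ ρ w → new≤ (at≤ refl (spec₀ t ρ) ⨟≤ branch≤ (ok ρ w (fun t ρ) ≤-refl))
  }
  where
  arm : Symbol → Stmt _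
  arm nothing  = at 1F (code a)
  arm (just b) = pop 1F ⨟ code (g b) ⨟ at zero clear
  choose : ∀ b ρ v → length v ≤ length (fun t ρ) →
    ⟪ cost (g b) ⟫ (total (v ∷ ρ)) ≤ ⟪ inner t (cost (g false) ⊕ cost (g true)) ⟫ (total ρ)
  choose false ρ v v≤ = ≤-trans (inner-≥ t (cost (g false)) ρ v v≤) (m≤m+n _ _)
  choose true  ρ v v≤ = ≤-trans (inner-≥ t (cost (g true)) ρ v v≤) (m≤n+m _ _)
  ok : ∀ ρ w v → length v ≤ length (fun t ρ) →
    arm (top v) ⊢ w ∷ v ∷ ρ ⇓ (caseWord v (fun a ρ) (λ b u → fun (g b) (u ∷ ρ)) ++ w) ∷ [] ∷ ρ ≤
    ⟪ cost a ⊕ (K 3 ⊕ inner t (cost (g false) ⊕ cost (g true)) ⊕ dispose t) ⟫ (total ρ)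
  ok ρ w []      v≤ = within (m≤m+n _ _) (at≤ refl (spec a ρ w))
  ok ρ w (b ∷ v) v≤ = within (≤-trans (≤-reflexive (eq (⟪ inner t (cost (g false) ⊕ cost (g true)) ⟫ (total ρ)) (⟪ dispose t ⟫ (total ρ)))) (m≤n+m _ (⟪ cost a ⟫ (total ρ))))
    (exact pop ⨟≤
     within (choose b ρ v (<⇒≤ v≤)) (spec (g b) (v ∷ ρ) w) ⨟≤
     at≤ refl (dispose-spec t ρ v ρ (<⇒≤ v≤)))
    where
    eq : ∀ x y → suc (1 + suc (x + y)) ≡ 3 + x + y
    eq = solve-∀

loopWord : (Bool → Word → Word) → Word → Word
loopWord g []      = []
loopWord g (b ∷ w) = g b w ++ loopWord g w

module _ {k} (t : FP k) (g : Bool → FP (suc k)) where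
  private
    body : Stmt (3 + k)
    body = branch 2F λ
      { nothing  → skip
      ; (just b) → pop 2F ⨟ at 2F (code (g b)) ⨟ push b 1F }

    c : PolyExpr
    c = inner t (cost (g false) ⊕ cost (g true))

    module _ (ρ : Vec Word k) where
      C : Word → Word
      C = loopWord λ b w → fun (g b) (w ∷ ρ)

      choose : ∀ b w → length w ≤ length (fun t ρ) → ⟪ cost (g b) ⟫ (total (w ∷ ρ)) ≤ ⟪ c ⟫ (total ρ)
      choose false w w≤ = ≤-trans (inner-≥ t (cost (g false)) ρ w w≤) (m≤m+n _ _)
      choose true  w w≤ = ≤-trans (inner-≥ t (cost (g true)) ρ w w≤) (m≤n+m _ _)

      -- The list is held reversed on `r` and rebuilt on `w`, so that `w` is always the suffix after
      -- the current bit. Blocks are produced from the last to the first and prepended, hence end in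
      -- the right order.
      iterate : ∀ d w r → length r + length w ≤ length (fun t ρ) →
        while 2F body ⊢ (C w ++ d) ∷ w ∷ r ∷ ρ ⇓ (C (r List.ʳ++ w) ++ d) ∷ (r List.ʳ++ w) ∷ [] ∷ ρ ≤
        length r * (7 + ⟪ c ⟫ (total ρ)) + 1
      iterate d w []      le = exact (stop refl)
      iterate d w (b ∷ r) le = within (≤-reflexive (eq (⟪ c ⟫ (total ρ)) (length r)))
        (again≤ refl
          (branch≤ (exact pop ⨟≤
            at≤ refl (within (choose b w (≤-trans (m≤n+m _ (suc (length r))) le))
              (subst (λ v → code (g b) ⊢ (C w ++ d) ∷ w ∷ ρ ⇓ v ∷ w ∷ ρ ≤ ⟪ cost (g b) ⟫ (total (w ∷ ρ)))
                (sym (List.++-assoc (fun (g b) (w ∷ ρ)) (C w) d)) (spec (g b) (w ∷ ρ) (C w ++ d)))) ⨟⟨ (C (b ∷ w) ++ d) ∷ w ∷ r ∷ ρ ⟩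
            exact push))
          (iterate d (b ∷ w) r (≤-trans (≤-reflexive (+-suc (length r) (length w))) le)))
        where
        eq : ∀ x n → 2 + (suc (suc (1 + suc (x + 1))) + (n * (7 + x) + 1)) ≡ suc n * (7 + x) + 1
        eq = solve-∀

  loop : FP k
  loop = record
    { fun  = λ ρ → loopWord (λ b w → fun (g b) (w ∷ ρ)) (fun t ρ)
    ; code = new 1F (at zero (code t) ⨟
               new 2F (at zero shift ⨟ while 2F body) ⨟
               at zero clear)
    ; cost = K 1 ⊕ (cost t ⊕ (K 1 ⊕ ((K 1 ⊕ ((K 6 ⊗ cost t ⊕ K 1) ⊕ (cost t ⊗ (K 7 ⊕ c) ⊕ K 1))) ⊕ dispose t)))
    ; spec = λ ρ d → new≤
        (at≤ refl (spec₀ t ρ) ⨟⟨ d ∷ fun t ρ ∷ ρ ⟩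
         new≤ (at≤ refl (within (+-monoˡ-≤ 1 (*-monoʳ-≤ 6 (fun-length t ρ))) (shift-spec (fun t ρ) [] ρ)) ⨟⟨ d ∷ [] ∷ reverse (fun t ρ) ∷ ρ ⟩
               within (+-monoˡ-≤ 1 (*-monoˡ-≤ (7 + ⟪ c ⟫ (total ρ))
                        (≤-trans (≤-reflexive (List.length-reverse (fun t ρ))) (fun-length t ρ))))
                 (subst (λ v → while 2F body ⊢ d ∷ [] ∷ reverse (fun t ρ) ∷ ρ ⇓ (C ρ v ++ d) ∷ v ∷ [] ∷ ρ ≤
                               length (reverse (fun t ρ)) * (7 + ⟪ c ⟫ (total ρ)) + 1)
                   (trans (ʳ++-ʳ++ (fun t ρ) []) (List.++-identityʳ _))
                   (iterate ρ d [] (reverse (fun t ρ))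
                     (≤-reflexive (trans (+-identityʳ _) (List.length-reverse (fun t ρ))))))) ⨟⟨ (C ρ (fun t ρ) ++ d) ∷ fun t ρ ∷ ρ ⟩
         at≤ refl (dispose-spec t ρ (fun t ρ) ρ ≤-refl))
    }

recWord : Word → (Bool → Word → Word → Word) → Word → Word
recWord g h []      = g
recWord g h (b ∷ w) = h b (recWord g h w) w

module _ {k} (t : FP k) (g : FP k) (h : Bool → FP (2 + k)) where
  private
    R : Vec Word k → Word → Word
    R ρ = recWord (fun g ρ) (λ b r w → fun (h b) (r ∷ w ∷ ρ))

    body : Stmt (4 + k)
    body = branch 3F λ
      { nothing  → skip
      ; (just b) →
          pop 3F ⨟
          new zero
            (at 1F (at 3F (code (h b))) ⨟
             at zero (at zero clear) ⨟
             -- Two reversals carry the new value, in its original order, to the place of the old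
             -- one.
             new 1F (shift ⨟ at zero (at 1F shift))) ⨟
          push b 2F }

    m : PolyExpr
    m = cost t ⊕ N

    c : PolyExpr
    c = (cost (h false) ⊕ cost (h true)) ⟨∘⟩ (m ⊕ m)

    step-cost : PolyExpr
    step-cost = K 13 ⊕ c ⊕ K 15 ⊗ m

  module _ (bound : ∀ ρ w → length (R ρ w) ≤ length w + total ρ) where
    private
      module _ (ρ : Vec Word k) where
        M : ℕ
        M = ⟪ m ⟫ (total ρ)

        small : ∀ w → length w ≤ length (fun t ρ) → length (R ρ w) ≤ M
        small w w≤ = ≤-trans (bound ρ w) (+-monoˡ-≤ (total ρ) (≤-trans w≤ (fun-length t ρ)))

        choose : ∀ b w → length w ≤ length (fun t ρ) →
          ⟪ cost (h b) ⟫ (total (R ρ w ∷ w ∷ ρ)) ≤ ⟪ c ⟫ (total ρ)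
        choose b w w≤ = begin
          ⟪ cost (h b) ⟫ (total (R ρ w ∷ w ∷ ρ))
            ≤⟨ ⟪⟫-mono (cost (h b)) (+-mono-≤ (small w w≤) (+-monoˡ-≤ (total ρ) (≤-trans w≤ (fun-length t ρ)))) ⟩
          ⟪ cost (h b) ⟫ (M + M)                            ≤⟨ pick b (M + M) ⟩
          ⟪ cost (h false) ⊕ cost (h true) ⟫ (M + M)        ≡⟨ ⟪∘⟫ (cost (h false) ⊕ cost (h true)) (m ⊕ m) (total ρ) ⟨
          ⟪ c ⟫ (total ρ)                                   ∎
          where
          open ≤-Reasoning
          pick : ∀ b n → ⟪ cost (h b) ⟫ n ≤ ⟪ cost (h false) ⊕ cost (h true) ⟫ n
          pick false n = m≤m+n _ _
          pick true  n = m≤n+m _ _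

        iterate : ∀ d w r → length r + length w ≤ length (fun t ρ) →
          while 3F body ⊢ d ∷ R ρ w ∷ w ∷ r ∷ ρ ⇓ d ∷ R ρ (r List.ʳ++ w) ∷ (r List.ʳ++ w) ∷ [] ∷ ρ ≤
          length r * ⟪ step-cost ⟫ (total ρ) + 1
        iterate d w []      le = exact (stop refl)
        iterate d w (b ∷ r) le = within (≤-reflexive (eq (⟪ c ⟫ (total ρ)) M (length r)))
          (again≤ refl
            (branch≤ (exact pop ⨟≤
              new≤
                (at≤ refl (at≤ refl (within (choose b w w≤) (spec₀ (h b) (R ρ w ∷ w ∷ ρ)))) ⨟⟨ v ∷ d ∷ R ρ w ∷ w ∷ r ∷ ρ ⟩
                 at≤ refl (at≤ refl (within (+-monoˡ-≤ 1 (*-monoʳ-≤ 3 (small w w≤))) (clear-spec (R ρ w) (w ∷ r ∷ ρ)))) ⨟⟨ v ∷ d ∷ [] ∷ w ∷ r ∷ ρ ⟩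
                 new≤ (within (+-monoˡ-≤ 1 (*-monoʳ-≤ 6 (small (b ∷ w) w<))) (shift-spec v [] (d ∷ [] ∷ w ∷ r ∷ ρ)) ⨟⟨ [] ∷ reverse v ∷ d ∷ [] ∷ w ∷ r ∷ ρ ⟩
                       at≤ refl (at≤ refl
                         (within (+-monoˡ-≤ 1 (*-monoʳ-≤ 6 (≤-trans (≤-reflexive (List.length-reverse v)) (small (b ∷ w) w<))))
                         (subst (λ u → shift ⊢ reverse v ∷ [] ∷ w ∷ r ∷ ρ ⇓ [] ∷ u ∷ w ∷ r ∷ ρ ≤ 6 * length (reverse v) + 1)
                           (trans (ʳ++-ʳ++ v []) (List.++-identityʳ v))
                           (shift-spec (reverse v) [] (w ∷ r ∷ ρ))))))) ⨟⟨ d ∷ v ∷ w ∷ r ∷ ρ ⟩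
              exact push))
            (iterate d (b ∷ w) r (≤-trans (≤-reflexive (+-suc (length r) (length w))) le)))
          where
          v = R ρ (b ∷ w)
          w< : suc (length w) ≤ length (fun t ρ)
          w< = ≤-trans (s≤s (m≤n+m (length w) (length r))) le
          w≤ = <⇒≤ w<
          eq : ∀ x y n → 2 + (suc (suc (1 + suc (suc (x + suc (3 * y + 1 + suc (6 * y + 1 + (6 * y + 1)))) + 1))) +
                 (n * (13 + x + 15 * y) + 1)) ≡ suc n * (13 + x + 15 * y) + 1
          eq = solve-∀

    -- Cobham's bounded recursion on notation. Without `bound` an intermediate result could double
    -- in every round; with it, all of them have size at most `⟪ m ⟫ (total ρ)`, and one cost serves
    -- for every round.
    rec : FP k
    rec = record
      { fun  = λ ρ → R ρ (fun t ρ)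
      ; code = new 1F (at zero (code t) ⨟
                 new 2F (at zero shift ⨟
                   new 1F (at zero (at 1F (at 1F (code g))) ⨟
                     while 3F body ⨟ copy ⨟ at zero clear)) ⨟
                 at zero clear)
      ; cost = K 1 ⊕ (cost t ⊕ (K 1 ⊕ ((K 1 ⊕ ((K 6 ⊗ cost t ⊕ K 1) ⊕
                 (K 1 ⊕ (cost g ⊕ (K 1 ⊕ ((cost t ⊗ step-cost ⊕ K 1) ⊕ (K 1 ⊕ ((K 14 ⊗ m ⊕ K 3) ⊕ (K 3 ⊗ m ⊕ K 1))))))))) ⊕
                 dispose t)))
      ; spec = λ ρ d → let v = R ρ (fun t ρ) in new≤
          (at≤ refl (spec₀ t ρ) ⨟⟨ d ∷ fun t ρ ∷ ρ ⟩
           new≤ (at≤ refl (within (+-monoˡ-≤ 1 (*-monoʳ-≤ 6 (fun-length t ρ))) (shift-spec (fun t ρ) [] ρ)) ⨟⟨ d ∷ [] ∷ reverse (fun t ρ) ∷ ρ ⟩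
             new≤ (at≤ refl (at≤ refl (at≤ refl (spec₀ g ρ))) ⨟⟨ d ∷ fun g ρ ∷ [] ∷ reverse (fun t ρ) ∷ ρ ⟩
               within (+-monoˡ-≤ 1 (*-monoˡ-≤ (⟪ step-cost ⟫ (total ρ))
                        (≤-trans (≤-reflexive (List.length-reverse (fun t ρ))) (fun-length t ρ))))
                 (subst (λ u → while 3F body ⊢
                           d ∷ fun g ρ ∷ [] ∷ reverse (fun t ρ) ∷ ρ ⇓ d ∷ R ρ u ∷ u ∷ [] ∷ ρ ≤
                           length (reverse (fun t ρ)) * ⟪ step-cost ⟫ (total ρ) + 1)
                   (trans (ʳ++-ʳ++ (fun t ρ) []) (List.++-identityʳ _))
                   (iterate ρ d [] (reverse (fun t ρ))
                     (≤-reflexive (trans (+-identityʳ _) (List.length-reverse (fun t ρ)))))) ⨟≤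
               within (+-monoˡ-≤ 3 (*-monoʳ-≤ 14 (small ρ (fun t ρ) ≤-refl))) (copy-spec d v (fun t ρ ∷ [] ∷ ρ)) ⨟≤
               at≤ refl (within (+-monoˡ-≤ 1 (*-monoʳ-≤ 3 (small ρ (fun t ρ) ≤-refl))) (clear-spec v (fun t ρ ∷ [] ∷ ρ))))) ⨟⟨ (v ++ d) ∷ fun t ρ ∷ ρ ⟩
           at≤ refl (dispose-spec t ρ (fun t ρ) ρ ≤-refl))
      }

-- Simulation of a Turing machine by a stack program

wk : ∀ {k} → FP k → FP (suc k)
wk t = record
  { fun  = λ { (x ∷ ρ) → fun t ρ }
  ; code = at 1F (code t)
  ; cost = cost t
  ; spec = λ { (x ∷ ρ) w → at≤ refl (within (⟪⟫-mono (cost t) (m≤n+m _ (length x))) (spec t ρ w)) }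
  }

lookup≤total : ∀ {k} (ρ : Vec Word k) i → length (lookup ρ i) ≤ total ρ
lookup≤total (w ∷ ρ) zero    = m≤m+n _ _
lookup≤total (w ∷ ρ) (suc i) = ≤-trans (lookup≤total ρ i) (m≤n+m _ _)

ones : ℕ → Word
ones n = replicate n true

-- A tape is kept as three stacks: the cells before the head and those after it,
-- in a prefix code, and the scanned symbol, where the empty stack is a blank.
symbolCode : List Symbol → Word
symbolCode []            = []
symbolCode (nothing ∷ l) = false ∷ symbolCode l
symbolCode (just b ∷ l)  = true ∷ b ∷ symbolCode l

headCode : Symbol → Word
headCode nothing  = []
headCode (just b) = b ∷ []

top-headCode : ∀ a → top (headCode a) ≡ a
top-headCode nothing  = refl
top-headCode (just b) = refl

blocks : ℕ → ℕ → ℕ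
blocks zero    k = k
blocks (suc n) k = 3 + blocks n k

flat : ∀ {n k} → Vec Tape n → Vec Word k → Vec Word (blocks n k)
flat []                ρ = ρ
flat (tape l h r ∷ ts) ρ = symbolCode l ∷ headCode h ∷ symbolCode r ∷ flat ts ρ

headIndex : ∀ {n k} → Fin n → Fin (blocks n k)
headIndex zero    = suc zero
headIndex (suc i) = suc (suc (suc (headIndex i)))

lookup-flat : ∀ {n k} (ts : Vec Tape n) (ρ : Vec Word k) i →
  lookup (flat ts ρ) (headIndex i) ≡ headCode (Tape.head (lookup ts i))
lookup-flat (t ∷ ts) ρ zero    = refl
lookup-flat (t ∷ ts) ρ (suc i) = lookup-flat ts ρ i

readAll : ∀ {n k} → Vec (Fin k) n → (Vec Symbol n → Stmt k) → Stmt k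
readAll []       f = f []
readAll (i ∷ is) f = branch i λ a → readAll is λ as → f (a ∷ as)

readAll-spec : ∀ {n k} (is : Vec (Fin k) n) f {ρ ρ′ c} →
  f (Vec.map (λ i → top (lookup ρ i)) is) ⊢ ρ ⇓ ρ′ ≤ c → readAll is f ⊢ ρ ⇓ ρ′ ≤ n + c
readAll-spec []       f D = D
readAll-spec (i ∷ is) f D = branch≤ (readAll-spec is (λ as → f (_ ∷ as)) D)

dropHead : ∀ {k} → Stmt (3 + k)
dropHead = branch 1F λ { nothing → skip ; (just _) → pop 1F }

writeHead : ∀ {k} → Symbol → Stmt (3 + k)
writeHead nothing  = skip
writeHead (just b) = push b 1F

pushSymbol : ∀ {k} → Symbol → Fin (3 + k) → Stmt (3 + k)
pushSymbol nothing  i = push false i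
pushSymbol (just b) i = push b i ⨟ push true i

-- Past the end of the stack all cells are blank, and a scanned blank is the empty stack, so in this
-- case nothing is to be done.
takeSymbol : ∀ {k} → Fin (3 + k) → Stmt (3 + k)
takeSymbol i = branch i λ
  { nothing      → skip
  ; (just false) → pop i
  ; (just true)  → pop i ⨟ branch i λ { nothing → skip ; (just b) → pop i ⨟ push b 1F } }

actTape : ∀ {k} → Symbol × Move → Stmt (3 + k)
actTape (s , stay)  = dropHead ⨟ writeHead s
actTape (s , right) = dropHead ⨟ pushSymbol s zero ⨟ takeSymbol 2F
actTape (s , left)  = dropHead ⨟ pushSymbol s 2F ⨟ takeSymbol zero

module _ {n k} (ts : Vec Tape n) (ρ : Vec Word k) where
  dropHead-spec : ∀ l h r → dropHead ⊢ flat (tape l h r ∷ ts) ρ ⇓ flat (tape l nothing r ∷ ts) ρ ≤ 2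
  dropHead-spec l nothing  r = within (s≤s z≤n) (branch≤ (exact skip))
  dropHead-spec l (just b) r = branch≤ (exact pop)

  writeHead-spec : ∀ l s r → writeHead s ⊢ flat (tape l nothing r ∷ ts) ρ ⇓ flat (tape l s r ∷ ts) ρ ≤ 1
  writeHead-spec l nothing  r = within z≤n (exact skip)
  writeHead-spec l (just b) r = exact push

  pushˡ-spec : ∀ l s r → pushSymbol s zero ⊢ flat (tape l nothing r ∷ ts) ρ ⇓ flat (tape (s ∷ l) nothing r ∷ ts) ρ ≤ 3
  pushˡ-spec l nothing  r = within (s≤s z≤n) (exact push)
  pushˡ-spec l (just b) r = exact push ⨟≤ exact push

  pushʳ-spec : ∀ l s r → pushSymbol s 2F ⊢
    flat (tape l nothing r ∷ ts) ρ ⇓ flat (tape l nothing (s ∷ r) ∷ ts) ρ ≤ 3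
  pushʳ-spec l nothing  r = within (s≤s z≤n) (exact push)
  pushʳ-spec l (just b) r = exact push ⨟≤ exact push

  takeʳ-spec : ∀ l s r → takeSymbol 2F ⊢
    flat (tape l nothing (s ∷ r) ∷ ts) ρ ⇓ flat (tape l s r ∷ ts) ρ ≤ 7
  takeʳ-spec l nothing  r = within (s≤s (s≤s z≤n)) (branch≤ (exact pop))
  takeʳ-spec l (just b) r = branch≤ (exact pop ⨟≤ branch≤ (exact pop ⨟≤ exact push))

  takeʳ-spec₀ : ∀ l → takeSymbol 2F ⊢
    flat (tape l nothing [] ∷ ts) ρ ⇓ flat (tape l nothing [] ∷ ts) ρ ≤ 7
  takeʳ-spec₀ l = within (s≤s z≤n) (branch≤ (exact skip))

  takeˡ-spec : ∀ l s r → takeSymbol zero ⊢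
    flat (tape (s ∷ l) nothing r ∷ ts) ρ ⇓ flat (tape l s r ∷ ts) ρ ≤ 7
  takeˡ-spec l nothing  r = within (s≤s (s≤s z≤n)) (branch≤ (exact pop))
  takeˡ-spec l (just b) r = branch≤ (exact pop ⨟≤ branch≤ (exact pop ⨟≤ exact push))

  takeˡ-spec₀ : ∀ r → takeSymbol zero ⊢
    flat (tape [] nothing r ∷ ts) ρ ⇓ flat (tape [] nothing r ∷ ts) ρ ≤ 7
  takeˡ-spec₀ r = within (s≤s z≤n) (branch≤ (exact skip))

  actTape-spec : ∀ a t → actTape a ⊢ flat (t ∷ ts) ρ ⇓ flat (act a t ∷ ts) ρ ≤ 14
  actTape-spec (s , stay)  (tape l h r) =
    within (s≤s (s≤s (s≤s (s≤s z≤n)))) (dropHead-spec l h r ⨟≤ writeHead-spec l s r)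
  actTape-spec (s , left)  (tape [] h r) =
    dropHead-spec [] h r ⨟⟨ flat (tape [] nothing r ∷ ts) ρ ⟩ pushʳ-spec [] s r ⨟⟨ flat (tape [] nothing (s ∷ r) ∷ ts) ρ ⟩ takeˡ-spec₀ (s ∷ r)
  actTape-spec (s , left)  (tape (x ∷ l) h r) =
    dropHead-spec (x ∷ l) h r ⨟⟨ flat (tape (x ∷ l) nothing r ∷ ts) ρ ⟩ pushʳ-spec (x ∷ l) s r ⨟⟨ flat (tape (x ∷ l) nothing (s ∷ r) ∷ ts) ρ ⟩ takeˡ-spec l x (s ∷ r)
  actTape-spec (s , right) (tape l h []) =
    dropHead-spec l h [] ⨟⟨ flat (tape l nothing [] ∷ ts) ρ ⟩ pushˡ-spec l s [] ⨟⟨ flat (tape (s ∷ l) nothing [] ∷ ts) ρ ⟩ takeʳ-spec₀ (s ∷ l)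
  actTape-spec (s , right) (tape l h (x ∷ r)) =
    dropHead-spec l h (x ∷ r) ⨟⟨ flat (tape l nothing (x ∷ r) ∷ ts) ρ ⟩ pushˡ-spec l s (x ∷ r) ⨟⟨ flat (tape (s ∷ l) nothing (x ∷ r) ∷ ts) ρ ⟩ takeʳ-spec (s ∷ l) x r

at³ : ∀ {k} → Stmt k → Stmt (3 + k)
at³ S = at zero (at zero (at zero S))

at³-spec : ∀ {k} {S : Stmt k} {ρ ρ′ c} u v w → S ⊢ ρ ⇓ ρ′ ≤ c → at³ S ⊢ u ∷ v ∷ w ∷ ρ ⇓ u ∷ v ∷ w ∷ ρ′ ≤ c
at³-spec u v w D = at≤ refl (at≤ refl (at≤ refl D))

actTapes : ∀ {n k} → Vec (Symbol × Move) n → Stmt (blocks n k)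
actTapes []       = skip
actTapes (a ∷ as) = actTape a ⨟ at³ (actTapes as)

actTapes-spec : ∀ {n k} as (ts : Vec Tape n) (ρ : Vec Word k) →
  actTapes as ⊢ flat ts ρ ⇓ flat (Vec.zipWith act as ts) ρ ≤ n * 15
actTapes-spec []       []       ρ = exact skip
actTapes-spec (a ∷ as) (t ∷ ts) ρ =
  actTape-spec ts ρ a t ⨟⟨ flat (act a t ∷ ts) ρ ⟩ at³-spec _ _ _ (actTapes-spec as ts ρ)

switch : ∀ {n k} → (Fin n → Stmt (suc k)) → Stmt (suc k)
switch {zero}  f = skip
switch {suc n} f = branch zero λ { nothing → f zero ; (just _) → pop zero ⨟ switch (f ∘ suc) }

switch-spec : ∀ {n k} (f : Fin n → Stmt (suc k)) q {ρ ρ′ c} →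
  f q ⊢ [] ∷ ρ ⇓ ρ′ ≤ c → switch f ⊢ ones (toℕ q) ∷ ρ ⇓ ρ′ ≤ n * 3 + c
switch-spec {suc n} f zero    {c = c} D = within (s≤s (m≤n+m c (2 + n * 3))) (branch≤ D)
switch-spec         f (suc q) D = branch≤ (exact pop ⨟≤ switch-spec (f ∘ suc) q D)

setState : ∀ {k} → ℕ → Stmt (suc k)
setState zero    = skip
setState (suc n) = setState n ⨟ push true zero

setState-spec : ∀ {k} n (ρ : Vec Word k) → setState n ⊢ [] ∷ ρ ⇓ ones n ∷ ρ ≤ 2 * n
setState-spec zero    ρ = exact skip
setState-spec (suc n) ρ = within (≤-reflexive (eq n)) (setState-spec n ρ ⨟≤ exact push)
  where
  eq : ∀ n → suc (2 * n + 1) ≡ 2 * suc n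
  eq = solve-∀

-- The cells passed are not saved on the left part of the tape, since all tapes are cleared
-- afterwards. The word comes out reversed.
extract : ∀ {k} → Stmt (4 + k)
extract = while 2F (branch 2F λ
  { nothing  → skip
  ; (just b) → push b zero ⨟ pop 2F ⨟ at zero (takeSymbol 2F) })

extract-spec : ∀ {n k} v l h r (ts : Vec Tape n) (ρ : Vec Word k) → ∃[ r′ ]
  (extract ⊢ v ∷ flat (tape l h r ∷ ts) ρ ⇓
     (unblank (h ∷ r) List.ʳ++ v) ∷ flat (tape l nothing r′ ∷ ts) ρ ≤ length (unblank (h ∷ r)) * 14 + 1)
extract-spec v l nothing  r ts ρ = r , exact (stop refl)
extract-spec v l (just b) [] ts ρ = [] ,
  again≤ refl (branch≤ (exact push ⨟≤ exact pop ⨟≤ at≤ refl (takeʳ-spec₀ ts ρ l))) (exact (stop refl))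
extract-spec v l (just b) (s ∷ r) ts ρ with extract-spec (b ∷ v) l s r ts ρ
... | r′ , D = r′ , within (≤-reflexive (eq (length (unblank (s ∷ r))))) (again≤ refl
  (branch≤ (exact push ⨟≤ exact pop ⨟≤
    at≤ {ρ′ = (b ∷ v) ∷ flat (tape l s r ∷ ts) ρ} refl (takeʳ-spec ts ρ l s r))) D)
  where
  eq : ∀ n → 2 + (suc (suc (1 + suc (1 + 7))) + (n * 14 + 1)) ≡ suc n * 14 + 1
  eq = solve-∀

clearAll : ∀ n {k} → Stmt (blocks n k)
clearAll zero    = skip
clearAll (suc n) = clear ⨟ at zero clear ⨟ at zero (at zero clear) ⨟ at³ (clearAll n)

clearAll-spec : ∀ {n k} (ts : Vec Tape n) (ρ : Vec Word k) L → (∀ i → length (lookup (flat ts ρ) i) ≤ L) →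
  clearAll n ⊢ flat ts ρ ⇓ flat (Vec.replicate n blankTape) ρ ≤ n * (6 + 9 * L)
clearAll-spec []                ρ L small = exact skip
clearAll-spec {suc n} (tape l h r ∷ ts) ρ L small = within (≤-reflexive (eq L (n * (6 + 9 * L))))
  (one zero (clear-spec (symbolCode l) _) ⨟≤
   at≤ {ρ = [] ∷ headCode h ∷ symbolCode r ∷ flat ts ρ} {[] ∷ [] ∷ symbolCode r ∷ flat ts ρ} refl
     (one 1F (clear-spec (headCode h) _)) ⨟≤
   at≤ {ρ = [] ∷ [] ∷ symbolCode r ∷ flat ts ρ} {[] ∷ [] ∷ [] ∷ flat ts ρ} refl (at≤ refl
     (one 2F (clear-spec (symbolCode r) _))) ⨟≤
   at³-spec [] [] [] (clearAll-spec ts ρ L λ i → small (suc (suc (suc i)))))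
  where
  one : ∀ i {k} {S : Stmt k} {ρ₁ ρ₂} → S ⊢ ρ₁ ⇓ ρ₂ ≤ 3 * length (lookup (flat (tape l h r ∷ ts) ρ) i) + 1 →
    S ⊢ ρ₁ ⇓ ρ₂ ≤ 3 * L + 1
  one i = within (+-monoˡ-≤ 1 (*-monoʳ-≤ 3 (small i)))
  eq : ∀ L m → suc (3 * L + 1 + suc (3 * L + 1 + suc (3 * L + 1 + m))) ≡ 6 + 9 * L + m
  eq = solve-∀

module Simulation (M : TM) where
  open TM M renaming (states to s; workTapes to w)

  heads : ∀ {k} → Vec (Fin (suc (blocks (3 + w) k))) (3 + w)
  heads = tabulate (suc ∘ headIndex)

  perform : ∀ {k} → Maybe (Fin s × Vec (Symbol × Move) (3 + w)) → Stmt (suc (blocks (3 + w) k))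
  perform nothing           = skip
  perform (just (q , acts)) = setState (suc (toℕ q)) ⨟ at zero (actTapes acts)

  -- State `q` is kept as `q + 1` ones, so that the empty stack can mean "halted" and end the
  -- `while`. The `pop` removes the extra one and `switch` consumes the others.
  stepCode : ∀ {k} → Stmt (suc (blocks (3 + w) k))
  stepCode = pop zero ⨟ switch λ q → readAll heads λ as → perform (δ q as)

  stepCost : ℕ
  stepCost = s * 3 + (3 + w + suc (2 * s + (3 + w) * 15))

  read-heads : ∀ {k} (ts : Vec Tape (3 + w)) (ρ : Vec Word k) →
    Vec.map (λ i → top (lookup ([] ∷ flat ts ρ) i)) heads ≡ Vec.map Tape.head ts
  read-heads ts ρ = begin
    Vec.map (λ i → top (lookup ([] ∷ flat ts ρ) i)) heads ≡⟨ Vec.tabulate-∘ (λ i → top (lookup ([] ∷ flat ts ρ) i)) (suc ∘ headIndex) ⟨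
    tabulate (λ i → top (lookup (flat ts ρ) (headIndex i))) ≡⟨ Vec.tabulate-cong (λ i → trans (cong top (lookup-flat ts ρ i)) (top-headCode _)) ⟩
    tabulate (λ i → Tape.head (lookup ts i))             ≡⟨ Vec.tabulate-∘ Tape.head (lookup ts) ⟩
    Vec.map Tape.head (tabulate (lookup ts))             ≡⟨ cong (Vec.map Tape.head) (Vec.tabulate∘lookup ts) ⟩
    Vec.map Tape.head ts                                 ∎
    where open ≡-Reasoning

  stepCode-spec : ∀ {k} q (ts : Vec Tape (3 + w)) (ρ : Vec Word k) {ρ′} →
    perform (δ q (Vec.map Tape.head ts)) ⊢ [] ∷ flat ts ρ ⇓ ρ′ ≤ suc (2 * s + (3 + w) * 15) →
    stepCode ⊢ ones (suc (toℕ q)) ∷ flat ts ρ ⇓ ρ′ ≤ 2 + stepCost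
  stepCode-spec q ts ρ {ρ′} D = exact pop ⨟≤ switch-spec _ q (readAll-spec heads (λ as → perform (δ q as))
    (subst (λ as → perform (δ q as) ⊢ [] ∷ flat ts ρ ⇓ ρ′ ≤ suc (2 * s + (3 + w) * 15)) (sym (read-heads ts ρ)) D))

  performed : ∀ {k} q ts (ρ : Vec Word k) {o ρ′} → δ q (Vec.map Tape.head ts) ≡ o →
    perform o ⊢ [] ∷ flat ts ρ ⇓ ρ′ ≤ suc (2 * s + (3 + w) * 15) →
    stepCode ⊢ ones (suc (toℕ q)) ∷ flat ts ρ ⇓ ρ′ ≤ 2 + stepCost
  performed q ts ρ refl D = stepCode-spec q ts ρ D

  -- One round more than there are steps: the last round discovers that the machine has halted.
  loopCost : ℕ → ℕ
  loopCost t = suc t * (4 + stepCost) + 1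

  halt-spec : ∀ {k} t q ts (ρ : Vec Word k) → δ q (Vec.map Tape.head ts) ≡ nothing →
    while zero stepCode ⊢ ones (suc (toℕ q)) ∷ flat ts ρ ⇓ [] ∷ flat ts ρ ≤ loopCost t
  halt-spec t q ts ρ e = within (+-monoˡ-≤ 1 (m≤m+n (4 + stepCost) (t * (4 + stepCost))))
    (again≤ refl (performed q ts ρ e (within z≤n (exact skip))) (exact (stop refl)))

  run-spec : ∀ {k} t q ts (ρ : Vec Word k) {v} → run M t (q , ts) ≡ just v → Σ[ ts′ ∈ Vec Tape (3 + w) ]
    (while zero stepCode ⊢ ones (suc (toℕ q)) ∷ flat ts ρ ⇓ [] ∷ flat ts′ ρ ≤ loopCost t) ×
    contents (lookup ts′ 2F) ≡ v
  run-spec t q ts@(_ ∷ _ ∷ _ ∷ _) ρ eq with δ q (Vec.map Tape.head ts) in e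
  run-spec zero    q ts@(_ ∷ _ ∷ _ ∷ _) ρ refl | nothing = ts , halt-spec zero q ts ρ e , refl
  run-spec (suc t) q ts@(_ ∷ _ ∷ _ ∷ _) ρ refl | nothing = ts , halt-spec (suc t) q ts ρ e , refl
  run-spec (suc t) q ts@(_ ∷ _ ∷ _ ∷ _) ρ eq | just (q′ , acts)
    with run-spec t q′ (Vec.zipWith act acts ts) ρ eq
  ... | ts′ , D , val = ts′ , within (≤-reflexive (sym (+-assoc (4 + stepCost) (suc t * (4 + stepCost)) 1)))
      (again≤ {ρ′ = ones (suc (toℕ q′)) ∷ flat (Vec.zipWith act acts ts) ρ} refl
        (performed q ts ρ e
          (within (*-monoʳ-≤ 2 (Fin.toℕ<n q′)) (setState-spec (suc (toℕ q′)) (flat ts ρ)) ⨟≤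
           at≤ refl (actTapes-spec acts ts ρ))) D) , val

constant : ∀ {k} → Word → FP k
constant []      = nil
constant (b ∷ w) = cons b (constant w)

fun-constant : ∀ {k} w (ρ : Vec Word k) → fun (constant w) ρ ≡ w
fun-constant []      ρ = refl
fun-constant (b ∷ w) ρ = cong (b ∷_) (fun-constant w ρ)

headFP tailFP : ∀ {k} → Fin k → FP k
headFP i = caseOf (var i) nil (λ b → cons b nil)
tailFP i = caseOf (var i) nil (λ _ → loop (var zero) (λ b → cons true (cons b nil)))

headFP-code : ∀ {k} i (ρ : Vec Word k) {a} → lookup ρ i ≡ a → fun (headFP i) ρ ≡ headCode (top a)
headFP-code i ρ {[]}    eq rewrite eq = refl
headFP-code i ρ {b ∷ a} eq rewrite eq = refl

tailFP-code : ∀ {k} i (ρ : Vec Word k) {a} → lookup ρ i ≡ a →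
  fun (tailFP i) ρ ≡ symbolCode (List.map just (drop 1 a))
tailFP-code i ρ {[]}    eq rewrite eq = refl
tailFP-code i ρ {b ∷ a} eq rewrite eq = loop-code a
  where
  loop-code : ∀ a → loopWord (λ b w → true ∷ b ∷ []) a ≡ symbolCode (List.map just a)
  loop-code []      = refl
  loop-code (b ∷ a) = cong (λ w → true ∷ b ∷ w) (loop-code a)

past : ∀ n {k} → Fin k → Fin (blocks n k)
past zero    i = i
past (suc n) i = suc (suc (suc (past n i)))

lookup-past : ∀ {n k} (ts : Vec Tape n) (ρ : Vec Word k) i → lookup (flat ts ρ) (past n i) ≡ lookup ρ i
lookup-past []       ρ i = refl
lookup-past (t ∷ ts) ρ i = lookup-past ts ρ i

alloc : ∀ {k} → FP k → Stmt (2 + k) → Stmt (suc k)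
alloc t S = new 1F (at zero (code t) ⨟ S)

alloc-spec : ∀ {k} (t : FP k) {S d d′ x ρ ρ′ c} U → fun t ρ ≡ x → total (x ∷ ρ) ≤ U →
  S ⊢ d ∷ x ∷ ρ ⇓ d′ ∷ [] ∷ ρ′ ≤ c → alloc t S ⊢ d ∷ ρ ⇓ d′ ∷ ρ′ ≤ suc (⟪ cost t ⟫ U + c)
alloc-spec t {d = d} {ρ = ρ} U refl le D = new≤
  (at≤ {ρ′ = d ∷ fun t ρ ∷ ρ} refl
    (within (⟪⟫-mono (cost t) (≤-trans (m≤n+m _ (length (fun t ρ))) le)) (spec₀ t ρ)) ⨟≤ D)

newBlocks : ∀ n {k} → Stmt (suc (blocks n k)) → Stmt (suc k)
newBlocks zero    S = S
newBlocks (suc n) S = newBlocks n (new 1F (new 1F (new 1F S)))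

newBlocks-spec : ∀ n {k} {S d d′} {ρ : Vec Word k} {c} →
  S ⊢ d ∷ flat (Vec.replicate n blankTape) ρ ⇓ d′ ∷ flat (Vec.replicate n blankTape) ρ ≤ c →
  newBlocks n S ⊢ d ∷ ρ ⇓ d′ ∷ ρ ≤ c
newBlocks-spec zero    D = D
newBlocks-spec (suc n) D = newBlocks-spec n (new≤ (new≤ (new≤ D)))

unblank-length : ∀ h r → length (unblank (h ∷ r)) ≤ length (headCode h) + length (symbolCode r)
unblank-length nothing  r = z≤n
unblank-length (just b) r = s≤s (rest r)
  where
  rest : ∀ r → length (unblank r) ≤ length (symbolCode r)
  rest []            = z≤n
  rest (nothing ∷ r) = z≤n
  rest (just b ∷ r)  = s≤s (m≤n⇒m≤1+n (rest r))

total-blank : ∀ n {k} (ρ : Vec Word k) → total (flat (Vec.replicate n blankTape) ρ) ≡ total ρ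
total-blank zero    ρ = refl
total-blank (suc n) ρ = total-blank n ρ

to-witness-just : ∀ {m : Maybe Word} (p : Data.Maybe.Is-just m) → m ≡ just (Data.Maybe.to-witness p)
to-witness-just (Data.Maybe.Relation.Unary.Any.just _) = refl

module Call (M : PolyTimeTM) where
  open PolyTimeTM M
  open TM machine renaming (states to s; workTapes to w)
  open Simulation machine

  -- Hides the destination, the state and the six stacks of tapes 0 and 1, so that the output tape
  -- comes next.
  at⁸ : ∀ {k} → Stmt (suc k) → Stmt (9 + k)
  at⁸ S = at i (at i (at i (at i (at i (at i (at i (at i S)))))))
    where
    i : ∀ {k} → Fin (2 + k)
    i = suc zero

  simulateCode : ∀ {k} → Stmt (2 + blocks (3 + w) k)
  simulateCode = (at zero (while zero stepCode) ⨟ new zero (at⁸ extract ⨟ shift)) ⨟ at zero (at zero (clearAll (3 + w)))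

  -- t bounds the running time and u the contents of all stacks.
  reach : ℕ → ℕ → ℕ
  reach t u = u + loopCost t

  prefixCost simulateCost : ℕ → ℕ → ℕ
  prefixCost t u = suc (loopCost t + suc (((reach t u + reach t u) * 14 + 1) + (6 * (reach t u + reach t u) + 1)))
  simulateCost t u = suc (prefixCost t u + (3 + w) * (6 + 9 * (u + prefixCost t u)))

  simulate-spec : ∀ {k} t q ts (ρ : Vec Word k) d {v} → run machine t (q , ts) ≡ just v →
    simulateCode ⊢ d ∷ ones (suc (toℕ q)) ∷ flat ts ρ ⇓
      (v ++ d) ∷ [] ∷ flat (Vec.replicate (3 + w) blankTape) ρ ≤ simulateCost t (total (flat ts ρ))
  simulate-spec t q ts ρ d {v} eq with run-spec t q ts ρ eq
  ... | ts′@(tape l₀ h₀ r₀ ∷ tape l₁ h₁ r₁ ∷ tape l h r ∷ us) , run@(_ , D , c≤) , val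
    with extract-spec [] l h r us ρ
  ... | r′ , E = finish first
    where
    u = total (flat ts ρ)
    found = unblank (h ∷ r)
    ts″ = tape l₀ h₀ r₀ ∷ tape l₁ h₁ r₁ ∷ tape l nothing r′ ∷ us
    small : ∀ i → length (lookup (flat ts′ ρ) i) ≤ reach t u
    small i = ≤-trans (growth D (suc i)) (+-mono-≤ (lookup≤total (flat ts ρ) i) c≤)
    found≤ : length found ≤ reach t u + reach t u
    found≤ = ≤-trans (unblank-length h r)
      (+-mono-≤ (small 7F)
                (small 8F))
    first : at zero (while zero stepCode) ⨟ new zero (at⁸ extract ⨟ shift) ⊢
      d ∷ ones (suc (toℕ q)) ∷ flat ts ρ ⇓ (v ++ d) ∷ [] ∷ flat ts″ ρ ≤ prefixCost t u
    first = at≤ {ρ′ = d ∷ [] ∷ flat ts′ ρ} refl run ⨟≤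
      new≤
        (at≤ refl (at≤ refl (at≤ refl (at≤ refl (at≤ refl (at≤ refl (at≤ refl (at≤ refl
           (within (+-monoˡ-≤ 1 (*-monoˡ-≤ 14 found≤)) E)))))))) ⨟⟨ (found List.ʳ++ []) ∷ d ∷ [] ∷ flat ts″ ρ ⟩
         within (+-monoˡ-≤ 1 (*-monoʳ-≤ 6 (≤-trans (≤-reflexive (List.length-reverse found)) found≤)))
           (subst (λ x → shift ⊢ (found List.ʳ++ []) ∷ d ∷ [] ∷ flat ts″ ρ ⇓ [] ∷ x ∷ [] ∷ flat ts″ ρ ≤ 6 * length (reverse found) + 1)
             (trans (ʳ++-ʳ++ found d) (cong (_++ d) val)) (shift-spec (reverse found) d ([] ∷ flat ts″ ρ))))
    finish : _ ⊢ _ ⇓ (v ++ d) ∷ [] ∷ flat ts″ ρ ≤ prefixCost t u → _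
    finish P@(c , D′ , c≤′) = P ⨟≤ at≤ refl (at≤ refl (clearAll-spec ts″ ρ (u + prefixCost t u) λ i →
      ≤-trans (growth D′ (suc (suc i))) (+-mono-≤ (lookup≤total (flat ts ρ) i) c≤′)))

  module _ {k : ℕ} where
    T : ∀ {l} → Fin l → Fin (blocks (suc w) l)
    T = past (suc w)

    t₁ : FP (blocks (suc w) (2 + k))
    t₁ = tailFP (T 1F)
    h₁ : FP (1 + blocks (suc w) (2 + k))
    h₁ = headFP (suc (T 1F))
    t₀ : FP (3 + blocks (suc w) (2 + k))
    t₀ = tailFP (suc (suc (suc (T zero))))
    h₀ : FP (4 + blocks (suc w) (2 + k))
    h₀ = headFP (suc (suc (suc (suc (T zero)))))
    q₀ : FP (6 + blocks (suc w) (2 + k))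
    q₀ = constant (ones (suc (toℕ start)))

    -- Each allocation goes in front of the earlier ones, so the order is reversed: blank tapes,
    -- then right part, scanned symbol and empty left part of tape 1, the same for tape 0, and the
    -- state last.
    callCode : Stmt (3 + k)
    callCode = newBlocks (suc w) (alloc t₁ (alloc h₁ (new 1F
      (alloc t₀ (alloc h₀ (new 1F (alloc q₀ simulateCode)))))))

    e-time e-total e-loop e-reach e-prefix : PolyExpr
    e-time   = fromPoly time
    e-total  = K 3 ⊗ N
    e-loop   = (K 1 ⊕ e-time) ⊗ K (4 + stepCost) ⊕ K 1
    e-reach  = e-total ⊕ e-loop
    e-prefix = K 1 ⊕ (e-loop ⊕ (K 1 ⊕ (((e-reach ⊕ e-reach) ⊗ K 14 ⊕ K 1) ⊕ (K 6 ⊗ (e-reach ⊕ e-reach) ⊕ K 1))))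

    e-simulate : PolyExpr
    e-simulate = K 1 ⊕ (e-prefix ⊕ K (3 + w) ⊗ (K 6 ⊕ K 9 ⊗ (e-total ⊕ e-prefix)))

    e-all : PolyExpr
    e-all = K (suc (toℕ start)) ⊕ e-total

    allocs : PolyExpr → PolyExpr
    allocs e = stage t₁ (stage h₁ (stage t₀ (stage h₀ (stage q₀ e))))
      where
      stage : ∀ {l} → FP l → PolyExpr → PolyExpr
      stage t e = K 1 ⊕ ((cost t ⟨∘⟩ e-all) ⊕ e)

    simulateCost-mono : ∀ {t t′ u u′} → t ≤ t′ → u ≤ u′ → simulateCost t u ≤ simulateCost t′ u′
    simulateCost-mono {t} {t′} {u} {u′} t≤ u≤ =
      s≤s (+-mono-≤ prefix≤ (*-monoʳ-≤ (3 + w) (+-monoʳ-≤ 6 (*-monoʳ-≤ 9 (+-mono-≤ u≤ prefix≤)))))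
      where
      loop≤ : loopCost t ≤ loopCost t′
      loop≤ = +-monoˡ-≤ 1 (*-monoˡ-≤ (4 + stepCost) (s≤s t≤))
      reach≤ : reach t u ≤ reach t′ u′
      reach≤ = +-mono-≤ u≤ loop≤
      prefix≤ : prefixCost t u ≤ prefixCost t′ u′
      prefix≤ = s≤s (+-mono-≤ loop≤ (s≤s (+-mono-≤ (+-monoˡ-≤ 1 (*-monoˡ-≤ 14 (+-mono-≤ reach≤ reach≤)))
                                                  (+-monoˡ-≤ 1 (*-monoʳ-≤ 6 (+-mono-≤ reach≤ reach≤))))))

    load′ : Word → Tape
    load′ a = tape [] (top a) (List.map just (drop 1 a))

    load′≡load : ∀ a → load a ≡ load′ a
    load′≡load []      = refl
    load′≡load (b ∷ a) = refl

    total-load : ∀ a → length (headCode (top a)) + length (symbolCode (List.map just (drop 1 a))) ≤ 2 * length a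
    total-load []      = z≤n
    total-load (b ∷ a) = ≤-trans (s≤s (≤-reflexive (go′ a))) (≤-trans (n≤1+n _) (≤-reflexive (sym (*-suc 2 (length a)))))
      where
      go′ : ∀ a → length (symbolCode (List.map just a)) ≡ 2 * length a
      go′ []      = refl
      go′ (b ∷ a) = trans (cong (2 +_) (go′ a)) (sym (*-suc 2 (length a)))

    callVars-spec : ∀ a b (ρ : Vec Word k) d →
      callCode ⊢ d ∷ a ∷ b ∷ ρ ⇓ (M ⟨ a , b ⟩ ++ d) ∷ a ∷ b ∷ ρ ≤ ⟪ allocs e-simulate ⟫ (total (a ∷ b ∷ ρ))
    callVars-spec a b ρ d = newBlocks-spec (suc w)
      (stage t₁ (tailFP-code (T 1F) σ₁ (lookup-past blanks env 1F)) le₁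
      (stage h₁ (headFP-code (suc (T 1F)) (r₁ ∷ σ₁) (lookup-past blanks env 1F)) le₂
      (new≤
      (stage t₀ (tailFP-code (suc (suc (suc (T zero)))) σ₂ (lookup-past blanks env zero)) le₃
      (stage h₀ (headFP-code (suc (suc (suc (suc (T zero))))) (r₀ ∷ σ₂) (lookup-past blanks env zero)) le₄
      (new≤
      (stage q₀ (fun-constant (ones (suc (toℕ start))) σ₃) le₅ core)))))))
      where
      n = total (a ∷ b ∷ ρ)
      U = ⟪ e-all ⟫ n
      env = a ∷ b ∷ ρ
      blanks = Vec.replicate (suc w) blankTape
      σ₁ = flat blanks env
      r₁ = symbolCode (List.map just (drop 1 b))
      σ₂ = flat (load′ b ∷ blanks) env
      r₀ = symbolCode (List.map just (drop 1 a))
      σ₃ = flat (load′ a ∷ load′ b ∷ blanks) env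
      stage : ∀ {l} (t : FP l) {S d d′ x σ σ′ c} → fun t σ ≡ x → total (x ∷ σ) ≤ U →
        S ⊢ d ∷ x ∷ σ ⇓ d′ ∷ [] ∷ σ′ ≤ c →
        alloc t S ⊢ d ∷ σ ⇓ d′ ∷ σ′ ≤ suc (⟪ cost t ⟨∘⟩ e-all ⟫ n + c)
      stage t {c = c} eq le D =
        within (≤-reflexive (cong (λ m → suc (m + c)) (sym (⟪∘⟫ (cost t) e-all n)))) (alloc-spec t U eq le D)
      total-σ₃ : total σ₃ ≤ 3 * n
      total-σ₃ = begin
        total σ₃ ≡⟨ eq (length (headCode (top a))) (length r₀) (length (headCode (top b))) (length r₁) (total σ₁) ⟩
        (length (headCode (top a)) + length r₀) + (length (headCode (top b)) + length r₁) + total σ₁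
          ≤⟨ +-mono-≤ (+-mono-≤ (total-load a) (total-load b)) (≤-reflexive (total-blank (suc w) env)) ⟩
        2 * length a + 2 * length b + n ≤⟨ +-monoˡ-≤ n (m≤m+n (2 * length a + 2 * length b) (2 * total ρ)) ⟩
        2 * length a + 2 * length b + 2 * total ρ + n ≡⟨ eq′ (length a) (length b) (total ρ) ⟩
        3 * n ∎
        where
        open ≤-Reasoning
        eq : ∀ x y z v t → x + (y + (z + (v + t))) ≡ (x + y) + (z + v) + t
        eq = solve-∀
        eq′ : ∀ x y z → 2 * x + 2 * y + 2 * z + (x + (y + z)) ≡ 3 * (x + (y + z))
        eq′ = solve-∀
      le₅ : total (ones (suc (toℕ start)) ∷ σ₃) ≤ U
      le₅ = +-mono-≤ (≤-reflexive (List.length-replicate (suc (toℕ start)))) total-σ₃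
      le₄ : total (headCode (top a) ∷ r₀ ∷ σ₂) ≤ U
      le₄ = ≤-trans (m≤n+m _ (length (ones (suc (toℕ start))))) le₅
      le₃ : total (r₀ ∷ σ₂) ≤ U
      le₃ = ≤-trans (m≤n+m _ (length (headCode (top a)))) le₄
      le₂ : total (headCode (top b) ∷ r₁ ∷ σ₁) ≤ U
      le₂ = ≤-trans (m≤n+m _ (length r₀)) le₃
      le₁ : total (r₁ ∷ σ₁) ≤ U
      le₁ = ≤-trans (m≤n+m _ (length (headCode (top b)))) le₂
      halted : run machine (⟦ time ⟧ (length a + length b)) (start , load′ a ∷ load′ b ∷ blanks) ≡ just (M ⟨ a , b ⟩)
      halted = trans (cong₂ (λ t u → run machine (⟦ time ⟧ (length a + length b)) (start , t ∷ u ∷ blanks))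
        (sym (load′≡load a)) (sym (load′≡load b))) (to-witness-just (halts a b))
      core : simulateCode ⊢ d ∷ ones (suc (toℕ start)) ∷ σ₃ ⇓
        (M ⟨ a , b ⟩ ++ d) ∷ [] ∷ flat (Vec.replicate (3 + w) blankTape) env ≤ ⟪ e-simulate ⟫ n
      core = within (simulateCost-mono t≤ total-σ₃) (simulate-spec _ start (load′ a ∷ load′ b ∷ blanks) env d halted)
        where
        t≤ : ⟦ time ⟧ (length a + length b) ≤ ⟪ e-time ⟫ n
        t≤ = ≤-trans (≤-reflexive (sym (⟪fromPoly⟫ time (length a + length b))))
          (⟪⟫-mono e-time (+-monoʳ-≤ (length a) (m≤m+n (length b) (total ρ))))

    callVars : FP (2 + k)
    callVars = record
      { fun  = λ { (a ∷ b ∷ ρ) → M ⟨ a , b ⟩ }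
      ; code = callCode
      ; cost = allocs e-simulate
      ; spec = λ { (a ∷ b ∷ ρ) d → callVars-spec a b ρ d }
      }

call : ∀ {k} → PolyTimeTM → FP k → FP k → FP k
call M t u = let′ u (let′ (wk t) (Call.callVars M))

-- Turing machines for polynomial-time functions

module Machine (t : FP 2) where
  S : Stmt 3
  S = code t

  w : ℕ
  w = depth S

  -- The destination becomes the output tape 2, and the two arguments are read where they are
  -- loaded, on tapes 0 and 1.
  place : Vec (Fin (3 + w)) 3
  place = suc 1F ∷ zero ∷ suc zero ∷ []

  separate : Separate place 3
  separate = injective , below
    where
    injective : ∀ i j → lookup place i ≡ lookup place j → i ≡ j
    injective zero             zero             _ = refl
    injective zero             1F       ()
    injective zero             2F ()
    injective 1F       zero             ()
    injective 1F       2F ()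
    injective 2F zero             ()
    injective 2F 1F       ()
    injective 1F       1F       _ = refl
    injective 2F 2F _ = refl
    below : ∀ i → toℕ (lookup place i) < 3
    below zero             = s≤s (s≤s (s≤s z≤n))
    below 1F       = s≤s z≤n
    below 2F = s≤s (s≤s z≤n)

  open ToTM {w} (State-finite S) (entry S) (compile S place 3)

  module _ (x r : Word) where
    σ : Vec Word (3 + w)
    σ = x ∷ r ∷ [] ∷ Vec.replicate w []

    tapes : Vec Tape (3 + w)
    tapes = load x ∷ load r ∷ blankTape ∷ Vec.replicate w blankTape

    hold : Hold σ tapes
    hold zero                = holds-load x
    hold 1F          = holds-load r
    hold 2F    = holds-blank
    hold (suc (suc (suc i))) = subst₂ Holds
      (sym (Vec.lookup-replicate i [])) (sym (Vec.lookup-replicate i blankTape)) holds-blank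

    represents : Represents place 3 ([] ∷ x ∷ r ∷ []) σ
    represents = rep , free
      where
      rep : ∀ i → lookup σ (lookup place i) ≡ lookup ([] ∷ x ∷ r ∷ []) i
      rep zero             = refl
      rep 1F       = refl
      rep 2F = refl
      free : ∀ y → 3 ≤ toℕ y → lookup σ y ≡ []
      free zero             ()
      free 1F       (s≤s ())
      free 2F (s≤s (s≤s ()))
      free (suc (suc (suc i))) _ = Vec.lookup-replicate i []

    result : run machine (⟦ toPoly (K 2 ⊗ cost t) ⟧ (length x + length r)) (initial machine x r) ≡
      just (fun t (x ∷ r ∷ []))
    result with spec₀ t (x ∷ r ∷ [])
    ... | c , D , c≤ with compile-correct D place 3 σ separate (≤-reflexive (+-comm w 3)) represents
    ... | q , σ′ , R , halt , (rep , _) , _ = run-mono machine 2c≤ (begin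
      run machine (2 * c) (initial machine x r) ≡⟨ simulate-halt R halt tapes hold ⟩
      just (lookup σ′ 2F)         ≡⟨ cong just (rep zero) ⟩
      just (fun t (x ∷ r ∷ []))                 ∎)
      where
      open ≡-Reasoning
      2c≤ : 2 * c ≤ ⟦ toPoly (K 2 ⊗ cost t) ⟧ (length x + length r)
      2c≤ = ≤-trans (*-monoʳ-≤ 2 c≤) (≤-reflexive (trans
        (cong (λ m → 2 * ⟪ cost t ⟫ (length x + m)) (+-identityʳ (length r)))
        (sym (⟦toPoly⟧ (K 2 ⊗ cost t) (length x + length r)))))

  polyTimeTM : PolyTimeTM
  polyTimeTM = record
    { machine = machine
    ; time    = toPoly (K 2 ⊗ cost t)
    ; halts   = λ x r → subst Data.Maybe.Is-just (sym (result x r)) (Data.Maybe.Relation.Unary.Any.just tt)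
    }

  computes : ∀ x r → polyTimeTM ⟨ x , r ⟩ ≡ fun t (x ∷ r ∷ [])
  computes x r = Maybe.just-injective (trans (sym (to-witness-just (PolyTimeTM.halts polyTimeTM x r))) (result x r))
    where import Data.Maybe.Properties as Maybe

-- Unary arithmetic and formula schemes

tailOf : ∀ {k} → FP k → FP k
tailOf t = caseOf t nil (λ _ → var zero)

dropRec : Word → Word → Word
dropRec v = recWord v (λ _ r _ → caseWord r [] (λ _ w → w))

dropRec≡drop : ∀ u v → dropRec v u ≡ drop (length u) v
dropRec≡drop []      v = refl
dropRec≡drop (b ∷ u) v = trans (cong (λ r → caseWord r [] (λ _ w → w)) (dropRec≡drop u v)) (peel (length u) v)
  where
  peel : ∀ n (v : Word) → caseWord (drop n v) [] (λ _ w → w) ≡ drop (suc n) v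
  peel zero    []      = refl
  peel zero    (x ∷ v) = refl
  peel (suc n) []      = refl
  peel (suc n) (x ∷ v) = peel n v

dropFP : ∀ {k} → FP k → FP k → FP k
dropFP u v = let′ v (rec (wk u) (var zero) (λ _ → tailOf (var zero)) bound)
  where
  bound : ∀ ρ w → length (recWord (lookup ρ zero) (λ _ r _ → caseWord r [] (λ _ w → w)) w) ≤ length w + total ρ
  bound ρ w = begin
    length (dropRec (lookup ρ zero) w)         ≡⟨ cong length (dropRec≡drop w (lookup ρ zero)) ⟩
    length (drop (length w) (lookup ρ zero))   ≡⟨ List.length-drop (length w) (lookup ρ zero) ⟩
    length (lookup ρ zero) ∸ length w          ≤⟨ m∸n≤m _ (length w) ⟩
    length (lookup ρ zero)                     ≤⟨ lookup≤total ρ zero ⟩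
    total ρ                                    ≤⟨ m≤n+m _ (length w) ⟩
    length w + total ρ                         ∎
    where open ≤-Reasoning

fun-dropFP : ∀ {k} (u v : FP k) ρ → fun (dropFP u v) ρ ≡ drop (length (fun u ρ)) (fun v ρ)
fun-dropFP u v ρ = dropRec≡drop (fun u ρ) (fun v ρ)

ones-++ : ∀ m n → ones (m + n) ≡ ones m ++ ones n
ones-++ zero    n = refl
ones-++ (suc m) n = cong (true ∷_) (ones-++ m n)

length-ones : ∀ n → length (ones n) ≡ n
length-ones n = List.length-replicate n

drop-ones : ∀ m n → drop m (ones n) ≡ ones (n ∸ m)
drop-ones zero    n       = refl
drop-ones (suc m) zero    = refl
drop-ones (suc m) (suc n) = drop-ones m n

lengthFP : ∀ {k} → FP k → FP k
lengthFP t = loop t (λ _ → cons true nil)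

loop-length : ∀ w → loopWord (λ _ _ → true ∷ []) w ≡ ones (length w)
loop-length []      = refl
loop-length (b ∷ w) = cong (true ∷_) (loop-length w)

mulFP : ∀ {k} → FP k → FP k → FP k
mulFP t u = loop t (λ _ → wk u)

loop-const : ∀ n w → loopWord (λ _ _ → ones n) w ≡ ones (length w * n)
loop-const n []      = refl
loop-const n (b ∷ w) = trans (cong (ones n ++_) (loop-const n w)) (sym (ones-++ n _))

fun-mulFP : ∀ {k} (t u : FP k) ρ {m n} → fun t ρ ≡ ones m → fun u ρ ≡ ones n → fun (mulFP t u) ρ ≡ ones (m * n)
fun-mulFP t u ρ {m} {n} et eu rewrite et | eu = trans (loop-const n (ones m)) (cong (λ l → ones (l * n)) (length-ones m))

fun-⊹ : ∀ {k} (t u : FP k) ρ {m n} → fun t ρ ≡ ones m → fun u ρ ≡ ones n → fun (t ⊹ u) ρ ≡ ones (m + n)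
fun-⊹ t u ρ {m} {n} et eu rewrite et | eu = sym (ones-++ m n)

-- The minimum as `m ∸ (m ∸ n)`. The generator uses it to clamp variable indices exactly as `clamp`
-- does.
minFP : ∀ {k} → FP k → FP k → FP k
minFP t u = dropFP (dropFP u t) t

fun-minFP : ∀ {k} (t u : FP k) ρ {m n} → fun t ρ ≡ ones m → length (fun u ρ) ≡ n → fun (minFP t u) ρ ≡ ones (m ⊓ n)
fun-minFP t u ρ {m} {n} et eu = begin
  fun (minFP t u) ρ                                            ≡⟨ fun-dropFP (dropFP u t) t ρ ⟩
  drop (length (fun (dropFP u t) ρ)) (fun t ρ)                 ≡⟨ cong (λ w → drop (length w) (fun t ρ)) (fun-dropFP u t ρ) ⟩
  drop (length (drop (length (fun u ρ)) (fun t ρ))) (fun t ρ)  ≡⟨ cong₂ (λ l w → drop (length (drop l w)) w) eu et ⟩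
  drop (length (drop n (ones m))) (ones m)                     ≡⟨ cong (λ w → drop (length w) (ones m)) (drop-ones n m) ⟩
  drop (length (ones (m ∸ n))) (ones m)                        ≡⟨ cong (λ l → drop l (ones m)) (length-ones (m ∸ n)) ⟩
  drop (m ∸ n) (ones m)                                        ≡⟨ drop-ones (m ∸ n) m ⟩
  ones (m ∸ (m ∸ n))                                           ≡⟨ cong ones min ⟩
  ones (m ⊓ n)                                                 ∎
  where
  open ≡-Reasoning
  min : m ∸ (m ∸ n) ≡ m ⊓ n
  min with ≤-total m n
  ... | inj₁ m≤n rewrite m≤n⇒m∸n≡0 m≤n = sym (m≤n⇒m⊓n≡m m≤n)
  ... | inj₂ n≤m = trans (m∸[m∸n]≡n n≤m) (sym (m≥n⇒m⊓n≡n n≤m))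

polyFP : ∀ {k} → PolyExpr → FP k → FP k
polyFP (K a)   t = constant (ones a)
polyFP N       t = lengthFP t
polyFP (e ⊕ f) t = polyFP e t ⊹ polyFP f t
polyFP (e ⊗ f) t = mulFP (polyFP e t) (polyFP f t)

fun-polyFP : ∀ {k} e (t : FP k) ρ → fun (polyFP e t) ρ ≡ ones (⟪ e ⟫ (length (fun t ρ)))
fun-polyFP (K a)   t ρ = fun-constant (ones a) ρ
fun-polyFP N       t ρ = loop-length (fun t ρ)
fun-polyFP (e ⊕ f) t ρ = fun-⊹ (polyFP e t) (polyFP f t) ρ (fun-polyFP e t ρ) (fun-polyFP f t ρ)
fun-polyFP (e ⊗ f) t ρ = fun-mulFP (polyFP e t) (polyFP f t) ρ (fun-polyFP e t ρ) (fun-polyFP f t ρ)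

nth : Word → ℕ → Symbol
nth w n = top (drop n w)

-- Formula schemes in d bound indices and p parameter words; indices are unary,
-- and the length of a parameter may be used as a number.
data Index (d p : ℕ) : Set where
  bound : Fin d → Index d p
  len   : Fin p → Index d p
  #_    : ℕ → Index d p
  _+ᵢ_  : Index d p → Index d p → Index d p
  _*ᵢ_  : Index d p → Index d p → Index d p

infix  8 #_
infixl 6 _+ᵢ_
infixl 7 _*ᵢ_

data Scheme (p : ℕ) : ℕ → Set where
  X Y   : ∀ {d} → Index d p → Scheme p d
  bit   : ∀ {d} → (Symbol → Bool) → Fin p → Index d p → Scheme p d
  const : ∀ {d} → Bool → Scheme p d
  neg   : ∀ {d} → Scheme p d → Scheme p d
  and   : ∀ {d} → Scheme p d → Scheme p d → Scheme p d
  or    : ∀ {d} → Scheme p d → Scheme p d → Scheme p d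
  all   : ∀ {d} → Index d p → Scheme p (suc d) → Scheme p d

-- The indices descend because `loop` over a unary number sees, at each of its bits, the ones that
-- are left; this remainder is the index of the conjunct.
bigAnd : ∀ {n m} → ℕ → (ℕ → Formula n m) → Formula n m
bigAnd zero    F = const true
bigAnd (suc i) F = and (F i) (bigAnd i F)

module Instance {p} (xs ys : Fin p) (ρ : Vec Word p) where
  n m : ℕ
  n = length (lookup ρ xs)
  m = length (lookup ρ ys)

  value : ∀ {d} → Index d p → Vec ℕ d → ℕ
  value (bound i) δ = lookup δ i
  value (len i)   δ = length (lookup ρ i)
  value (# a)     δ = a
  value (a +ᵢ b)  δ = value a δ + value b δ
  value (a *ᵢ b)  δ = value a δ * value b δ

  -- `clamp` needs a nonempty set of variables, hence the two `suc`. For `Y` the additional variable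
  -- will be the answer, in front of the tableau cells; for `X` it is a last variable, to which
  -- queries assign `false`.
  formula : ∀ {d} → Scheme p d → Vec ℕ d → Formula (suc n) (suc m)
  formula (X a)       δ = X (clamp (value a δ))
  formula (Y a)       δ = Y (clamp (value a δ))
  formula (bit f i a) δ = const (f (nth (lookup ρ i) (value a δ)))
  formula (const b)   δ = const b
  formula (neg s)     δ = neg (formula s δ)
  formula (and s t)   δ = and (formula s δ) (formula t δ)
  formula (or s t)    δ = or (formula s δ) (formula t δ)
  formula (all a s)   δ = bigAnd (value a δ) (λ i → formula s (i ∷ δ))

indexFP : ∀ {d p} → Index d p → FP (d + p)
indexFP (bound i) = var (i ↑ˡ _)
indexFP (len i)   = lengthFP (var (_ ↑ʳ i))
indexFP (# a)     = constant (ones a)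
indexFP (a +ᵢ b)  = indexFP a ⊹ indexFP b
indexFP (a *ᵢ b)  = mulFP (indexFP a) (indexFP b)

module Generator {p} (xs ys : Fin p) where
  clamped : ∀ {d} → Fin p → Index d p → FP (d + p)
  clamped {d} i a = minFP (indexFP a) (var (d ↑ʳ i)) ⊹ constant (false ∷ [])

  schemeFP : ∀ {d} → Scheme p d → FP (d + p)
  schemeFP (X a)     = constant (false ∷ false ∷ false ∷ []) ⊹ clamped xs a
  schemeFP (Y a)     = constant (false ∷ false ∷ true ∷ []) ⊹ clamped ys a
  schemeFP {d} (bit f i a) = caseOf (dropFP (indexFP a) (var (d ↑ʳ i)))
    (constant (false ∷ true ∷ f nothing ∷ [])) (λ b → constant (false ∷ true ∷ f (just b) ∷ []))
  schemeFP (const b) = constant (false ∷ true ∷ b ∷ [])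
  schemeFP (neg s)   = constant (true ∷ false ∷ []) ⊹ schemeFP s
  schemeFP (and s t) = constant (true ∷ true ∷ false ∷ []) ⊹ schemeFP s ⊹ schemeFP t
  schemeFP (or s t)  = constant (true ∷ true ∷ true ∷ []) ⊹ schemeFP s ⊹ schemeFP t
  schemeFP (all a s) =
    loop (indexFP a) (λ _ → constant (true ∷ true ∷ false ∷ []) ⊹ schemeFP s) ⊹ constant (false ∷ true ∷ true ∷ [])

  module _ (ρ : Vec Word p) where
    open Instance xs ys ρ

    env : ∀ {d} → Vec ℕ d → Vec Word (d + p)
    env δ = Vec.map ones δ Vec.++ ρ

    lookup-parameter : ∀ {d} (δ : Vec ℕ d) i → lookup (env δ) (d ↑ʳ i) ≡ lookup ρ i
    lookup-parameter δ i = Vec.lookup-++ʳ (Vec.map ones δ) ρ i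

    fun-indexFP : ∀ {d} (a : Index d p) δ → fun (indexFP a) (env δ) ≡ ones (value a δ)
    fun-indexFP (bound i) δ = trans (Vec.lookup-++ˡ (Vec.map ones δ) ρ i) (Vec.lookup-map i ones δ)
    fun-indexFP {d} (len i) δ = trans (loop-length (lookup (env δ) (d ↑ʳ i))) (cong (ones ∘ length) (lookup-parameter δ i))
    fun-indexFP (# a)     δ = fun-constant (ones a) (env δ)
    fun-indexFP (a +ᵢ b)  δ = fun-⊹ (indexFP a) (indexFP b) (env δ) (fun-indexFP a δ) (fun-indexFP b δ)
    fun-indexFP (a *ᵢ b)  δ = fun-mulFP (indexFP a) (indexFP b) (env δ) (fun-indexFP a δ) (fun-indexFP b δ)

    fun-clamped : ∀ {d} i (a : Index d p) δ → fun (clamped i a) (env δ) ≡ index (clamp {length (lookup ρ i)} (value a δ))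
    fun-clamped {d} i a δ = cong₂ _++_
      (trans (fun-minFP (indexFP a) (var (d ↑ʳ i)) (env δ) (fun-indexFP a δ) (cong length (lookup-parameter δ i)))
        (cong ones (sym (toℕ-clamp (value a δ)))))
      refl

    fun-schemeFP : ∀ {d} (s : Scheme p d) δ → fun (schemeFP s) (env δ) ≡ encodeFormula (formula s δ)
    fun-schemeFP (X a)       δ = cong (λ w → false ∷ false ∷ false ∷ w) (fun-clamped xs a δ)
    fun-schemeFP (Y a)       δ = cong (λ w → false ∷ false ∷ true ∷ w) (fun-clamped ys a δ)
    fun-schemeFP {d} (bit f i a) δ
      rewrite fun-dropFP (indexFP a) (var (d ↑ʳ i)) (env δ) | fun-indexFP a δ | length-ones (value a δ) | lookup-parameter δ i
      with drop (value a δ) (lookup ρ i)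
    ... | []    = refl
    ... | b ∷ w = refl
    fun-schemeFP (const b)   δ = refl
    fun-schemeFP (neg s)     δ = cong (λ w → true ∷ false ∷ w) (fun-schemeFP s δ)
    fun-schemeFP (and s t)   δ = cong₂ (λ v w → true ∷ true ∷ false ∷ v ++ w) (fun-schemeFP s δ) (fun-schemeFP t δ)
    fun-schemeFP (or s t)    δ = cong₂ (λ v w → true ∷ true ∷ true ∷ v ++ w) (fun-schemeFP s δ) (fun-schemeFP t δ)
    fun-schemeFP (all a s)   δ rewrite fun-indexFP a δ = unroll (value a δ)
      where
      unroll : ∀ i → loopWord (λ _ w → true ∷ true ∷ false ∷ fun (schemeFP s) (w ∷ env δ)) (ones i) ++ (false ∷ true ∷ true ∷ []) ≡
        encodeFormula (bigAnd i λ j → formula s (j ∷ δ))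
      unroll zero    = refl
      unroll (suc i) = trans
        (List.++-assoc (true ∷ true ∷ false ∷ fun (schemeFP s) (ones i ∷ env δ)) _ _)
        (cong₂ (λ v w → true ∷ true ∷ false ∷ v ++ w) (fun-schemeFP s (i ∷ δ)) (unroll i))

    inputFP-spec : ∀ (s : Scheme p 0) →
      fun (constant (true ∷ []) ⊹ lengthFP (var xs) ⊹ constant (false ∷ true ∷ []) ⊹ lengthFP (var ys) ⊹
        constant (false ∷ false ∷ []) ⊹ schemeFP s) ρ ≡ encodeInput (formula s []) zero
    inputFP-spec s = cong (true ∷_) (begin
      L xs ++ false ∷ true ∷ L ys ++ false ∷ false ∷ fun (schemeFP s) ρ
        ≡⟨ cong₂ (λ v w → v ++ false ∷ true ∷ w) (loop-length (lookup ρ xs)) (cong₂ (λ v w → v ++ false ∷ false ∷ w) (loop-length (lookup ρ ys)) (fun-schemeFP s [])) ⟩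
      ones n ++ false ∷ true ∷ ones m ++ false ∷ false ∷ encodeFormula (formula s [])
        ≡⟨ cong (λ w → ones n ++ false ∷ true ∷ w) (List.++-assoc (ones m) (false ∷ []) _) ⟨
      ones n ++ false ∷ true ∷ (ones m ++ false ∷ []) ++ false ∷ encodeFormula (formula s [])
        ≡⟨ List.++-assoc (ones n) (false ∷ []) _ ⟨
      (ones n ++ false ∷ []) ++ true ∷ (ones m ++ false ∷ []) ++ false ∷ encodeFormula (formula s []) ∎)
      where
      open ≡-Reasoning
      L : Fin p → Word
      L i = loopWord (λ _ _ → true ∷ []) (lookup ρ i)

-- The Cook–Levin tableau of a stack machine

eqFin : ∀ {n} → Fin n → Fin n → Bool
eqFin zero    zero    = true
eqFin zero    (suc j) = false
eqFin (suc i) zero    = false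
eqFin (suc i) (suc j) = eqFin i j

eqFin-refl : ∀ {n} (i : Fin n) → eqFin i i ≡ true
eqFin-refl zero    = refl
eqFin-refl (suc i) = eqFin-refl i

eqFin-≢ : ∀ {n} {i j : Fin n} → i ≢ j → eqFin i j ≡ false
eqFin-≢ {i = zero}  {zero}  i≢j = ⊥-elim (i≢j refl)
eqFin-≢ {i = zero}  {suc j} i≢j = refl
eqFin-≢ {i = suc i} {zero}  i≢j = refl
eqFin-≢ {i = suc i} {suc j} i≢j = eqFin-≢ (i≢j ∘ cong suc)

anyFin allFin : ∀ {n} → (Fin n → Bool) → Bool
anyFin {zero}  f = false
anyFin {suc n} f = f zero ∨ anyFin (f ∘ suc)
allFin {zero}  f = true
allFin {suc n} f = f zero ∧ allFin (f ∘ suc)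

∧-true : ∀ {a b} → a ∧ b ≡ true → a ≡ true × b ≡ true
∧-true {true} {true} _ = refl , refl

true-∧ : ∀ {a b} → a ≡ true → b ≡ true → a ∧ b ≡ true
true-∧ refl refl = refl

allFin-elim : ∀ {n} (f : Fin n → Bool) → allFin f ≡ true → ∀ i → f i ≡ true
allFin-elim f eq zero    = proj₁ (∧-true eq)
allFin-elim f eq (suc i) = allFin-elim (f ∘ suc) (proj₂ (∧-true {f zero} eq)) i

allFin-intro : ∀ {n} (f : Fin n → Bool) → (∀ i → f i ≡ true) → allFin f ≡ true
allFin-intro {zero}  f h = refl
allFin-intro {suc n} f h = true-∧ (h zero) (allFin-intro (f ∘ suc) (h ∘ suc))

anyFin-none : ∀ {n} (f g : Fin n → Bool) → (∀ i → f i ≡ false) → anyFin (λ i → f i ∧ g i) ≡ false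
anyFin-none {zero}  f g none = refl
anyFin-none {suc n} f g none rewrite none zero = anyFin-none (f ∘ suc) (g ∘ suc) (none ∘ suc)

anyFin-cong : ∀ {n} {f g : Fin n → Bool} → (∀ i → f i ≡ g i) → anyFin f ≡ anyFin g
anyFin-cong {zero}  eq = refl
anyFin-cong {suc n} eq = cong₂ _∨_ (eq zero) (anyFin-cong (eq ∘ suc))

anyFin-one-hot : ∀ {n} (j : Fin n) (g : Fin n → Bool) → anyFin (λ i → eqFin i j ∧ g i) ≡ g j
anyFin-one-hot {suc n} zero    g
  rewrite anyFin-none {n} (λ i → eqFin (suc i) zero) (g ∘ suc) (λ i → refl) with g zero
... | true  = refl
... | false = refl
anyFin-one-hot {suc n} (suc j) g = anyFin-one-hot j (g ∘ suc)

allBelow : ℕ → (ℕ → Bool) → Bool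
allBelow zero    f = true
allBelow (suc n) f = f n ∧ allBelow n f

allBelow-elim : ∀ n f → allBelow n f ≡ true → ∀ i → i < n → f i ≡ true
allBelow-elim (suc n) f eq i (s≤s i≤n) with m≤n⇒m<n∨m≡n i≤n
... | inj₁ i<n  = allBelow-elim n f (proj₂ (∧-true {f n} eq)) i i<n
... | inj₂ refl = proj₁ (∧-true eq)

allBelow-intro : ∀ n f → (∀ i → i < n → f i ≡ true) → allBelow n f ≡ true
allBelow-intro zero    f h = refl
allBelow-intro (suc n) f h = true-∧ (h n ≤-refl) (allBelow-intro n f λ i i<n → h i (m≤n⇒m≤1+n i<n))

allBelow-cong : ∀ n {f g : ℕ → Bool} → (∀ i → i < n → f i ≡ g i) → allBelow n f ≡ allBelow n g
allBelow-cong zero    eq = refl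
allBelow-cong (suc n) eq = cong₂ _∧_ (eq n ≤-refl) (allBelow-cong n λ i i<n → eq i (m≤n⇒m≤1+n i<n))

iffB : Bool → Bool → Bool
iffB a b = (a ∧ b) ∨ (not a ∧ not b)

iffB-elim : ∀ {a b} → iffB a b ≡ true → a ≡ b
iffB-elim {true}  {true}  _ = refl
iffB-elim {false} {false} _ = refl

iffB-intro : ∀ {a b} → a ≡ b → iffB a b ≡ true
iffB-intro {true}  refl = refl
iffB-intro {false} refl = refl

present val : Symbol → Bool
present nothing  = false
present (just b) = true
val nothing  = false
val (just b) = b

applyOp : Op → Word → Word
applyOp keep     w = w
applyOp (push b) w = b ∷ w
applyOp pop      w = drop 1 w

isPush isPop isKeep : Op → Bool
isPush (push _) = true
isPush _        = false
isPop pop = true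
isPop _   = false
isKeep keep = true
isKeep _    = false

pushed : Op → Bool
pushed (push b) = b
pushed _        = false

lookup-applyAt : ∀ {n} o (i : Fin n) σ k →
  lookup (applyAt o i σ) k ≡ applyOp (if eqFin i k then o else keep) (lookup σ k)
lookup-applyAt keep i σ k with eqFin i k
... | true  = refl
... | false = refl
lookup-applyAt (push b) i σ k with k Fin.≟ i
... | yes refl rewrite eqFin-refl i = Vec.lookup∘updateAt i σ
... | no k≢i   rewrite eqFin-≢ {i = i} {k} (≢-sym k≢i) = Vec.lookup∘updateAt′ k i k≢i σ
lookup-applyAt pop i σ k with k Fin.≟ i
... | yes refl rewrite eqFin-refl i = Vec.lookup∘updateAt i σ
... | no k≢i   rewrite eqFin-≢ {i = i} {k} (≢-sym k≢i) = Vec.lookup∘updateAt′ k i k≢i σ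

clamp-toℕ : ∀ {m} (i : Fin (suc m)) → clamp (toℕ i) ≡ i
clamp-toℕ {zero}  zero    = refl
clamp-toℕ {suc m} zero    = refl
clamp-toℕ {suc m} (suc i) = cong suc (clamp-toℕ i)

-- A table of `t` rows with `p` positions of `w` bits each, in row-major order behind one leading
-- variable.
assignment : ∀ {m} t p w → m ≡ t * (p * w) → (b : Bool) (f : ℕ → ℕ → Fin w → Bool) →
  Σ[ y ∈ Vec Bool (suc m) ] lookup y zero ≡ b ×
    (∀ i j c → i < t → j < p → lookup y (clamp (suc (p * w * i + (w * j + toℕ c)))) ≡ f i j c)
assignment t p w refl b f = b ∷ tabulate g , refl , at-cell
  where
  g : Fin (t * (p * w)) → Bool
  g x = let (i , y) = remQuot {t} (p * w) x ; (j , c) = remQuot {p} w y in f (toℕ i) (toℕ j) c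
  at-cell : ∀ i j c → i < t → j < p → lookup (b ∷ tabulate g) (clamp (suc (p * w * i + (w * j + toℕ c)))) ≡ f i j c
  at-cell i j c i<t j<p = begin
    lookup (b ∷ tabulate g) (clamp (suc (p * w * i + (w * j + toℕ c))))
      ≡⟨ cong (λ n → lookup (b ∷ tabulate g) (clamp (suc n))) (sym position) ⟩
    lookup (b ∷ tabulate g) (clamp (toℕ (suc x))) ≡⟨ cong (lookup (b ∷ tabulate g)) (clamp-toℕ (suc x)) ⟩
    lookup (tabulate g) x                         ≡⟨ Vec.lookup∘tabulate g x ⟩
    g x                                           ≡⟨ cong (λ (i , y) → let (j , c) = remQuot {p} w y in f (toℕ i) (toℕ j) c) (Fin.remQuot-combine i′ (combine j′ c)) ⟩
    _                                             ≡⟨ cong (λ (j , c) → f (toℕ i′) (toℕ j) c) (Fin.remQuot-combine j′ c) ⟩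
    f (toℕ i′) (toℕ j′) c                         ≡⟨ cong₂ (λ i j → f i j c) (Fin.toℕ-fromℕ< i<t) (Fin.toℕ-fromℕ< j<p) ⟩
    f i j c                                       ∎
    where
    open ≡-Reasoning
    i′ = fromℕ< i<t
    j′ = fromℕ< j<p
    x = combine i′ (combine j′ c)
    position : toℕ x ≡ p * w * i + (w * j + toℕ c)
    position = trans (Fin.toℕ-combine i′ (combine j′ c)) (cong₂ (λ a b → p * w * a + b) (Fin.toℕ-fromℕ< i<t)
      (trans (Fin.toℕ-combine j′ c) (cong (λ a → w * a + toℕ c) (Fin.toℕ-fromℕ< j<p))))

iff : ∀ {p d} → Scheme p d → Scheme p d → Scheme p d
iff a b = or (and a b) (and (neg a) (neg b))

anyS allS : ∀ {p d n} → (Fin n → Scheme p d) → Scheme p d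
anyS {n = zero}  F = const false
anyS {n = suc n} F = or (F zero) (anyS (F ∘ suc))
allS {n = zero}  F = const true
allS {n = suc n} F = and (F zero) (allS (F ∘ suc))

-- The history of a stack machine with s states and 2 + m stacks, of which
-- stack 0 is for output, stack 1 holds the certificate and the others are
-- initially either parameters or empty.  Row t lists the stacks after t steps;
-- since a step moves the contents of a stack by at most one cell, the cells
-- at distance at most T + 1 - t from the top are determined by the first T + 2
-- cells of row 0.
module Tableau {m s p : ℕ} (δ : Fin s → Maybe (Instr (2 + m) (Fin s))) (start : Fin s)
  (kind : Fin m → Maybe (Fin p)) (τ xs ys : Fin p) where

  stackCount width : ℕ
  stackCount = 2 + m
  width = stackCount + (stackCount + s)

  -- At each depth there are two bits per stack, one telling whether there is a symbol and one
  -- telling which, and a one-hot code of the state, which is read at depth 0.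
  pr vl : Fin stackCount → Fin width
  pr k = k ↑ˡ (stackCount + s)
  vl k = stackCount ↑ʳ (k ↑ˡ s)

  st : Fin s → Fin width
  st q = stackCount ↑ʳ (stackCount ↑ʳ q)

  readOf : Maybe (Instr stackCount (Fin s)) → (Fin stackCount → Word) → Symbol
  readOf nothing        σ = nothing
  readOf (just (i , _)) σ = top (σ i)

  stateOf : Maybe (Instr stackCount (Fin s)) → Fin s → Symbol → Fin s
  stateOf nothing        q a = q
  stateOf (just (_ , g)) q a = proj₂ (g a)

  opOf : Maybe (Instr stackCount (Fin s)) → Fin stackCount → Symbol → Op
  opOf nothing        k a = keep
  opOf (just (i , g)) k a = if eqFin i k then proj₁ (g a) else keep

  Snapshot : Set
  Snapshot = Fin s × (Fin stackCount → Word)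

  -- A halted machine idles, so that the output can be read in row `T` however early it was reached.
  advance : Snapshot → Snapshot
  advance (q , σ) = let a = readOf (δ q) σ in stateOf (δ q) q a , λ k → applyOp (opOf (δ q) k a) (σ k)

  after : ℕ → Snapshot → Snapshot
  after zero    c = c
  after (suc t) c = after t (advance c)

  after-suc : ∀ t c → after (suc t) c ≡ advance (after t c)
  after-suc zero    c = refl
  after-suc (suc t) c = after-suc t (advance c)

  after-+ : ∀ t u c → after (t + u) c ≡ after u (after t c)
  after-+ zero    u c = refl
  after-+ (suc t) u c = after-+ t u (advance c)

  after-halted : ∀ t {q} σ → δ q ≡ nothing → after t (q , σ) ≡ (q , σ)
  after-halted zero    σ halt = refl
  after-halted (suc t) {q} σ halt = trans (cong (after t) stuck) (after-halted t σ halt)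
    where
    stuck : advance (q , σ) ≡ (q , σ)
    stuck rewrite halt = refl

  reach-after : ∀ {q σ t q′ σ′} → Reach δ q σ t q′ σ′ → ∀ f → (∀ k → f k ≡ lookup σ k) →
    proj₁ (after t (q , f)) ≡ q′ × (∀ k → proj₂ (after t (q , f)) k ≡ lookup σ′ k)
  reach-after here f f≗σ = refl , f≗σ
  reach-after {q} {σ} {suc t} {q′} {σ′} (next {i = i} {g} eq R) f f≗σ =
    subst (λ z → proj₁ (after t (z , f₁)) ≡ q′ × (∀ k → proj₂ (after t (z , f₁)) k ≡ lookup σ′ k))
      (sym same-state) (reach-after R f₁ follows)
    where
    f₁ = proj₂ (advance (q , f))
    follows : ∀ k → f₁ k ≡ lookup (applyAt (proj₁ (g (top (lookup σ i)))) i σ) k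
    follows k rewrite eq | f≗σ i | f≗σ k = sym (lookup-applyAt (proj₁ (g (top (lookup σ i)))) i σ k)
    same-state : proj₁ (advance (q , f)) ≡ proj₂ (g (top (lookup σ i)))
    same-state rewrite eq | f≗σ i = refl

  module _ {d : ℕ} where
    cell : Index d p → Index d p → Fin width → Scheme p d
    cell t x c = Y (# 1 +ᵢ (((# 2 +ᵢ len τ) *ᵢ # width) *ᵢ t +ᵢ (# width *ᵢ x +ᵢ # toℕ c)))

    topIs : Fin stackCount → Symbol → Index d p → Scheme p d
    topIs k nothing  t = neg (cell t (# 0) (pr k))
    topIs k (just b) t = and (cell t (# 0) (pr k)) (iff (cell t (# 0) (vl k)) (const b))

    arm : Maybe (Instr stackCount (Fin s)) → (Symbol → Bool) → Index d p → Scheme p d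
    arm nothing        f t = const (f nothing)
    arm (just (i , _)) f t = or (and (topIs i nothing t) (const (f nothing)))
      (or (and (topIs i (just false) t) (const (f (just false)))) (and (topIs i (just true) t) (const (f (just true)))))

    select : (Fin s → Symbol → Bool) → Index d p → Scheme p d
    select f t = anyS λ q → and (cell t (# 0) (st q)) (arm (δ q) (f q) t)

    whenOp : (Op → Bool) → Fin stackCount → Index d p → Scheme p d
    whenOp f k = select λ q a → f (opOf (δ q) k a)

    mux : Fin stackCount → Index d p → Scheme p d → Scheme p d → Scheme p d → Scheme p d
    mux k t above below kept =
      or (and (whenOp isPush k t) above) (or (and (whenOp isPop k t) below) (and (whenOp isKeep k t) kept))

    topRule : (Fin stackCount → Fin width) → Scheme p d → Fin stackCount → Index d p → Scheme p d
    topRule col fresh k t =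
      iff (cell (# 1 +ᵢ t) (# 0) (col k)) (mux k t fresh (cell t (# 1) (col k)) (cell t (# 0) (col k)))

    cellRule : (Fin stackCount → Fin width) → Fin stackCount → Index d p → Index d p → Scheme p d
    cellRule col k t x =
      iff (cell (# 1 +ᵢ t) (# 1 +ᵢ x) (col k)) (mux k t (cell t x (col k)) (cell t (# 2 +ᵢ x) (col k)) (cell t (# 1 +ᵢ x) (col k)))

    stateRule : Fin s → Index d p → Scheme p d
    stateRule q′ t = iff (cell (# 1 +ᵢ t) (# 0) (st q′)) (select (λ q a → eqFin q′ (stateOf (δ q) q a)) t)

  cellsRule : Fin stackCount → Scheme p 2
  cellsRule k = and (cellRule pr k (bound 1F) (bound zero)) (cellRule vl k (bound 1F) (bound zero))

  topsRule stackRule : Fin stackCount → Scheme p 1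
  topsRule k  = and (topRule pr (const true) k (bound zero)) (topRule vl (whenOp pushed k (bound zero)) k (bound zero))
  -- The rule covers positions 1 to `T`. Position `T + 1` of a later row is left free, because after
  -- a pop it would come from depth `T + 2`, outside the row.
  stackRule k = and (topsRule k) (all (len τ) (cellsRule k))

  transition : Scheme p 1
  transition = and (allS λ q → stateRule q (bound zero)) (allS stackRule)

  initialCell : Fin stackCount → Scheme p 1
  initialCell k = by k
    where
    here-pr here-vl : Scheme p 1
    here-pr = cell (# 0) (bound zero) (pr k)
    here-vl = cell (# 0) (bound zero) (vl k)
    by : Fin stackCount → Scheme p 1
    by zero          = and (neg here-pr) (neg here-vl)
    -- Only the length of the certificate is prescribed. Its bits are free, and the value bits
    -- beyond its end are `false`.
    by 1F    = and (iff here-pr (bit present xs (bound zero))) (or here-pr (neg here-vl))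
    by (suc (suc j)) with kind j
    ... | nothing = and (neg here-pr) (neg here-vl)
    ... | just i  = and (iff here-pr (bit present i (bound zero))) (iff here-vl (bit val i (bound zero)))

  initialState : Fin s → Scheme p 0
  initialState q = iff (cell (# 0) (# 0) (st q)) (const (eqFin q start))

  initialStack : Fin stackCount → Scheme p 0
  initialStack k = all (# 2 +ᵢ len τ) (initialCell k)

  initially : Scheme p 0
  initially = and (allS initialState) (allS initialStack)

  -- X selects a bit of the certificate; with no bit or several bits selected,
  -- Y 0 is the disjunction of the selected bits.
  unselected : Scheme p 1
  unselected = neg (and (X (bound zero)) (cell (# 0) (bound zero) (vl 1F)))

  answer : Scheme p 0
  answer = iff (Y (# 0)) (neg (all (len xs) unselected))

  accepting : Scheme p 0
  accepting = and (cell (len τ) (# 0) (pr zero)) (cell (len τ) (# 0) (vl zero))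

  scheme : Scheme p 0
  scheme = and answer (and initially (and (all (len τ) transition) accepting))

-- Satisfying assignments of the tableau formula

eval-bigAnd : ∀ {n m} i (F : ℕ → Formula n m) x y → eval (bigAnd i F) x y ≡ allBelow i (λ j → eval (F j) x y)
eval-bigAnd zero    F x y = refl
eval-bigAnd (suc i) F x y = cong (eval (F i) x y ∧_) (eval-bigAnd i F x y)

present-length : ∀ (u v : Word) j → length u ≡ length v → present (nth u j) ≡ present (nth v j)
present-length []      []      j       eq = refl
present-length (b ∷ u) (c ∷ v) zero    eq = refl
present-length (b ∷ u) (c ∷ v) (suc j) eq = present-length u v j (suc-injective eq)

nth-beyond : ∀ (u : Word) j → length u ≤ j → nth u j ≡ nothing
nth-beyond []      zero    le       = refl
nth-beyond []      (suc j) le       = refl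
nth-beyond (b ∷ u) (suc j) (s≤s le) = nth-beyond u j le

nth-tabulate : ∀ {n} (f : Fin n → Bool) i → nth (toList (tabulate f)) (toℕ i) ≡ just (f i)
nth-tabulate f zero    = refl
nth-tabulate f (suc i) = nth-tabulate (f ∘ suc) i

length-toList : ∀ {A : Set} {n} (v : Vec A n) → length (toList v) ≡ n
length-toList []      = refl
length-toList (x ∷ v) = cong suc (length-toList v)

nth-drop : ∀ (w : Word) j → nth (drop 1 w) (suc j) ≡ nth w (2 + j)
nth-drop []      zero    = refl
nth-drop []      (suc j) = refl
nth-drop (b ∷ w) j       = refl

caseOp : ∀ {A : Set} → Op → A → A → A → A
caseOp (push _) a b c = a
caseOp pop      a b c = b
caseOp keep     a b c = c

lookup-clamp-0 : ∀ {A : Set} {m} (v : Vec A (suc m)) → lookup v (clamp 0) ≡ lookup v zero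
lookup-clamp-0 {m = zero}  v = refl
lookup-clamp-0 {m = suc m} v = refl

selected : ∀ {n} → Vec Bool (suc n) → Word → Bool
selected x z = not (allBelow (length z) λ i → not (lookup x (clamp i) ∧ val (nth z i)))

module TableauCorrect {m s p : ℕ} (δ : Fin s → Maybe (Instr (2 + m) (Fin s))) (start : Fin s)
  (kind : Fin m → Maybe (Fin p)) (τ xs ys : Fin p) (ρ : Vec Word p) where

  open Tableau δ start kind τ xs ys
  open Instance xs ys ρ renaming (n to ℓ; m to cells)

  T : ℕ
  T = length (lookup ρ τ)

  stacks₀ : Word → Fin stackCount → Word
  stacks₀ z zero          = []
  stacks₀ z 1F    = z
  stacks₀ z (suc (suc j)) with kind j
  ... | nothing = []
  ... | just i  = lookup ρ i

  snapshot : Word → ℕ → Snapshot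
  snapshot z t = after t (start , stacks₀ z)

  module _ (x : Vec Bool (suc ℓ)) (y : Vec Bool (suc cells)) where
    E : ∀ {d} → Scheme p d → Vec ℕ d → Bool
    E a ε = eval (formula a ε) x y

    E-all : ∀ {d} a (b : Scheme p (suc d)) ε → E (all a b) ε ≡ allBelow (value a ε) (λ i → E b (i ∷ ε))
    E-all a b ε = eval-bigAnd (value a ε) (λ i → formula b (i ∷ ε)) x y

    E-anyS : ∀ {d n} (F : Fin n → Scheme p d) ε → E (anyS F) ε ≡ anyFin (λ i → E (F i) ε)
    E-anyS {n = zero}  F ε = refl
    E-anyS {n = suc n} F ε = cong (E (F zero) ε ∨_) (E-anyS (F ∘ suc) ε)

    E-allS : ∀ {d n} (F : Fin n → Scheme p d) ε → E (allS F) ε ≡ allFin (λ i → E (F i) ε)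
    E-allS {n = zero}  F ε = refl
    E-allS {n = suc n} F ε = cong (E (F zero) ε ∧_) (E-allS (F ∘ suc) ε)

    entryAt : ℕ → ℕ → Fin width → Bool
    entryAt t j c = lookup y (clamp (suc ((2 + T) * width * t + (width * j + toℕ c))))

    -- Correctness is claimed down to depth `R` only, since a pop reads one level deeper in the
    -- preceding row: each step costs one level.
    record Row (R t : ℕ) (c : Snapshot) : Set where
      constructor row
      field
        row-st : ∀ q′ → entryAt t 0 (st q′) ≡ eqFin q′ (proj₁ c)
        row-pr : ∀ k j → j ≤ R → entryAt t j (pr k) ≡ present (nth (proj₂ c k) j)
        row-vl : ∀ k j → j ≤ R → entryAt t j (vl k) ≡ val (nth (proj₂ c k) j)

    open Row

    module _ {d R} (ti : Index d p) (ε : Vec ℕ d) (c : Snapshot) (r : Row R (value ti ε) c) where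
      private
        t = value ti ε
        q = proj₁ c
        σ = proj₂ c
        a = readOf (δ q) σ

      E-arm : ∀ o f → E (arm o f ti) ε ≡ f (readOf o σ)
      E-arm nothing        f = refl
      E-arm (just (i , _)) f rewrite row-pr r i 0 z≤n | row-vl r i 0 z≤n with top (σ i)
      ... | nothing    = Bool.∨-identityʳ _
      ... | just false = Bool.∨-identityʳ _
      ... | just true  = refl

      E-select : ∀ f → E (select f ti) ε ≡ f q a
      E-select f = begin
        E (select f ti) ε ≡⟨ E-anyS (λ q → and (cell ti (# 0) (st q)) (arm (δ q) (f q) ti)) ε ⟩
        anyFin (λ q′ → entryAt t 0 (st q′) ∧ E (arm (δ q′) (f q′) ti) ε)
          ≡⟨ anyFin-cong (λ q′ → cong (_∧ E (arm (δ q′) (f q′) ti) ε) (row-st r q′)) ⟩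
        anyFin (λ q′ → eqFin q′ q ∧ E (arm (δ q′) (f q′) ti) ε) ≡⟨ anyFin-one-hot q (λ q′ → E (arm (δ q′) (f q′) ti) ε) ⟩
        E (arm (δ q) (f q) ti) ε ≡⟨ E-arm (δ q) (f q) ⟩
        f q a ∎
        where open ≡-Reasoning

      E-mux : ∀ k above below kept → E (mux k ti above below kept) ε ≡
        caseOp (opOf (δ q) k a) (E above ε) (E below ε) (E kept ε)
      E-mux k above below kept
        rewrite E-select (λ q a → isPush (opOf (δ q) k a)) | E-select (λ q a → isPop (opOf (δ q) k a))
              | E-select (λ q a → isKeep (opOf (δ q) k a))
        with opOf (δ q) k a
      ... | push _ = Bool.∨-identityʳ _
      ... | pop    = Bool.∨-identityʳ _
      ... | keep   = refl

      E-state : ∀ q′ → E (select (λ q a → eqFin q′ (stateOf (δ q) q a)) ti) ε ≡ eqFin q′ (proj₁ (advance c))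
      E-state q′ = E-select (λ q a → eqFin q′ (stateOf (δ q) q a))

      -- Presence and value bits obey the same rule up to the bit that a push writes; `P` and
      -- `fresh` make one proof serve both.
      E-top : ∀ (col : Fin stackCount → Fin width) (P : Symbol → Bool) k fresh →
        (∀ j → j ≤ R → entryAt t j (col k) ≡ P (nth (σ k) j)) → 1 ≤ R →
        (∀ b → opOf (δ q) k a ≡ push b → E fresh ε ≡ P (just b)) →
        E (mux k ti fresh (cell ti (# 1) (col k)) (cell ti (# 0) (col k))) ε ≡ P (nth (proj₂ (advance c) k) 0)
      E-top col P k fresh e 1≤R efresh =
        trans (E-mux k fresh (cell ti (# 1) (col k)) (cell ti (# 0) (col k))) (by (opOf (δ q) k a) refl)
        where
        by : ∀ o → opOf (δ q) k a ≡ o →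
          caseOp o (E fresh ε) (entryAt t 1 (col k)) (entryAt t 0 (col k)) ≡ P (nth (applyOp o (σ k)) 0)
        by (push b) eq = efresh b eq
        by pop      eq = e 1 1≤R
        by keep     eq = e 0 z≤n

      E-cell : ∀ (col : Fin stackCount → Fin width) (P : Symbol → Bool) k (xi : Index d p) →
        (∀ j → j ≤ R → entryAt t j (col k) ≡ P (nth (σ k) j)) → 2 + value xi ε ≤ R →
        E (mux k ti (cell ti xi (col k)) (cell ti (# 2 +ᵢ xi) (col k)) (cell ti (# 1 +ᵢ xi) (col k))) ε ≡
        P (nth (proj₂ (advance c) k) (suc (value xi ε)))
      E-cell col P k xi e le =
        trans (E-mux k (cell ti xi (col k)) (cell ti (# 2 +ᵢ xi) (col k)) (cell ti (# 1 +ᵢ xi) (col k)))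
          (by (opOf (δ q) k a))
        where
        j = value xi ε
        by : ∀ o → caseOp o (entryAt t j (col k)) (entryAt t (2 + j) (col k)) (entryAt t (1 + j) (col k)) ≡
          P (nth (applyOp o (σ k)) (suc j))
        by (push b) = e j (≤-trans (m≤n+m _ 2) le)
        by pop      = trans (e (2 + j) le) (cong P (sym (nth-drop (σ k) j)))
        by keep     = e (1 + j) (≤-trans (n≤1+n _) le)

      E-top-pr : ∀ k → 1 ≤ R →
        E (mux k ti (const true) (cell ti (# 1) (pr k)) (cell ti (# 0) (pr k))) ε ≡ present (nth (proj₂ (advance c) k) 0)
      E-top-pr k 1≤R = E-top pr present k (const true) (row-pr r k) 1≤R (λ b _ → refl)

      E-top-vl : ∀ k → 1 ≤ R →
        E (mux k ti (whenOp pushed k ti) (cell ti (# 1) (vl k)) (cell ti (# 0) (vl k))) ε ≡ val (nth (proj₂ (advance c) k) 0)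
      E-top-vl k 1≤R = E-top vl val k (whenOp pushed k ti) (row-vl r k) 1≤R
        (λ b eq → trans (E-select (λ q a → pushed (opOf (δ q) k a))) (cong pushed eq))

    module _ (t : ℕ) (c : Snapshot) where
      private
        ε : Vec ℕ 1
        ε = t ∷ []
        ti : ∀ {d} → Index (suc d) p
        ti = bound zero

      transition-sound : ∀ {R} → R ≤ T → Row (suc R) t c → E transition ε ≡ true → Row R (suc t) (advance c)
      transition-sound {R} R≤T r eq = row st′ pr′ vl′
        where
        eqs = ∧-true {E (allS λ q → stateRule q ti) ε} eq
        stackwise : ∀ k → E (stackRule k) ε ≡ true
        stackwise = allFin-elim _ (trans (sym (E-allS stackRule ε)) (proj₂ eqs))
        tops : ∀ k → E (topRule pr (const true) k ti) ε ≡ true × E (topRule vl (whenOp pushed k ti) k ti) ε ≡ true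
        tops k = ∧-true (proj₁ (∧-true {E (topsRule k) ε} (stackwise k)))
        below : ∀ k j → j < T → E (cellRule pr k (bound 1F) (bound zero)) (j ∷ ε) ≡ true ×
          E (cellRule vl k (bound 1F) (bound zero)) (j ∷ ε) ≡ true
        below k j j<T = ∧-true (allBelow-elim T (λ j → E (cellsRule k) (j ∷ ε))
          (trans (sym (E-all (len τ) (cellsRule k) ε)) (proj₂ (∧-true {E (topsRule k) ε} (stackwise k)))) j j<T)
        st′ : ∀ q′ → entryAt (suc t) 0 (st q′) ≡ eqFin q′ (proj₁ (advance c))
        st′ q′ = trans (iffB-elim (allFin-elim _ (trans (sym (E-allS (λ q → stateRule q ti) ε)) (proj₁ eqs)) q′)) (E-state ti ε c r q′)
        pr′ : ∀ k j → j ≤ R → entryAt (suc t) j (pr k) ≡ present (nth (proj₂ (advance c) k) j)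
        pr′ k zero    le = trans (iffB-elim (proj₁ (tops k))) (E-top-pr ti ε c r k (s≤s z≤n))
        pr′ k (suc j) le = trans (iffB-elim (proj₁ (below k j (≤-trans le R≤T))))
          (E-cell (bound 1F) (j ∷ ε) c r pr present k (bound zero) (row-pr r k) (s≤s le))
        vl′ : ∀ k j → j ≤ R → entryAt (suc t) j (vl k) ≡ val (nth (proj₂ (advance c) k) j)
        vl′ k zero    le = trans (iffB-elim (proj₂ (tops k))) (E-top-vl ti ε c r k (s≤s z≤n))
        vl′ k (suc j) le = trans (iffB-elim (proj₂ (below k j (≤-trans le R≤T))))
          (E-cell (bound 1F) (j ∷ ε) c r vl val k (bound zero) (row-vl r k) (s≤s le))

      -- In the table filled in from an actual run all positions of all rows are correct, so here no
      -- depth is lost.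
      transition-complete : Row (suc T) t c → Row (suc T) (suc t) (advance c) → E transition ε ≡ true
      transition-complete r r′ = true-∧
        (trans (E-allS (λ q → stateRule q ti) ε) (allFin-intro _ λ q′ → iffB-intro (trans (row-st r′ q′) (sym (E-state ti ε c r q′)))))
        (trans (E-allS stackRule ε) (allFin-intro _ λ k → true-∧
          (true-∧ (iffB-intro (trans (row-pr r′ k 0 z≤n) (sym (E-top-pr ti ε c r k (s≤s z≤n)))))
                  (iffB-intro (trans (row-vl r′ k 0 z≤n) (sym (E-top-vl ti ε c r k (s≤s z≤n))))))
          (trans (E-all (len τ) (cellsRule k) ε) (allBelow-intro T _ λ j j<T → true-∧
            (iffB-intro (trans (row-pr r′ k (suc j) (s≤s (<⇒≤ j<T)))
              (sym (E-cell (bound 1F) (j ∷ ε) c r pr present k (bound zero) (row-pr r k) (s≤s j<T)))))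
            (iffB-intro (trans (row-vl r′ k (suc j) (s≤s (<⇒≤ j<T)))
              (sym (E-cell (bound 1F) (j ∷ ε) c r vl val k (bound zero) (row-vl r k) (s≤s j<T)))))))))

    certificate : Word
    certificate = toList (tabulate {n = ℓ} λ i → entryAt 0 (toℕ i) (vl 1F))

    length-certificate : length certificate ≡ ℓ
    length-certificate = length-toList (tabulate {n = ℓ} λ i → entryAt 0 (toℕ i) (vl 1F))

    nth-certificate : ∀ j → j < ℓ → nth certificate j ≡ just (entryAt 0 j (vl 1F))
    nth-certificate j j<ℓ = subst (λ i → nth certificate i ≡ just (entryAt 0 i (vl 1F))) (Fin.toℕ-fromℕ< j<ℓ)
      (nth-tabulate (λ i → entryAt 0 (toℕ i) (vl 1F)) (fromℕ< j<ℓ))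

    initial-row : E initially [] ≡ true → Row (suc T) 0 (start , stacks₀ certificate)
    initial-row eq = row st′ (λ k j le → proj₁ (cells′ k j (initial-cell k j le))) (λ k j le → proj₂ (cells′ k j (initial-cell k j le)))
      where
      eqs = ∧-true {E (allS initialState) []} eq
      st′ : ∀ q′ → entryAt 0 0 (st q′) ≡ eqFin q′ start
      st′ q′ = iffB-elim (allFin-elim _ (trans (sym (E-allS initialState [])) (proj₁ eqs)) q′)
      initial-cell : ∀ k j → j ≤ suc T → E (initialCell k) (j ∷ []) ≡ true
      initial-cell k j le = allBelow-elim (2 + T) (λ j → E (initialCell k) (j ∷ []))
        (trans (sym (E-all (# 2 +ᵢ len τ) (initialCell k) []))
          (allFin-elim (λ k → E (initialStack k) []) (trans (sym (E-allS initialStack [])) (proj₂ eqs)) k)) j (s≤s le)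
      not-true : ∀ {b} → not b ≡ true → b ≡ false
      not-true {false} _ = refl
      empty : ∀ {c d} j → not (entryAt 0 j c) ∧ not (entryAt 0 j d) ≡ true →
        entryAt 0 j c ≡ present (nth [] j) × entryAt 0 j d ≡ val (nth [] j)
      empty j e rewrite nth-beyond [] j z≤n = not-true (proj₁ (∧-true e)) , not-true (proj₂ (∧-true e))
      cells′ : ∀ k j → E (initialCell k) (j ∷ []) ≡ true →
        entryAt 0 j (pr k) ≡ present (nth (stacks₀ certificate k) j) × entryAt 0 j (vl k) ≡ val (nth (stacks₀ certificate k) j)
      cells′ zero       j e = empty j e
      cells′ 1F j e = is-present , is-val (j <? ℓ)
        where
        e′ = ∧-true {iffB (entryAt 0 j (pr 1F)) (present (nth (lookup ρ xs) j))} e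
        is-present : entryAt 0 j (pr 1F) ≡ present (nth certificate j)
        is-present = trans (iffB-elim (proj₁ e′)) (present-length (lookup ρ xs) certificate j (sym length-certificate))
        or-not : ∀ {a b} → a ≡ false → a ∨ not b ≡ true → b ≡ false
        or-not {false} {false} _ _ = refl
        is-val : Dec (j < ℓ) → entryAt 0 j (vl 1F) ≡ val (nth certificate j)
        is-val (yes j<ℓ) = cong val (sym (nth-certificate j j<ℓ))
        is-val (no j≮ℓ) = trans (or-not (trans is-present (cong present beyond)) (proj₂ e′)) (cong val (sym beyond))
          where
          beyond : nth certificate j ≡ nothing
          beyond = nth-beyond certificate j (≤-trans (≤-reflexive length-certificate) (≮⇒≥ j≮ℓ))
      cells′ (suc (suc i)) j e with kind i
      ... | nothing = empty j e
      ... | just l  = iffB-elim (proj₁ (∧-true e)) ,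
        iffB-elim (proj₂ (∧-true {iffB (entryAt 0 j (pr (suc (suc i)))) (present (nth (lookup ρ l) j))} e))

    -- The triangle of reliable cells, `t + R ≡ suc T`. Row `T` is still reliable at depths 0 and 1,
    -- and its top cell shows the output.
    rows : E initially [] ≡ true → E (all (len τ) transition) [] ≡ true →
      ∀ t R → t + R ≡ suc T → 1 ≤ R → Row R t (snapshot certificate t)
    rows init trans′ zero    R refl 1≤R = initial-row init
    rows init trans′ (suc t) R eq 1≤R = subst (Row R (suc t)) (sym (after-suc t (start , stacks₀ certificate)))
      (transition-sound t (snapshot certificate t) (≤-trans (m≤n+m R t) (≤-reflexive (suc-injective eq)))
        (rows init trans′ t (suc R) (trans (+-suc t R) eq) (s≤s z≤n))
        (allBelow-elim T (λ i → E transition (i ∷ [])) (trans (sym (E-all (len τ) transition [])) trans′) t t<T))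
      where
      t<T : t < T
      t<T = ≤-trans (≤-trans (≤-reflexive (+-comm 1 t)) (+-monoʳ-≤ t 1≤R)) (≤-reflexive (suc-injective eq))

    E-answer : ∀ z → length z ≡ ℓ → (∀ j → j < ℓ → entryAt 0 j (vl 1F) ≡ val (nth z j)) →
      E (neg (all (len xs) unselected)) [] ≡ selected x z
    E-answer z len-z vals = cong not (trans (E-all (len xs) unselected []) (subst (λ n → allBelow ℓ (λ i → E unselected (i ∷ [])) ≡ allBelow n (λ i → not (lookup x (clamp i) ∧ val (nth z i)))) (sym len-z)
      (allBelow-cong ℓ λ i i<ℓ → cong (λ b → not (lookup x (clamp i) ∧ b)) (vals i i<ℓ))))

    sound : E scheme [] ≡ true →
      lookup y zero ≡ selected x certificate × top (proj₂ (snapshot certificate T) zero) ≡ just true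
    sound eq = answers , accepts (rows init trans′ T 1 (+-comm T 1) ≤-refl) (∧-true (proj₂ e₃))
      where
      e₁ = ∧-true {E answer []} eq
      e₂ = ∧-true {E initially []} (proj₂ e₁)
      e₃ = ∧-true {E (all (len τ) transition) []} (proj₂ e₂)
      init = proj₁ e₂
      trans′ = proj₁ e₃
      answers : lookup y zero ≡ selected x certificate
      answers = trans (sym (lookup-clamp-0 y)) (trans (iffB-elim (proj₁ e₁))
        (E-answer certificate length-certificate λ j j<ℓ → cong val (sym (nth-certificate j j<ℓ))))
      accepts : Row 1 T (snapshot certificate T) → entryAt T 0 (pr zero) ≡ true × entryAt T 0 (vl zero) ≡ true →
        top (proj₂ (snapshot certificate T) zero) ≡ just true
      accepts r (p , v) = symbol (top (proj₂ (snapshot certificate T) zero)) (trans (sym (row-pr r zero 0 z≤n)) p) (trans (sym (row-vl r zero 0 z≤n)) v)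
        where
        symbol : ∀ a → present a ≡ true → val a ≡ true → a ≡ just true
        symbol (just true) _ _ = refl

    -- The hypothesis `ℓ ≤ 2 + T` puts all certificate bits mentioned by `answer` into row 0, where
    -- `Row` determines them.
    complete-rows : ∀ z → length z ≡ ℓ → ℓ ≤ 2 + T → lookup y zero ≡ selected x z →
      (∀ t → t ≤ T → Row (suc T) t (snapshot z t)) → top (proj₂ (snapshot z T) zero) ≡ just true →
      E scheme [] ≡ true
    complete-rows z len-z ℓ≤ ans r acc = true-∧ answers (true-∧ init (true-∧ trans′ final))
      where
      answers : E answer [] ≡ true
      answers = iffB-intro (trans (lookup-clamp-0 y) (trans ans (sym (E-answer z len-z λ j j<ℓ →
        row-vl (r 0 z≤n) 1F j (≤-pred (≤-trans j<ℓ ℓ≤))))))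
      trans′ : E (all (len τ) transition) [] ≡ true
      trans′ = trans (E-all (len τ) transition []) (allBelow-intro T _ λ t t<T →
        transition-complete t (snapshot z t) (r t (<⇒≤ t<T))
          (subst (Row (suc T) (suc t)) (after-suc t (start , stacks₀ z)) (r (suc t) t<T)))
      final : E accepting [] ≡ true
      final = true-∧ (trans (row-pr (r T ≤-refl) zero 0 z≤n) (cong present acc))
                     (trans (row-vl (r T ≤-refl) zero 0 z≤n) (cong val acc))
      cell-ok : ∀ k j → j ≤ suc T → E (initialCell k) (j ∷ []) ≡ true
      cell-ok k j le = by k (row-pr (r 0 z≤n) k j le) (row-vl (r 0 z≤n) k j le)
        where
        empty : ∀ {a b} → a ≡ present (nth [] j) → b ≡ val (nth [] j) → not a ∧ not b ≡ true
        empty p v rewrite nth-beyond [] j z≤n | p | v = refl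
        absent : ∀ a {b c} → b ≡ present a → c ≡ val a → b ∨ not c ≡ true
        absent nothing  refl refl = refl
        absent (just _) refl refl = refl
        by : ∀ k → entryAt 0 j (pr k) ≡ present (nth (stacks₀ z k) j) → entryAt 0 j (vl k) ≡ val (nth (stacks₀ z k) j) →
          E (initialCell k) (j ∷ []) ≡ true
        by zero          p v = empty p v
        by 1F    p v = true-∧ (iffB-intro (trans p (present-length z (lookup ρ xs) j len-z))) (absent (nth z j) p v)
        by (suc (suc i)) p v with kind i
        ... | nothing = empty p v
        ... | just l  = true-∧ (iffB-intro p) (iffB-intro v)
      init : E initially [] ≡ true
      init = true-∧ (trans (E-allS initialState []) (allFin-intro _ λ q′ → iffB-intro (row-st (r 0 z≤n) q′)))
        (trans (E-allS initialStack []) (allFin-intro _ λ k →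
          trans (E-all (# 2 +ᵢ len τ) (initialCell k) []) (allBelow-intro (2 + T) _ λ j j< → cell-ok k j (≤-pred j<))))

  contentsOf : Snapshot → ℕ → Fin width → Bool
  contentsOf (q , σ) j c with splitAt stackCount c
  ... | inj₁ k = present (nth (σ k) j)
  ... | inj₂ d with splitAt stackCount d
  ... | inj₁ k  = val (nth (σ k) j)
  ... | inj₂ q′ = eqFin q′ q

  complete : ∀ z → length z ≡ ℓ → ℓ ≤ 2 + T → cells ≡ suc T * ((2 + T) * width) →
    top (proj₂ (snapshot z T) zero) ≡ just true → ∀ x → ∃[ y ] eval (formula scheme []) x y ≡ true
  complete z len-z ℓ≤ size acc x
    with assignment (suc T) (2 + T) width size (selected x z) (λ t → contentsOf (snapshot z t))
  ... | y , y₀ , y₊ = y , complete-rows x y z len-z ℓ≤ y₀ (λ t t≤T → row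
    (λ q′ → trans (y₊ t 0 (st q′) (s≤s t≤T) (s≤s z≤n)) (at-st (snapshot z t) 0 q′))
    (λ k j j≤ → trans (y₊ t j (pr k) (s≤s t≤T) (s≤s j≤)) (at-pr (snapshot z t) j k))
    (λ k j j≤ → trans (y₊ t j (vl k) (s≤s t≤T) (s≤s j≤)) (at-vl (snapshot z t) j k))) acc
    where
    at-pr : ∀ c j k → contentsOf c j (pr k) ≡ present (nth (proj₂ c k) j)
    at-pr c j k rewrite Fin.splitAt-↑ˡ stackCount k (stackCount + s) = refl
    at-vl : ∀ c j k → contentsOf c j (vl k) ≡ val (nth (proj₂ c k) j)
    at-vl c j k rewrite Fin.splitAt-↑ʳ stackCount (stackCount + s) (k ↑ˡ s) | Fin.splitAt-↑ˡ stackCount k s = refl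
    at-st : ∀ c j q′ → contentsOf c j (st q′) ≡ eqFin q′ (proj₁ c)
    at-st c j q′ rewrite Fin.splitAt-↑ʳ stackCount (stackCount + s) (stackCount ↑ʳ q′) | Fin.splitAt-↑ʳ stackCount s q′ = refl

-- The question to the synthesizer: totality, uniqueness and circuit size

allVars : ∀ {k} → FP k
allVars {zero}  = nil
allVars {suc k} = var zero ⊹ wk allVars

length-allVars : ∀ {k} (ρ : Vec Word k) → length (fun allVars ρ) ≡ total ρ
length-allVars []      = refl
length-allVars (w ∷ ρ) = trans (List.length-++ w) (cong (length w +_) (length-allVars ρ))

-- The bits `f` are wired into the circuit: an or-gate is spent only on a bit that is `true`. The
-- new gate is the accumulator at wire 0, which shifts the wires named by `g`.
select : ∀ {k} → ℕ → (ℕ → Bool) → (ℕ → Fin k) → Fin k → Circuit k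
select zero    f g acc = out acc
select (suc n) f g acc = if f n then or acc (g n) ▸ select n f (suc ∘ g) zero else select n f g acc

size-select : ∀ {k} n f (g : ℕ → Fin k) acc → size (select n f g acc) ≤ n
size-select zero    f g acc = z≤n
size-select (suc n) f g acc with f n
... | true  = s≤s (size-select n f (suc ∘ g) zero)
... | false = m≤n⇒m≤1+n (size-select n f g acc)

eval-select : ∀ {k} n f (g : ℕ → Fin k) acc ρ →
  evalCircuit (select n f g acc) ρ ≡ lookup ρ acc ∨ not (allBelow n λ i → not (lookup ρ (g i) ∧ f i))
eval-select zero    f g acc ρ = sym (Bool.∨-identityʳ _)
eval-select (suc n) f g acc ρ with f n
... | true  = trans (eval-select n f (suc ∘ g) zero _) (merge (lookup ρ acc) (lookup ρ (g n)) _)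
  where
  merge : ∀ a b c → (a ∨ b) ∨ not c ≡ a ∨ not (not (b ∧ true) ∧ c)
  merge true  b     c = refl
  merge false true  c = refl
  merge false false c = refl
... | false rewrite Bool.∧-zeroʳ (lookup ρ (g n)) = eval-select n f g acc ρ

size-bigAnd : ∀ {n m} i (F : ℕ → Formula n m) → i ≤ ∣ bigAnd i F ∣
size-bigAnd zero    F = z≤n
size-bigAnd (suc i) F = s≤s (≤-trans (size-bigAnd i F) (m≤n+m _ ∣ F i ∣))

-- The question has the conjunction over all certificate bits as a subformula. A circuit with one
-- gate per bit and one constant gate is therefore no larger than the question, which makes a linear
-- size promise sufficient.
size-disjunction : ∀ {n m} i F (a c d : Formula n m) → suc i ≤ ∣ and (or (and a (neg (bigAnd i F))) c) d ∣
size-disjunction i F a c d = s≤s (begin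
  i                                                        ≤⟨ size-bigAnd i F ⟩
  ∣ bigAnd i F ∣                                           ≤⟨ m≤n+m _ (3 + ∣ a ∣) ⟩
  3 + ∣ a ∣ + ∣ bigAnd i F ∣                               ≡⟨ eq ∣ a ∣ ∣ bigAnd i F ∣ ⟩
  ∣ a ∣ + suc ∣ bigAnd i F ∣ + 2                           ≡⟨ +-comm _ 2 ⟩
  2 + (∣ a ∣ + suc ∣ bigAnd i F ∣)                         ≤⟨ m≤m+n _ ∣ c ∣ ⟩
  ∣ or (and a (neg (bigAnd i F))) c ∣                      ≤⟨ m≤m+n _ ∣ d ∣ ⟩
  ∣ or (and a (neg (bigAnd i F))) c ∣ + ∣ d ∣              ∎)
  where
  open ≤-Reasoning
  eq : ∀ x y → 3 + x + y ≡ x + suc y + 2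
  eq = solve-∀

module Verifier {k} (V : FP (suc k)) where
  S : Stmt (2 + k)
  S = code V

  extra : ℕ
  extra = depth S

  states : Finite (State S)
  states = State-finite S

  open Finite states

  place : Vec (Fin (2 + (k + extra))) (2 + k)
  place = tabulate (_↑ˡ extra)

  δ : Fin card → Maybe (Instr (2 + (k + extra)) (Fin card))
  δ q = Maybe.map (mapInstr encode) (compile S place (2 + k) (decode q))

  start : Fin card
  start = encode (entry S)

  -- The parameters proper stand behind the three words `ys`, `τ` and `xs`. The stacks kept for
  -- `new` start empty.
  kind : Fin (k + extra) → Maybe (Fin (3 + k))
  kind j with splitAt k j
  ... | inj₁ i = just (suc (suc (suc i)))
  ... | inj₂ _ = nothing

  τ xs ys : Fin (3 + k)
  ys = zero
  τ  = suc zero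
  xs = suc 1F

  open Tableau δ start kind τ xs ys using (width; scheme; unselected; initially; transition; accepting; after; after-+; after-halted; reach-after)

  -- The summand `N` makes `T` at least the length of the certificate, so that the latter fits into
  -- row 0.
  timeBound : PolyExpr
  timeBound = cost V ⊕ N

  -- The certificate is unknown when the question is written: `u` stands in for it and contributes
  -- its length, on which the time bound depends.
  parameters : Word → Vec Word k → Vec Word (3 + k)
  parameters u ρ = ones (suc T * ((2 + T) * width)) ∷ ones T ∷ u ∷ ρ
    where T = ⟪ timeBound ⟫ (total (u ∷ ρ))

  requestFP : FP (suc k)
  requestFP = let′ (polyFP timeBound allVars) (let′
    (mulFP (constant (ones 1) ⊹ lengthFP (var zero)) (mulFP (constant (ones 2) ⊹ lengthFP (var zero)) (constant (ones width))))
    (constant (true ∷ []) ⊹ lengthFP (var xs) ⊹ constant (false ∷ true ∷ []) ⊹ lengthFP (var ys) ⊹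
      constant (false ∷ false ∷ []) ⊹ Generator.schemeFP xs ys scheme))

  module _ (u : Word) (ρ : Vec Word k) where
    private
      σ = parameters u ρ

    open Instance xs ys σ using (formula) renaming (n to ℓ; m to cells) public
    open TableauCorrect δ start kind τ xs ys σ using (stacks₀; snapshot; T; sound; complete; certificate; length-certificate) public

    question : Formula (suc ℓ) (suc cells)
    question = formula scheme []

    fun-requestFP : fun requestFP (u ∷ ρ) ≡ encodeInput question zero
    fun-requestFP = trans (cong₂ (λ v w → body (w ∷ v ∷ u ∷ ρ)) time cell-count) (Generator.inputFP-spec xs ys σ scheme)
      where
      t = ⟪ timeBound ⟫ (total (u ∷ ρ))
      body : Vec Word (3 + k) → Word
      body = fun (constant (true ∷ []) ⊹ lengthFP (var xs) ⊹ constant (false ∷ true ∷ []) ⊹ lengthFP (var ys) ⊹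
        constant (false ∷ false ∷ []) ⊹ Generator.schemeFP xs ys scheme)
      time : fun (polyFP timeBound allVars) (u ∷ ρ) ≡ ones t
      time = trans (fun-polyFP timeBound allVars (u ∷ ρ)) (cong (λ n → ones (⟪ timeBound ⟫ n)) (length-allVars (u ∷ ρ)))
      counter : FP (2 + k)
      counter = lengthFP (var zero)
      cell-count : fun (mulFP (constant (ones 1) ⊹ counter) (mulFP (constant (ones 2) ⊹ counter) (constant (ones width))))
        (fun (polyFP timeBound allVars) (u ∷ ρ) ∷ u ∷ ρ) ≡ ones (suc t * ((2 + t) * width))
      cell-count rewrite time = fun-mulFP (constant (ones 1) ⊹ counter) (mulFP (constant (ones 2) ⊹ counter) (constant (ones width))) env
        (fun-⊹ (constant (ones 1)) counter env refl count)
        (fun-mulFP (constant (ones 2) ⊹ counter) (constant (ones width)) env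
          (fun-⊹ (constant (ones 2)) counter env refl count) (fun-constant (ones width) env))
        where
        env : Vec Word (2 + k)
        env = ones t ∷ u ∷ ρ
        count : fun counter env ≡ ones t
        count = trans (loop-length (ones t)) (cong ones (length-ones t))

    T≡ : T ≡ ⟪ timeBound ⟫ (total (u ∷ ρ))
    T≡ = length-ones _

    -- As `z` is as long as `u` and costs depend on lengths alone, the verifier halts within `T`
    -- steps; for the rest of the time it idles.
    output-top : ∀ z → length z ≡ ℓ → top (proj₂ (snapshot z T) zero) ≡ top (fun V (z ∷ ρ))
    output-top z len-z with spec₀ V (z ∷ ρ)
    ... | c , D , c≤ with compile-correct D place (2 + k) store separate (≤-reflexive (+-comm extra (2 + k))) (represents , free)
      where
      store : Vec Word (2 + (k + extra))
      store = ([] ∷ z ∷ ρ) Vec.++ Vec.replicate extra []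
      separate : Separate place (2 + k)
      separate = (λ i j eq → Fin.↑ˡ-injective extra i j (trans (sym (Vec.lookup∘tabulate (_↑ˡ extra) i))
                   (trans eq (Vec.lookup∘tabulate (_↑ˡ extra) j)))) ,
        (λ i → subst (λ x → toℕ x < 2 + k) (sym (Vec.lookup∘tabulate (_↑ˡ extra) i))
          (≤-trans (s≤s (≤-reflexive (Fin.toℕ-↑ˡ i extra))) (Fin.toℕ<n i)))
      represents : ∀ i → lookup store (lookup place i) ≡ lookup ([] ∷ z ∷ ρ) i
      represents i = trans (cong (lookup store) (Vec.lookup∘tabulate (_↑ˡ extra) i))
        (Vec.lookup-++ˡ ([] ∷ z ∷ ρ) (Vec.replicate extra []) i)
      free : ∀ x → 2 + k ≤ toℕ x → lookup store x ≡ []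
      free x le = trans (Vec.lookup-++-≥ ([] ∷ z ∷ ρ) (Vec.replicate extra []) x le)
        (Vec.lookup-replicate (Data.Fin.Base.reduce≥ x le) [])
    ... | q , store′ , R , halt , (rep , _) , _ = cong top (begin
      proj₂ (snapshot z T) zero ≡⟨ cong (λ t → proj₂ (after t c₀) zero) (m+[n∸m]≡n c≤T) ⟨
      proj₂ (after (c + (T ∸ c)) c₀) zero ≡⟨ cong (λ x → proj₂ x zero) (after-+ c (T ∸ c) c₀) ⟩
      proj₂ (after (T ∸ c) (after c c₀)) zero ≡⟨ cong (λ x → proj₂ x zero) (after-halted (T ∸ c) (proj₂ (after c c₀)) halted) ⟩
      proj₂ (after c c₀) zero ≡⟨ proj₂ reached zero ⟩
      lookup store′ zero      ≡⟨ rep zero ⟩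
      fun V (z ∷ ρ)           ∎)
      where
      open ≡-Reasoning
      c₀ = start , stacks₀ z
      initial-stacks : ∀ j → stacks₀ z j ≡ lookup (([] ∷ z ∷ ρ) Vec.++ Vec.replicate extra []) j
      initial-stacks zero       = refl
      initial-stacks 1F = refl
      initial-stacks (suc (suc j)) rewrite Vec.lookup-splitAt k ρ (Vec.replicate extra []) j with splitAt k j
      ... | inj₁ i = refl
      ... | inj₂ i = sym (Vec.lookup-replicate i [])
      encoded : ∀ q I → compile S place (2 + k) q ≡ just I → δ (encode q) ≡ just (mapInstr encode I)
      encoded q I eq rewrite decode-encode q | eq = refl
      reached = reach-after (Reach-map encode encoded R) (stacks₀ z) initial-stacks
      halted : δ (proj₁ (after c c₀)) ≡ nothing
      halted rewrite proj₁ reached | decode-encode q | halt = refl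
      c≤T : c ≤ T
      c≤T = ≤-trans c≤ (≤-trans (≤-reflexive (cong (λ l → ⟪ cost V ⟫ (l + total ρ)) len-z))
        (≤-trans (m≤m+n _ _) (≤-reflexive (sym T≡))))

    Accepted : Word → Set
    Accepted z = length z ≡ length u × top (fun V (z ∷ ρ)) ≡ just true

    -- The run on `z` is the same for all inputs: `x` enters only into the value of `Y 0`, which can
    -- be set accordingly.
    question-total : ∀ z → Accepted z → Total question
    question-total z (len-z , acc) = complete z len-z ℓ≤T cells≡ (trans (output-top z len-z) acc)
      where
      ℓ≤T : ℓ ≤ 2 + T
      ℓ≤T = ≤-trans (≤-trans (m≤m+n (length u) (total ρ)) (m≤n+m _ (⟪ cost V ⟫ (total (u ∷ ρ)))))
        (≤-trans (≤-reflexive (sym T≡)) (m≤n+m T 2))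
      cells≡ : cells ≡ suc T * ((2 + T) * width)
      cells≡ = trans (length-ones _) (cong (λ t → suc t * ((2 + t) * width)) (sym T≡))

    question-sound : ∀ x y → eval question x y ≡ true → ∃[ z ] Accepted z × lookup y zero ≡ selected x z
    question-sound x y sat = certificate x y , (length-certificate x y ,
      trans (sym (output-top (certificate x y) (length-certificate x y))) (proj₂ (sound x y sat))) , proj₁ (sound x y sat)

    module _ (z : Word) (acc : Accepted z) (unique : ∀ z′ → Accepted z′ → z′ ≡ z) where
      question-answer : ∀ x y → eval question x y ≡ true → lookup y zero ≡ selected x z
      question-answer x y sat = let (z′ , acc′ , ans) = question-sound x y sat in
        trans ans (cong (selected x) (unique z′ acc′))

      question-unique : UniquelyDefinedBySize≤ question zero ∣ question ∣
      -- The constant gate is the empty disjunction. It occupies wire 0, hence the `suc` on the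
      -- input wires; `↑ˡ 0` appears because no outputs precede `Y 0`.
      question-unique = const false ▸ select (length z) (λ i → val (nth z i)) (λ i → suc (clamp i ↑ˡ 0)) zero ,
        ≤-trans (s≤s (≤-trans (size-select (length z) _ _ _) (≤-reflexive (proj₁ acc)))) large ,
        λ x y sat → begin
          evalCircuit (select (length z) (λ i → val (nth z i)) (λ i → suc (clamp i ↑ˡ 0)) zero) (false ∷ (x Vec.++ []))
            ≡⟨ eval-select (length z) (λ i → val (nth z i)) (λ i → suc (clamp i ↑ˡ 0)) zero (false ∷ (x Vec.++ [])) ⟩
          not (allBelow (length z) λ i → not (lookup (x Vec.++ []) (clamp i ↑ˡ 0) ∧ val (nth z i)))
            ≡⟨ cong not (allBelow-cong (length z) λ i _ → cong (λ b → not (b ∧ val (nth z i))) (Vec.lookup-++ˡ x [] (clamp i))) ⟩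
          selected x z ≡⟨ question-answer x y sat ⟨
          lookup y zero ∎
        where
        open ≡-Reasoning
        large : suc ℓ ≤ ∣ question ∣
        large = size-disjunction ℓ (λ i → formula unselected (i ∷ [])) (formula (Y (# 0)) [])
          (formula (and (neg (Y (# 0))) (neg (neg (all (len xs) unselected)))) [])
          (formula (and initially (and (all (len τ) transition) accepting)) [])

      -- A Skolem function is constrained on satisfying assignments only. Totality supplies one over
      -- every `x`, so the values of `C` are forced everywhere, in particular at the unit vectors.
      skolem-value : ∀ C → IsSkolem question zero C → ∀ x → evalCircuit C (x Vec.++ []) ≡ selected x z
      skolem-value C skolem x = let (y , sat) = question-total z acc x in
        trans (skolem x y sat) (question-answer x y sat)

-- Evaluation of circuits

skipArm countArm : ∀ {k} → Bool → FP (2 + k)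
skipArm true   = var zero
skipArm false  = var 1F
countArm true  = cons true (var zero)
countArm false = nil

skipWord countWord : Word → Word
skipWord []           = []
skipWord (true ∷ w)   = skipWord w
skipWord (false ∷ w)  = w
countWord []          = []
countWord (true ∷ w)  = true ∷ countWord w
countWord (false ∷ w) = []

rec-skip : ∀ {k} (ρ : Vec Word k) w → recWord [] (λ b r w → fun (skipArm b) (r ∷ w ∷ ρ)) w ≡ skipWord w
rec-skip ρ []          = refl
rec-skip ρ (true ∷ w)  = rec-skip ρ w
rec-skip ρ (false ∷ w) = refl

rec-count : ∀ {k} (ρ : Vec Word k) w → recWord [] (λ b r w → fun (countArm b) (r ∷ w ∷ ρ)) w ≡ countWord w
rec-count ρ []          = refl
rec-count ρ (true ∷ w)  = cong (true ∷_) (rec-count ρ w)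
rec-count ρ (false ∷ w) = refl

length-skip : ∀ w → length (skipWord w) ≤ length w
length-skip []          = z≤n
length-skip (true ∷ w)  = m≤n⇒m≤1+n (length-skip w)
length-skip (false ∷ w) = n≤1+n _

length-count : ∀ w → length (countWord w) ≤ length w
length-count []          = z≤n
length-count (true ∷ w)  = s≤s (length-count w)
length-count (false ∷ w) = z≤n

skipFP countFP : ∀ {k} → FP k → FP k
skipFP t  = rec t nil skipArm λ ρ w →
  ≤-trans (≤-reflexive (cong length (rec-skip ρ w))) (≤-trans (length-skip w) (m≤m+n (length w) (total ρ)))
countFP t = rec t nil countArm λ ρ w →
  ≤-trans (≤-reflexive (cong length (rec-count ρ w))) (≤-trans (length-count w) (m≤m+n (length w) (total ρ)))

fun-skipFP : ∀ {k} (t : FP k) ρ → fun (skipFP t) ρ ≡ skipWord (fun t ρ)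
fun-skipFP t ρ = rec-skip ρ (fun t ρ)

skip-index : ∀ n w → skipWord (unary n ++ w) ≡ w
skip-index zero    w = refl
skip-index (suc n) w = skip-index n w

count-index : ∀ n w → length (countWord (unary n ++ w)) ≡ n
count-index zero    w = refl
count-index (suc n) w = cong suc (count-index n w)

-- The default `false` makes evaluation yield one bit even on a word that encodes no circuit, as a
-- failing synthesizer may return.
bit₁ : Word → (Bool → Bool) → Word
bit₁ w f = caseWord w (false ∷ []) (λ b _ → f b ∷ [])

bitWord : Word → Word → Word
bitWord c e = bit₁ (drop (length (countWord c)) e) id

bitFP : ∀ {k} → FP k → FP k → FP k
bitFP c e = caseOf (dropFP (countFP c) e) (constant (false ∷ [])) (λ b → constant (b ∷ []))

fun-bitFP : ∀ {k} (c e : FP k) ρ → fun (bitFP c e) ρ ≡ bitWord (fun c ρ) (fun e ρ)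
fun-bitFP c e ρ rewrite fun-dropFP (countFP c) e ρ | rec-count ρ (fun c ρ) = refl

nth-toList : ∀ {n} (v : Vec Bool n) i → nth (toList v) (toℕ i) ≡ just (lookup v i)
nth-toList (x ∷ v) zero    = refl
nth-toList (x ∷ v) (suc i) = nth-toList v i

bitWord-index : ∀ {n} (v : Vec Bool n) i w → bitWord (index i ++ w) (toList v) ≡ lookup v i ∷ []
bitWord-index v i w rewrite count-index (toℕ i) w with drop (toℕ i) (toList v) | nth-toList v i
... | b ∷ _ | refl = refl

-- A step of the evaluation takes a code and the list of the values of the
-- wires; only its behaviour on codes of circuits matters.
gateRest : Word → Word
gateRest (false ∷ false ∷ b ∷ w) = w
gateRest (false ∷ true ∷ w)      = skipWord w
gateRest (true ∷ b ∷ w)          = skipWord (skipWord w)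
gateRest _                       = []

gateValue : Word → Word → Word
gateValue (false ∷ false ∷ b ∷ w) e = b ∷ []
gateValue (false ∷ true ∷ w)      e = bit₁ (bitWord w e) not
gateValue (true ∷ false ∷ w)      e = caseWord (bitWord w e) [] (λ { true _ → bitWord (skipWord w) e ; false _ → false ∷ [] })
gateValue (true ∷ true ∷ w)       e = caseWord (bitWord w e) [] (λ { true _ → true ∷ [] ; false _ → bitWord (skipWord w) e })
gateValue _                       e = []

length-bit₁ : ∀ w f → length (bit₁ w f) ≡ 1
length-bit₁ []      f = refl
length-bit₁ (b ∷ w) f = refl

length-gateRest : ∀ w → length (gateRest w) ≤ length w
length-gateRest []                      = z≤n
length-gateRest (false ∷ [])            = z≤n
length-gateRest (false ∷ false ∷ [])    = z≤n
length-gateRest (false ∷ false ∷ b ∷ w) = m≤n+m _ 3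
length-gateRest (false ∷ true ∷ w)      = ≤-trans (length-skip w) (m≤n+m _ 2)
length-gateRest (true ∷ [])             = z≤n
length-gateRest (true ∷ b ∷ w)          = ≤-trans (length-skip (skipWord w)) (≤-trans (length-skip w) (m≤n+m _ 2))

length-gateValue : ∀ w e → length (gateValue w e) ≤ 1
length-gateValue []                      e = z≤n
length-gateValue (false ∷ [])            e = z≤n
length-gateValue (false ∷ false ∷ [])    e = z≤n
length-gateValue (false ∷ false ∷ b ∷ w) e = s≤s z≤n
length-gateValue (false ∷ true ∷ w)      e = ≤-reflexive (length-bit₁ (bitWord w e) not)
length-gateValue (true ∷ [])             e = z≤n
length-gateValue (true ∷ false ∷ w)      e with bitWord w e
... | []        = z≤n
... | true ∷ _  = ≤-reflexive (length-bit₁ (drop (length (countWord (skipWord w))) e) id)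
... | false ∷ _ = s≤s z≤n
length-gateValue (true ∷ true ∷ w)       e with bitWord w e
... | []        = z≤n
... | true ∷ _  = s≤s z≤n
... | false ∷ _ = ≤-reflexive (length-bit₁ (drop (length (countWord (skipWord w))) e) id)

gateRest-encode : ∀ {k} (g : Gate k) w → gateRest (encodeGate g ++ w) ≡ w
gateRest-encode (const b) w = refl
gateRest-encode (neg i)   w = skip-index (toℕ i) w
gateRest-encode (and i j) w rewrite List.++-assoc (index i) (index j) w | skip-index (toℕ i) (index j ++ w) = skip-index (toℕ j) w
gateRest-encode (or i j)  w rewrite List.++-assoc (index i) (index j) w | skip-index (toℕ i) (index j ++ w) = skip-index (toℕ j) w

gateValue-encode : ∀ {k} (g : Gate k) w ρ → gateValue (encodeGate g ++ w) (toList ρ) ≡ evalGate g ρ ∷ []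
gateValue-encode (const b) w ρ = refl
gateValue-encode (neg i)   w ρ rewrite bitWord-index ρ i w = refl
gateValue-encode (and i j) w ρ
  rewrite List.++-assoc (index i) (index j) w | bitWord-index ρ i (index j ++ w) with lookup ρ i
... | true  = trans (cong (λ c → bitWord c (toList ρ)) (skip-index (toℕ i) (index j ++ w))) (bitWord-index ρ j w)
... | false = refl
gateValue-encode (or i j)  w ρ
  rewrite List.++-assoc (index i) (index j) w | bitWord-index ρ i (index j ++ w) with lookup ρ i
... | true  = refl
... | false = trans (cong (λ c → bitWord c (toList ρ)) (skip-index (toℕ i) (index j ++ w))) (bitWord-index ρ j w)

codeStep : Word → Word
codeStep []          = []
codeStep (true ∷ w)  = gateRest w
codeStep (false ∷ w) = false ∷ w

wireStep : Word → Word → Word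
wireStep []          e = e
wireStep (true ∷ w)  e = gateValue w e ++ e
wireStep (false ∷ w) e = e

codeArm : ∀ {k} → Bool → FP (suc k)
codeArm false = cons false (var zero)
codeArm true  = caseOf (var zero) nil λ
  { false → caseOf (var zero) nil λ { false → tailOf (var zero) ; true → skipFP (var zero) }
  ; true  → caseOf (var zero) nil λ _ → skipFP (skipFP (var zero)) }

codeStepFP : ∀ {k} → FP k → FP k
codeStepFP t = caseOf t nil codeArm

fun-codeStepFP : ∀ {k} (t : FP k) ρ → fun (codeStepFP t) ρ ≡ codeStep (fun t ρ)
fun-codeStepFP t ρ = by (fun t ρ)
  where
  by : ∀ w → caseWord w [] (λ b u → fun (codeArm b) (u ∷ ρ)) ≡ codeStep w
  by []                             = refl
  by (false ∷ w)                    = refl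
  by (true ∷ [])                    = refl
  by (true ∷ false ∷ [])            = refl
  by (true ∷ false ∷ false ∷ [])    = refl
  by (true ∷ false ∷ false ∷ b ∷ w) = refl
  by (true ∷ false ∷ true ∷ w)      = fun-skipFP (var zero) (w ∷ (true ∷ w) ∷ (false ∷ true ∷ w) ∷ ρ)
  by (true ∷ true ∷ [])             = refl
  by (true ∷ true ∷ b ∷ w)          = trans (fun-skipFP (skipFP (var zero)) (w ∷ (b ∷ w) ∷ (true ∷ b ∷ w) ∷ ρ))
    (cong skipWord (fun-skipFP (var zero) (w ∷ (b ∷ w) ∷ (true ∷ b ∷ w) ∷ ρ)))

notFP : ∀ {k} → FP k → FP k → FP k
notFP c e = caseOf (bitFP c e) (constant (false ∷ [])) (λ b → constant (not b ∷ []))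

fun-notFP : ∀ {k} (c e : FP k) ρ → fun (notFP c e) ρ ≡ bit₁ (bitWord (fun c ρ) (fun e ρ)) not
fun-notFP c e ρ rewrite fun-bitFP c e ρ = refl

andArm orArm : ∀ {k} → FP k → FP k → Bool → FP (suc k)
andArm c e false = constant (false ∷ [])
andArm c e true  = bitFP (skipFP (wk c)) (wk e)
orArm c e false  = bitFP (skipFP (wk c)) (wk e)
orArm c e true   = constant (true ∷ [])

fun-second : ∀ {k} (c e : FP k) v ρ →
  fun (bitFP (skipFP (wk c)) (wk e)) (v ∷ ρ) ≡ bitWord (skipWord (fun c ρ)) (fun e ρ)
fun-second c e v ρ = trans (fun-bitFP (skipFP (wk c)) (wk e) (v ∷ ρ))
  (cong (λ u → bitWord u (fun e ρ)) (fun-skipFP (wk c) (v ∷ ρ)))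

fun-andFP : ∀ {k} (c e : FP k) ρ →
  fun (caseOf (bitFP c e) nil (andArm c e)) ρ ≡ gateValue (true ∷ false ∷ fun c ρ) (fun e ρ)
fun-andFP c e ρ rewrite fun-bitFP c e ρ with bitWord (fun c ρ) (fun e ρ)
... | []        = refl
... | false ∷ v = refl
... | true ∷ v  = fun-second c e v ρ

fun-orFP : ∀ {k} (c e : FP k) ρ →
  fun (caseOf (bitFP c e) nil (orArm c e)) ρ ≡ gateValue (true ∷ true ∷ fun c ρ) (fun e ρ)
fun-orFP c e ρ rewrite fun-bitFP c e ρ with bitWord (fun c ρ) (fun e ρ)
... | []        = refl
... | false ∷ v = fun-second c e v ρ
... | true ∷ v  = refl

gateFP : ∀ {k} → FP k → FP (suc k)
gateFP e = caseOf (var zero) nil λ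
  { false → caseOf (var zero) nil λ
      { false → caseOf (var zero) nil (λ b → constant (b ∷ []))
      ; true  → notFP (var zero) (wk (wk (wk e))) }
  ; true  → caseOf (var zero) nil λ
      { false → caseOf (bitFP (var zero) (wk (wk (wk e)))) nil (andArm (var zero) (wk (wk (wk e))))
      ; true  → caseOf (bitFP (var zero) (wk (wk (wk e)))) nil (orArm (var zero) (wk (wk (wk e)))) } }

fun-gateFP : ∀ {k} (e : FP k) w ρ → fun (gateFP e) (w ∷ ρ) ≡ gateValue w (fun e ρ)
fun-gateFP e []                      ρ = refl
fun-gateFP e (false ∷ [])            ρ = refl
fun-gateFP e (false ∷ false ∷ [])    ρ = refl
fun-gateFP e (false ∷ false ∷ b ∷ w) ρ = refl
fun-gateFP e (false ∷ true ∷ w)      ρ = fun-notFP (var zero) (wk (wk (wk e))) (w ∷ (true ∷ w) ∷ (false ∷ true ∷ w) ∷ ρ)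
fun-gateFP e (true ∷ [])             ρ = refl
fun-gateFP e (true ∷ false ∷ w)      ρ = fun-andFP (var zero) (wk (wk (wk e))) (w ∷ (false ∷ w) ∷ (true ∷ false ∷ w) ∷ ρ)
fun-gateFP e (true ∷ true ∷ w)       ρ = fun-orFP (var zero) (wk (wk (wk e))) (w ∷ (true ∷ w) ∷ (true ∷ true ∷ w) ∷ ρ)

wireArm : ∀ {k} → FP k → Bool → FP (suc k)
wireArm e false = wk e
wireArm e true  = gateFP e ⊹ wk e

wireStepFP : ∀ {k} → FP k → FP k → FP k
wireStepFP t e = caseOf t e (wireArm e)

fun-wireStepFP : ∀ {k} (t e : FP k) ρ → fun (wireStepFP t e) ρ ≡ wireStep (fun t ρ) (fun e ρ)
fun-wireStepFP t e ρ = by (fun t ρ)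
  where
  by : ∀ w → caseWord w (fun e ρ) (λ b u → fun (wireArm e b) (u ∷ ρ)) ≡ wireStep w (fun e ρ)
  by []          = refl
  by (false ∷ w) = refl
  by (true ∷ w)  = cong (_++ fun e ρ) (fun-gateFP e w ρ)

length-codeStep : ∀ w → length (codeStep w) ≤ length w
length-codeStep []          = z≤n
length-codeStep (true ∷ w)  = m≤n⇒m≤1+n (length-gateRest w)
length-codeStep (false ∷ w) = ≤-refl

length-wireStep : ∀ w e → length (wireStep w e) ≤ suc (length e)
length-wireStep []          e = n≤1+n _
length-wireStep (true ∷ w)  e = ≤-trans (≤-reflexive (List.length-++ (gateValue w e))) (+-monoˡ-≤ (length e) (length-gateValue w e))
length-wireStep (false ∷ w) e = n≤1+n _

codeAfter : Word → Word → Word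
codeAfter c []      = c
codeAfter c (b ∷ n) = codeStep (codeAfter c n)

wiresAfter : Word → Word → Word → Word
wiresAfter c e []      = e
wiresAfter c e (b ∷ n) = wireStep (codeAfter c n) (wiresAfter c e n)

length-codeAfter : ∀ c n → length (codeAfter c n) ≤ length c
length-codeAfter c []      = ≤-refl
length-codeAfter c (b ∷ n) = ≤-trans (length-codeStep (codeAfter c n)) (length-codeAfter c n)

length-wiresAfter : ∀ c e n → length (wiresAfter c e n) ≤ length n + length e
length-wiresAfter c e []      = ≤-refl
length-wiresAfter c e (b ∷ n) = ≤-trans (length-wireStep (codeAfter c n) _) (s≤s (length-wiresAfter c e n))

rec-code : ∀ {k} i (ρ : Vec Word k) n →
  recWord (lookup ρ i) (λ _ r w → fun (codeStepFP (var zero)) (r ∷ w ∷ ρ)) n ≡ codeAfter (lookup ρ i) n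
rec-code i ρ []      = refl
rec-code i ρ (b ∷ n) = trans (fun-codeStepFP (var zero) (recWord (lookup ρ i) (λ _ r w → fun (codeStepFP (var zero)) (r ∷ w ∷ ρ)) n ∷ n ∷ ρ)) (cong codeStep (rec-code i ρ n))

codeAfterFP : ∀ {k} → Fin k → FP k → FP k
codeAfterFP i n = rec n (var i) (λ _ → codeStepFP (var zero)) λ ρ w → begin
  length (recWord (lookup ρ i) (λ _ r w → fun (codeStepFP (var zero)) (r ∷ w ∷ ρ)) w) ≡⟨ cong length (rec-code i ρ w) ⟩
  length (codeAfter (lookup ρ i) w) ≤⟨ length-codeAfter (lookup ρ i) w ⟩
  length (lookup ρ i)               ≤⟨ lookup≤total ρ i ⟩
  total ρ                           ≤⟨ m≤n+m _ (length w) ⟩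
  length w + total ρ                ∎
  where open ≤-Reasoning

-- `rec` carries a single word, here the wire values; the remaining code is recomputed from the
-- beginning in every round.
wireLoop : ∀ {k} → FP (4 + k)
wireLoop = wireStepFP (codeAfterFP 2F (var 1F)) (var zero)

rec-wires : ∀ {k} (ρ : Vec Word (2 + k)) n →
  recWord (lookup ρ 1F) (λ _ r w → fun wireLoop (r ∷ w ∷ ρ)) n ≡ wiresAfter (lookup ρ zero) (lookup ρ 1F) n
rec-wires ρ []      = refl
rec-wires {k} ρ (b ∷ n) = trans (fun-wireStepFP (codeAfterFP 2F (var 1F)) (var zero) env)
  (cong₂ wireStep (rec-code 2F env n) (rec-wires ρ n))
  where
  env : Vec Word (4 + k)
  env = recWord (lookup ρ 1F) (λ _ r w → fun wireLoop (r ∷ w ∷ ρ)) n ∷ n ∷ ρ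

wiresFP : ∀ {k} → FP (2 + k)
wiresFP = rec (var zero) (var 1F) (λ _ → wireLoop) λ ρ w →
  ≤-trans (≤-reflexive (cong length (rec-wires ρ w)))
    (≤-trans (length-wiresAfter (lookup ρ zero) (lookup ρ 1F) w) (+-monoʳ-≤ (length w) (lookup≤total ρ 1F)))

circuitFP : ∀ {k} → FP (2 + k)
circuitFP = caseOf (codeAfterFP zero (var zero)) (constant (false ∷ [])) λ _ → bitFP (var zero) (wk wiresFP)

-- The code serves as its own step counter: every gate takes up at least one of its bits, and once
-- the output is reached further steps change nothing.
circuitWord : Word → Word → Word
circuitWord c e = caseWord (codeAfter c c) (false ∷ []) (λ _ w → bitWord w (wiresAfter c e c))

fun-circuitFP : ∀ {k} c e (ρ : Vec Word k) → fun circuitFP (c ∷ e ∷ ρ) ≡ circuitWord c e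
fun-circuitFP c e ρ rewrite rec-code zero (c ∷ e ∷ ρ) c with codeAfter c c
... | []    = refl
... | b ∷ w = trans (fun-bitFP (var zero) (wk wiresFP) (w ∷ c ∷ e ∷ ρ)) (cong (bitWord w) (rec-wires (c ∷ e ∷ ρ) c))

length-circuitWord : ∀ c e → length (circuitWord c e) ≡ 1
length-circuitWord c e with codeAfter c c
... | []    = refl
... | b ∷ w = length-bit₁ (drop (length (countWord w)) (wiresAfter c e c)) id

size≤code : ∀ {k} (C : Circuit k) → size C ≤ length (encodeCircuit C)
size≤code (out i) = z≤n
size≤code (g ▸ C) = s≤s (≤-trans (size≤code C) (≤-trans (m≤n+m _ (length (encodeGate g))) (≤-reflexive (sym (List.length-++ (encodeGate g))))))

module _ {k} (C : Circuit k) (ρ : Vec Bool k) where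
  -- The alternatives in `progress`: either every step so far has consumed a gate, or only the
  -- output is left. After as many steps as the code has bits, the former is impossible with gates
  -- remaining.
  record Stage (n : Word) : Set where
    constructor stage
    field
      {wires}  : ℕ
      rest     : Circuit wires
      values   : Vec Bool wires
      rest≡    : codeAfter (encodeCircuit C) n ≡ encodeCircuit rest
      values≡  : wiresAfter (encodeCircuit C) (toList ρ) n ≡ toList values
      result   : evalCircuit rest values ≡ evalCircuit C ρ
      progress : size rest + length n ≤ size C ⊎ size rest ≡ 0

  stages : ∀ n → Stage n
  stages []      = stage C ρ refl refl refl (inj₁ (≤-reflexive (+-identityʳ _)))
  stages (b ∷ n) with stages n
  ... | stage (out i) v c≡ v≡ res prog = stage (out i) v
    (cong codeStep c≡) (trans (cong₂ wireStep c≡ v≡) refl) res (inj₂ refl)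
  ... | stage (g ▸ D) v c≡ v≡ res prog = stage D (evalGate g v ∷ v)
    (trans (cong codeStep c≡) (gateRest-encode g (encodeCircuit D)))
    (trans (cong₂ wireStep c≡ v≡) (cong (_++ toList v) (gateValue-encode g (encodeCircuit D) v)))
    res (smaller prog)
    where
    smaller : suc (size D) + length n ≤ size C ⊎ suc (size D) ≡ 0 → size D + suc (length n) ≤ size C ⊎ size D ≡ 0
    smaller (inj₁ le) = inj₁ (≤-trans (≤-reflexive (+-suc (size D) (length n))) le)

  circuitWord-encode : circuitWord (encodeCircuit C) (toList ρ) ≡ evalCircuit C ρ ∷ []
  circuitWord-encode with stages (encodeCircuit C)
  ... | stage (g ▸ D) v c≡ v≡ res (inj₁ le) = ⊥-elim (<⇒≱ (s≤s (m≤n+m (length (encodeCircuit C)) (size D)))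
    (≤-trans le (size≤code C)))
  ... | stage (out i) v c≡ v≡ res _ rewrite c≡ | v≡ = trans
    (trans (cong (λ w → bitWord w (toList v)) (sym (List.++-identityʳ (index i)))) (bitWord-index v i []))
    (cong (_∷ []) res)

-- Isolation

toNat : Bool → ℕ
toNat true  = 1
toNat false = 0

sumV : ∀ {n} → (Vec Bool n → ℕ) → ℕ
sumV {zero}  f = f []
sumV {suc n} f = sumV (λ v → f (true ∷ v)) + sumV (λ v → f (false ∷ v))

sumV-mono : ∀ {n} {f g : Vec Bool n → ℕ} → (∀ v → f v ≤ g v) → sumV f ≤ sumV g
sumV-mono {zero}  le = le []
sumV-mono {suc n} le = +-mono-≤ (sumV-mono λ v → le (true ∷ v)) (sumV-mono λ v → le (false ∷ v))

sumV-cong : ∀ {n} {f g : Vec Bool n → ℕ} → (∀ v → f v ≡ g v) → sumV f ≡ sumV g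
sumV-cong {zero}  eq = eq []
sumV-cong {suc n} eq = cong₂ _+_ (sumV-cong λ v → eq (true ∷ v)) (sumV-cong λ v → eq (false ∷ v))

sumV-+ : ∀ {n} (f g : Vec Bool n → ℕ) → sumV (λ v → f v + g v) ≡ sumV f + sumV g
sumV-+ {zero}  f g = refl
sumV-+ {suc n} f g rewrite sumV-+ (λ v → f (true ∷ v)) (λ v → g (true ∷ v)) | sumV-+ (λ v → f (false ∷ v)) (λ v → g (false ∷ v)) =
  interchange (sumV (λ v → f (true ∷ v))) (sumV (λ v → g (true ∷ v))) _ _
  where
  interchange : ∀ a b c d → (a + b) + (c + d) ≡ (a + c) + (b + d)
  interchange = solve-∀

sumV-* : ∀ {n} a (f : Vec Bool n → ℕ) → sumV (λ v → a * f v) ≡ a * sumV f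
sumV-* {zero}  a f = refl
sumV-* {suc n} a f rewrite sumV-* a (λ v → f (true ∷ v)) | sumV-* a (λ v → f (false ∷ v)) =
  sym (*-distribˡ-+ a (sumV (λ v → f (true ∷ v))) _)

sumV-const : ∀ {n} a → sumV {n} (λ _ → a) ≡ a * 2 ^ n
sumV-const {zero}  a = sym (*-identityʳ a)
sumV-const {suc n} a rewrite sumV-const {n} a = eq a (2 ^ n)
  where
  eq : ∀ a x → a * x + a * x ≡ a * (x + (x + 0))
  eq = solve-∀

sumV-zero : ∀ {n} {f : Vec Bool n → ℕ} → (∀ v → f v ≡ 0) → sumV f ≡ 0
sumV-zero {n} eq = trans (sumV-cong eq) (sumV-const {n} 0)

sumV-++ : ∀ m {n} (f : Vec Bool (m + n) → ℕ) → sumV f ≡ sumV {m} (λ u → sumV {n} (λ v → f (u Vec.++ v)))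
sumV-++ zero    f = refl
sumV-++ (suc m) f = cong₂ _+_ (sumV-++ m (λ v → f (true ∷ v))) (sumV-++ m (λ v → f (false ∷ v)))

toNat-∨ : ∀ a b → toNat (a ∨ b) ≤ toNat a + toNat b
toNat-∨ true  b = s≤s z≤n
toNat-∨ false b = ≤-refl

anyV allV : ∀ {n} → (Vec Bool n → Bool) → Bool
anyV {zero}  P = P []
anyV {suc n} P = anyV (λ v → P (true ∷ v)) ∨ anyV (λ v → P (false ∷ v))
allV {zero}  P = P []
allV {suc n} P = allV (λ v → P (true ∷ v)) ∧ allV (λ v → P (false ∷ v))

∨-true : ∀ a {b} → a ∨ b ≡ true → a ≡ true ⊎ b ≡ true
∨-true true  eq = inj₁ refl
∨-true false eq = inj₂ eq

∨-false : ∀ a {b} → a ∨ b ≡ false → a ≡ false × b ≡ false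
∨-false false eq = refl , eq

anyV-elim : ∀ {n} (P : Vec Bool n → Bool) → anyV P ≡ true → ∃[ v ] P v ≡ true
anyV-elim {zero}  P eq = [] , eq
anyV-elim {suc n} P eq with ∨-true (anyV λ v → P (true ∷ v)) eq
... | inj₁ e = let (v , p) = anyV-elim _ e in true ∷ v , p
... | inj₂ e = let (v , p) = anyV-elim _ e in false ∷ v , p

anyV-none : ∀ {n} (P : Vec Bool n → Bool) → anyV P ≡ false → ∀ v → P v ≡ false
anyV-none P eq []          = eq
anyV-none P eq (true ∷ v)  = anyV-none (λ v → P (true ∷ v)) (proj₁ (∨-false (anyV λ v → P (true ∷ v)) eq)) v
anyV-none P eq (false ∷ v) = anyV-none (λ v → P (false ∷ v)) (proj₂ (∨-false (anyV λ v → P (true ∷ v)) eq)) v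

allV-elim : ∀ {n} (P : Vec Bool n → Bool) → allV P ≡ true → ∀ v → P v ≡ true
allV-elim P eq []          = eq
allV-elim P eq (true ∷ v)  = allV-elim (λ v → P (true ∷ v)) (proj₁ (∧-true eq)) v
allV-elim P eq (false ∷ v) = allV-elim (λ v → P (false ∷ v)) (proj₂ (∧-true {allV λ v → P (true ∷ v)} eq)) v

allV-intro : ∀ {n} (P : Vec Bool n → Bool) → (∀ v → P v ≡ true) → allV P ≡ true
allV-intro {zero}  P h = h []
allV-intro {suc n} P h = true-∧ (allV-intro _ λ v → h (true ∷ v)) (allV-intro _ λ v → h (false ∷ v))

anyV-intro : ∀ {n} (P : Vec Bool n → Bool) v → P v ≡ true → anyV P ≡ true
anyV-intro P v p with anyV P in e
... | true  = refl
... | false with () ← trans (sym p) (anyV-none P e v)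

-- Twice the range is compared with L, so the final range exceeds L / 2 and is
-- at most L unless it is 1.
rangeOf : ℕ → ℕ → ℕ
rangeOf L zero    = 1
rangeOf L (suc n) = if rangeOf L n + rangeOf L n ≤ᵇ L then rangeOf L n + rangeOf L n else rangeOf L n

-- Bits are read from the end of the word until another doubling would carry the range past `L`; the
-- others are ignored. The value remains short in unary and yet exactly uniform, the range being a
-- power of two.
valueOf : ℕ → Word → ℕ
valueOf L []      = 0
valueOf L (b ∷ w) = if rangeOf L (length w) + rangeOf L (length w) ≤ᵇ L
  then valueOf L w + valueOf L w + toNat b else valueOf L w

valueV : ∀ L {n} → Vec Bool n → ℕ
valueV L v = valueOf L (toList v)

value<range : ∀ L w → valueOf L w < rangeOf L (length w)
value<range L []      = s≤s z≤n
value<range L (b ∷ w) with rangeOf L (length w) + rangeOf L (length w) ≤ᵇ L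
... | false = value<range L w
... | true  = ≤-trans (s≤s (+-monoʳ-≤ (valueOf L w + valueOf L w) (toNat≤1 b)))
  (≤-trans (≤-reflexive (eq (valueOf L w))) (+-mono-≤ (value<range L w) (value<range L w)))
  where
  toNat≤1 : ∀ b → toNat b ≤ 1
  toNat≤1 true  = ≤-refl
  toNat≤1 false = z≤n
  eq : ∀ v → suc (v + v + 1) ≡ suc v + suc v
  eq = solve-∀

range-small : ∀ L n → rangeOf L n ≤ suc L
range-small L zero    = s≤s z≤n
range-small L (suc n) with rangeOf L n + rangeOf L n ≤ᵇ L in e
... | true  = m≤n⇒m≤1+n (≤ᵇ⇒≤ _ _ (subst BoolBase.T (sym e) tt))
... | false = range-small L n

-- While doubling goes on, the range exceeds the number of bits read. After `L` bits it has either
-- stopped, which says that twice the range exceeds `L`, or already exceeds `L`.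
range-large : ∀ L n → L ≤ n → L < rangeOf L n + rangeOf L n
range-large L n L≤n with grows n
  where
  grows : ∀ n → L < rangeOf L n + rangeOf L n ⊎ n < rangeOf L n
  grows zero    = inj₂ (s≤s z≤n)
  grows (suc n) with rangeOf L n + rangeOf L n ≤ᵇ L in e | grows n
  ... | true  | inj₁ lt = ⊥-elim (<⇒≱ lt (≤ᵇ⇒≤ _ _ (subst BoolBase.T (sym e) tt)))
  ... | true  | inj₂ lt = inj₂ (≤-trans (s≤s (≤-trans (s≤s (m≤n+m n n)) (≤-reflexive (sym (+-suc n n))))) (+-mono-≤ lt lt))
  ... | false | _       = inj₁ (≰⇒> λ le → subst BoolBase.T e (≤⇒≤ᵇ le))
... | inj₁ lt = lt
... | inj₂ lt = ≤-trans (s≤s L≤n) (≤-trans lt (m≤m+n _ _))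

private
  half : ∀ t → ∃[ u ] (∀ v b → v + v + toNat b ≡ t → v ≡ u × toNat b ≡ t ∸ (u + u))
  half t = t / 2 , λ v b eq → let h = halves v b eq in h ,
    trans (sym (m+n∸m≡n (v + v) (toNat b))) (cong₂ _∸_ eq (cong₂ _+_ h h))
    where
    open import Data.Nat.DivMod using (_/_; m*n/n≡m; +-distrib-/-∣ˡ)
    open import Data.Nat.Divisibility using (n∣m*n)
    double : ∀ v b → (v + v + toNat b) / 2 ≡ v
    double v b = trans (cong (λ d → (d + toNat b) / 2) (eq v)) (trans (+-distrib-/-∣ˡ (toNat b) (n∣m*n v {2}))
      (trans (cong₂ _+_ (m*n/n≡m v 2) (small b)) (+-identityʳ v)))
      where
      eq : ∀ v → v + v ≡ v * 2
      eq = solve-∀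
      small : ∀ b → toNat b / 2 ≡ 0
      small true  = refl
      small false = refl
    halves : ∀ v b → v + v + toNat b ≡ t → v ≡ t / 2
    halves v b eq = trans (sym (double v b)) (cong (_/ 2) eq)

-- Induction on the bits. If the new bit is used, `t` determines it as its parity and determines the
-- earlier value as its half, so at most one of the two choices counts; if it is ignored, both
-- choices count alike.
uniform : ∀ L n t → rangeOf L n * sumV {n} (λ v → toNat (valueV L v ≡ᵇ t)) ≤ 2 ^ n
uniform L zero    t with 0 ≡ᵇ t
... | true  = ≤-refl
... | false = z≤n
uniform L (suc n) t = ≤-trans (≤-reflexive (cong (rangeOf L (suc n) *_) (cong₂ _+_
    (sumV-cong λ v → cong (λ m → toNat (pick true v m ≡ᵇ t)) (length-toList v))
    (sumV-cong λ v → cong (λ m → toNat (pick false v m ≡ᵇ t)) (length-toList v))))) (by (rangeOf L n + rangeOf L n ≤ᵇ L))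
  where
  r = rangeOf L n
  pick : Bool → Vec Bool n → ℕ → ℕ
  pick b v m = if rangeOf L m + rangeOf L m ≤ᵇ L then valueV L v + valueV L v + toNat b else valueV L v
  s : ℕ → ℕ
  s t = sumV {n} (λ v → toNat (valueV L v ≡ᵇ t))
  by : ∀ c → (if c then r + r else r) *
    (sumV {n} (λ v → toNat ((if c then valueV L v + valueV L v + 1 else valueV L v) ≡ᵇ t)) +
     sumV {n} (λ v → toNat ((if c then valueV L v + valueV L v + 0 else valueV L v) ≡ᵇ t))) ≤ 2 ^ n + (2 ^ n + 0)
  by false = ≤-trans (≤-reflexive (*-distribˡ-+ r (s t) (s t)))
    (+-mono-≤ (uniform L n t) (≤-trans (uniform L n t) (≤-reflexive (sym (+-identityʳ _)))))
  by true = ≤-trans (*-monoʳ-≤ (r + r) (≤-trans (≤-reflexive (sym (sumV-+ {n} _ _))) (sumV-mono once)))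
    (≤-trans (≤-reflexive (*-distribʳ-+ (s u) r r)) (+-mono-≤ (uniform L n u) (≤-trans (uniform L n u) (≤-reflexive (sym (+-identityʳ _))))))
    where
    u = proj₁ (half t)
    split : ∀ v b → v + v + toNat b ≡ t → v ≡ u × toNat b ≡ t ∸ (u + u)
    split = proj₂ (half t)
    sound : ∀ {a b} → (a ≡ᵇ b) ≡ true → a ≡ b
    sound e = ≡ᵇ⇒≡ _ _ (subst BoolBase.T (sym e) tt)
    found : ∀ {v} → v ≡ u → 1 ≤ toNat (v ≡ᵇ u)
    found {v} e with v ≡ᵇ u in e′
    ... | true  = ≤-refl
    ... | false = ⊥-elim (subst BoolBase.T e′ (≡⇒≡ᵇ v u e))
    once : ∀ (w : Vec Bool n) → toNat (valueV L w + valueV L w + 1 ≡ᵇ t) + toNat (valueV L w + valueV L w + 0 ≡ᵇ t) ≤ toNat (valueV L w ≡ᵇ u)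
    once w with valueV L w + valueV L w + 1 ≡ᵇ t in e₁ | valueV L w + valueV L w + 0 ≡ᵇ t in e₀
    ... | false | false = z≤n
    ... | true  | false = found (proj₁ (split (valueV L w) true (sound e₁)))
    ... | false | true  = found (proj₁ (split (valueV L w) false (sound e₀)))
    ... | true  | true  with () ← trans (proj₂ (split (valueV L w) true (sound e₁))) (sym (proj₂ (split (valueV L w) false (sound e₀))))

-- The isolation lemma of Mulmuley, Vazirani and Vazirani, for weights given by
-- the values of random chunks of c bits.
module Isolation (c R : ℕ) (value : Vec Bool c → ℕ)
  (uniform : ∀ t → R * sumV (λ a → toNat (value a ≡ᵇ t)) ≤ 2 ^ c) where

  Chunks : ℕ → Set
  Chunks n = Vec (Vec Bool c) n

  sumC : ∀ {n} → (Chunks n → ℕ) → ℕ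
  sumC {zero}  f = f []
  sumC {suc n} f = sumV (λ a → sumC (λ ω → f (a ∷ ω)))

  sumC-mono : ∀ {n} {f g : Chunks n → ℕ} → (∀ ω → f ω ≤ g ω) → sumC f ≤ sumC g
  sumC-mono {zero}  le = le []
  sumC-mono {suc n} le = sumV-mono λ a → sumC-mono λ ω → le (a ∷ ω)

  sumC-cong : ∀ {n} {f g : Chunks n → ℕ} → (∀ ω → f ω ≡ g ω) → sumC f ≡ sumC g
  sumC-cong {zero}  eq = eq []
  sumC-cong {suc n} eq = sumV-cong λ a → sumC-cong λ ω → eq (a ∷ ω)

  sumC-+ : ∀ {n} (f g : Chunks n → ℕ) → sumC (λ ω → f ω + g ω) ≡ sumC f + sumC g
  sumC-+ {zero}  f g = refl
  sumC-+ {suc n} f g = trans (sumV-cong λ a → sumC-+ (λ ω → f (a ∷ ω)) (λ ω → g (a ∷ ω))) (sumV-+ {c} _ _)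

  sumC-* : ∀ {n} k (f : Chunks n → ℕ) → sumC (λ ω → k * f ω) ≡ k * sumC f
  sumC-* {zero}  k f = refl
  sumC-* {suc n} k f = trans (sumV-cong λ a → sumC-* k (λ ω → f (a ∷ ω))) (sumV-* {c} k _)

  sumC-concat : ∀ {n} (f : Vec Bool (n * c) → ℕ) → sumV f ≡ sumC {n} (λ ω → f (Vec.concat ω))
  sumC-concat {zero}  f = refl
  sumC-concat {suc n} f = trans (sumV-++ c f) (sumV-cong λ a → sumC-concat {n} (λ v → f (a Vec.++ v)))

  sumV-sumC : ∀ {m n} (f : Vec Bool m → Chunks n → ℕ) →
    sumV (λ a → sumC (λ ω → f a ω)) ≡ sumC (λ ω → sumV (λ a → f a ω))
  sumV-sumC {zero}  f = refl
  sumV-sumC {suc m} {n} f = trans (cong₂ _+_ (sumV-sumC (λ a → f (true ∷ a))) (sumV-sumC (λ a → f (false ∷ a))))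
    (sym (sumC-+ {n} _ _))

  everything : ℕ → ℕ
  everything n = sumC {n} (λ _ → 1)

  -- A bound that holds for chunk `j` with all other chunks fixed holds on average.
  sumC-at : ∀ {n} (j : Fin n) (f : Chunks n → ℕ) →
    (∀ ω → R * sumV (λ a → f (ω Vec.[ j ]≔ a)) ≤ 2 ^ c) → R * sumC f ≤ everything n
  sumC-at {suc n} zero f le = begin
    R * sumV (λ a → sumC (λ ω → f (a ∷ ω))) ≡⟨ cong (R *_) (sumV-sumC (λ a ω → f (a ∷ ω))) ⟩
    R * sumC (λ ω → sumV (λ a → f (a ∷ ω))) ≡⟨ sumC-* {n} R _ ⟨
    -- The first chunk is overwritten by `a`, so any chunk may stand there.
    sumC (λ ω → R * sumV (λ a → f (a ∷ ω))) ≤⟨ sumC-mono (λ ω → le (Vec.replicate c false ∷ ω)) ⟩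
    sumC {n} (λ ω → 2 ^ c)                  ≡⟨ sumC-cong {n} (λ ω → trans (sym (+-identityʳ _)) (sym (sumV-const {c} 1))) ⟩
    sumC {n} (λ ω → sumV {c} (λ a → 1))     ≡⟨ sumV-sumC {c} {n} (λ a ω → 1) ⟨
    everything (suc n)                      ∎
    where open ≤-Reasoning
  sumC-at {suc n} (suc j) f le = begin
    R * sumV (λ a → sumC (λ ω → f (a ∷ ω))) ≡⟨ sumV-* {c} R _ ⟨
    sumV (λ a → R * sumC (λ ω → f (a ∷ ω))) ≤⟨ sumV-mono (λ a → sumC-at j (λ ω → f (a ∷ ω)) (λ ω → le (a ∷ ω))) ⟩
    everything (suc n)                      ∎
    where open ≤-Reasoning

  weight : ∀ {n} → Vec Bool n → Chunks n → ℕ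
  weight []      []      = 0
  weight (b ∷ z) (a ∷ ω) = (if b then value a else 0) + weight z ω

  -- Splits off the part that depends on chunk `j`: once bit `j` is `false`, the weight no longer
  -- sees that chunk.
  weight-at : ∀ {n} (z : Vec Bool n) ω j a →
    weight z (ω Vec.[ j ]≔ a) ≡ (if lookup z j then value a else 0) + weight (z Vec.[ j ]≔ false) ω
  weight-at (b ∷ z) (a′ ∷ ω) zero    a = refl
  weight-at (b ∷ z) (a′ ∷ ω) (suc j) a = trans (cong ((if b then value a′ else 0) +_) (weight-at z ω j a))
    (swap (if b then value a′ else 0) (if lookup z j then value a else 0) _)
    where
    swap : ∀ x y z → x + (y + z) ≡ y + (x + z)
    swap = solve-∀

  module _ {n} (S : Vec Bool n → Bool) where
    minimal : Chunks n → Vec Bool n → Bool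
    minimal ω z = S z ∧ allV (λ y → not (S y) ∨ (weight z ω ≤ᵇ weight y ω))

    Minimal : Chunks n → Vec Bool n → Set
    Minimal ω z = S z ≡ true × (∀ y → S y ≡ true → weight z ω ≤ weight y ω)

    minimal-elim : ∀ ω z → minimal ω z ≡ true → Minimal ω z
    minimal-elim ω z eq = proj₁ (∧-true eq) , λ y Sy → below y Sy (allV-elim _ (proj₂ (∧-true {S z} eq)) y)
      where
      below : ∀ y → S y ≡ true → not (S y) ∨ (weight z ω ≤ᵇ weight y ω) ≡ true → weight z ω ≤ weight y ω
      below y Sy e rewrite Sy = ≤ᵇ⇒≤ _ _ (subst BoolBase.T (sym e) tt)

    minimal-intro : ∀ ω z → Minimal ω z → minimal ω z ≡ true
    minimal-intro ω z (Sz , le) = true-∧ Sz (allV-intro _ above)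
      where
      above : ∀ y → not (S y) ∨ (weight z ω ≤ᵇ weight y ω) ≡ true
      above y with S y in Sy
      ... | false = refl
      ... | true  with weight z ω ≤ᵇ weight y ω in e
      ... | true  = refl
      ... | false = ⊥-elim (subst BoolBase.T e (≤⇒≤ᵇ (le y Sy)))

    ambiguous : Fin n → Chunks n → Bool
    ambiguous j ω = anyV (λ z → minimal ω z ∧ lookup z j) ∧ anyV (λ z → minimal ω z ∧ not (lookup z j))

    isolating : Chunks n → Bool
    isolating ω = not (anyFin λ j → ambiguous j ω)

    ambiguous-elim : ∀ j ω → ambiguous j ω ≡ true → ∃₂ λ z₁ z₀ →
      (Minimal ω z₁ × lookup z₁ j ≡ true) × (Minimal ω z₀ × lookup z₀ j ≡ false)
    ambiguous-elim j ω eq =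
      let (z₁ , e₁) = anyV-elim _ (proj₁ (∧-true eq))
          (z₀ , e₀) = anyV-elim _ (proj₂ (∧-true {anyV (λ z → minimal ω z ∧ lookup z j)} eq))
      in z₁ , z₀ , (minimal-elim ω z₁ (proj₁ (∧-true e₁)) , proj₂ (∧-true {minimal ω z₁} e₁)) ,
         (minimal-elim ω z₀ (proj₁ (∧-true e₀)) , not-true (proj₂ (∧-true {minimal ω z₀} e₀)))
      where
      not-true : ∀ {b} → not b ≡ true → b ≡ false
      not-true {false} _ = refl

    -- The weights of the other variables determine the value that makes j ambiguous.
    ambiguous-value : ∀ j ω a a′ → ambiguous j (ω Vec.[ j ]≔ a) ≡ true → ambiguous j (ω Vec.[ j ]≔ a′) ≡ true → value a ≡ value a′
    ambiguous-value j ω a a′ e e′ with ambiguous-elim j _ e | ambiguous-elim j _ e′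
    ... | z₁ , z₀ , (min₁ , l₁) , (min₀ , l₀) | y₁ , y₀ , (min₁′ , k₁) , (min₀′ , k₀) =
      -- Ambiguity equates `value a` plus the least remaining weight of a solution containing `j`
      -- with the least weight of a solution avoiding `j`. Neither minimum depends on chunk `j`, so
      -- the same equation holds for `a′`.
      +-cancelʳ-≡ (u z₁) (value a) (value a′) (begin
        value a + u z₁  ≡⟨ ≤-antisym (subst₂ _≤_ (on a z₁ l₁) (off a z₀ l₀) (proj₂ min₁ z₀ (proj₁ min₀)))
                                     (subst₂ _≤_ (off a z₀ l₀) (on a z₁ l₁) (proj₂ min₀ z₁ (proj₁ min₁))) ⟩
        u z₀            ≡⟨ ≤-antisym (subst₂ _≤_ (off a z₀ l₀) (off a y₀ k₀) (proj₂ min₀ y₀ (proj₁ min₀′)))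
                                     (subst₂ _≤_ (off a′ y₀ k₀) (off a′ z₀ l₀) (proj₂ min₀′ z₀ (proj₁ min₀))) ⟩
        u y₀            ≡⟨ ≤-antisym (subst₂ _≤_ (on a′ y₁ k₁) (off a′ y₀ k₀) (proj₂ min₁′ y₀ (proj₁ min₀′)))
                                     (subst₂ _≤_ (off a′ y₀ k₀) (on a′ y₁ k₁) (proj₂ min₀′ y₁ (proj₁ min₁′))) ⟨
        value a′ + u y₁ ≡⟨ cong (value a′ +_) (≤-antisym
                             (+-cancelˡ-≤ (value a′) _ _ (subst₂ _≤_ (on a′ y₁ k₁) (on a′ z₁ l₁) (proj₂ min₁′ z₁ (proj₁ min₁))))
                             (+-cancelˡ-≤ (value a) _ _ (subst₂ _≤_ (on a z₁ l₁) (on a y₁ k₁) (proj₂ min₁ y₁ (proj₁ min₁′))))) ⟩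
        value a′ + u z₁ ∎)
      where
      open ≡-Reasoning
      u : Vec Bool n → ℕ
      u z = weight (z Vec.[ j ]≔ false) ω
      on : ∀ a z → lookup z j ≡ true → weight z (ω Vec.[ j ]≔ a) ≡ value a + u z
      on a z l = trans (weight-at z ω j a) (cong (λ b → (if b then value a else 0) + u z) l)
      off : ∀ a z → lookup z j ≡ false → weight z (ω Vec.[ j ]≔ a) ≡ u z
      off a z l = trans (weight-at z ω j a) (cong (λ b → (if b then value a else 0) + u z) l)

    -- With the other chunks fixed, all chunks that make `j` ambiguous have the value of the witness
    -- `a₀`, and `uniform` bounds the number of chunks with a given value.
    ambiguous-rare : ∀ j → R * sumC (λ ω → toNat (ambiguous j ω)) ≤ everything n
    ambiguous-rare j = sumC-at j (λ ω → toNat (ambiguous j ω)) rare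
      where
      rare : ∀ ω → R * sumV (λ a → toNat (ambiguous j (ω Vec.[ j ]≔ a))) ≤ 2 ^ c
      rare ω with anyV (λ a → ambiguous j (ω Vec.[ j ]≔ a)) in e
      ... | false = ≤-trans (≤-reflexive (trans (cong (R *_) (sumV-zero λ a → cong toNat (anyV-none (λ a → ambiguous j (ω Vec.[ j ]≔ a)) e a))) (*-zeroʳ R))) z≤n
      ... | true  with anyV-elim _ e
      ... | a₀ , e₀ = ≤-trans (*-monoʳ-≤ R (sumV-mono only)) (uniform (value a₀))
        where
        only : ∀ a → toNat (ambiguous j (ω Vec.[ j ]≔ a)) ≤ toNat (value a ≡ᵇ value a₀)
        only a with ambiguous j (ω Vec.[ j ]≔ a) in eₐ
        ... | false = z≤n
        ... | true  with value a ≡ᵇ value a₀ in e₁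
        ... | true  = ≤-refl
        ... | false = ⊥-elim (subst BoolBase.T e₁ (≡⇒≡ᵇ (value a) (value a₀) (ambiguous-value j ω a a₀ eₐ e₀)))

    -- The union bound over positions, with the denominator `R` cleared.
    anyFin-sum : ∀ {m} (f : Fin m → Chunks n → Bool) → (∀ j → R * sumC (λ ω → toNat (f j ω)) ≤ everything n) →
      R * sumC (λ ω → toNat (anyFin λ j → f j ω)) ≤ m * everything n
    anyFin-sum {zero}  f le = ≤-reflexive (trans (cong (R *_) (sumC-* {n} 0 (λ _ → 0))) (*-zeroʳ R))
    anyFin-sum {suc m} f le = begin
      R * sumC (λ ω → toNat (f zero ω ∨ anyFin λ j → f (suc j) ω))
        ≤⟨ *-monoʳ-≤ R (sumC-mono λ ω → toNat-∨ (f zero ω) _) ⟩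
      R * sumC (λ ω → toNat (f zero ω) + toNat (anyFin λ j → f (suc j) ω)) ≡⟨ cong (R *_) (sumC-+ {n} _ _) ⟩
      R * (sumC (λ ω → toNat (f zero ω)) + sumC (λ ω → toNat (anyFin λ j → f (suc j) ω))) ≡⟨ *-distribˡ-+ R _ _ ⟩
      R * sumC (λ ω → toNat (f zero ω)) + R * sumC (λ ω → toNat (anyFin λ j → f (suc j) ω))
        ≤⟨ +-mono-≤ (le zero) (anyFin-sum (λ j → f (suc j)) (λ j → le (suc j))) ⟩
      everything n + m * everything n ∎
      where open ≤-Reasoning

    -- The union bound gives failure probability `n / R`, at most 1/4. Positivity of `n` is what
    -- allows the factor `n` to be cancelled.
    frequent : 0 < n → 4 * n ≤ R → 3 * everything n ≤ 4 * sumC (λ ω → toNat (isolating ω))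
    frequent (s≤s z≤n) 4n≤R = +-cancelʳ-≤ (4 * B) (3 * everything n) (4 * A) (begin
      3 * everything n + 4 * B            ≤⟨ +-monoʳ-≤ (3 * everything n) (*-cancelˡ-≤ n scaled) ⟩
      3 * everything n + everything n     ≡⟨ eq (everything n) ⟩
      4 * everything n                    ≡⟨ cong (4 *_) (trans (sumC-cong {n} complement) (sumC-+ {n} (λ ω → toNat (isolating ω)) (λ ω → toNat (bad ω)))) ⟩
      4 * (A + B)                         ≡⟨ *-distribˡ-+ 4 A B ⟩
      4 * A + 4 * B                       ∎)
      where
      open ≤-Reasoning
      bad : Chunks n → Bool
      bad ω = anyFin λ j → ambiguous j ω
      A = sumC (λ ω → toNat (isolating ω))
      B = sumC (λ ω → toNat (bad ω))
      complement : ∀ ω → 1 ≡ toNat (isolating ω) + toNat (bad ω)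
      complement ω with bad ω
      ... | true  = refl
      ... | false = refl
      eq : ∀ x → 3 * x + x ≡ 4 * x
      eq = solve-∀
      scaled : n * (4 * B) ≤ n * everything n
      scaled = begin
        n * (4 * B)  ≡⟨ eq′ n B ⟩
        4 * n * B    ≤⟨ *-monoˡ-≤ B 4n≤R ⟩
        R * B        ≤⟨ anyFin-sum ambiguous ambiguous-rare ⟩
        n * everything n ∎
        where
        eq′ : ∀ n b → n * (4 * b) ≡ 4 * n * b
        eq′ = solve-∀

    isolating-often : 4 * n ≤ R → 3 * everything n ≤ 4 * sumC (λ ω → toNat (isolating ω))
    isolating-often 4n≤R = split n refl
      where
      split : ∀ m → m ≡ n → 3 * everything n ≤ 4 * sumC (λ ω → toNat (isolating ω))
      -- Without positions nothing is ambiguous, and both sums are 1: the claim is `3 ≤ 4`.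
      split zero    refl = s≤s (s≤s (s≤s z≤n))
      split (suc _) refl = frequent (s≤s z≤n) 4n≤R

    minimum : ∀ ω z → S z ≡ true → ∃[ y ] Minimal ω y
    minimum ω z Sz = descend (weight z ω) z Sz ≤-refl
      where
      descend : ∀ k z → S z ≡ true → weight z ω ≤ k → ∃[ y ] Minimal ω y
      descend k z Sz le with anyV (λ y → S y ∧ (weight y ω <ᵇ weight z ω)) in e
      descend k z Sz le | false = z , Sz , λ y Sy → ≮⇒≥ λ lt → absurd y Sy lt (anyV-none _ e y)
        where
        absurd : ∀ y → S y ≡ true → weight y ω < weight z ω → S y ∧ (weight y ω <ᵇ weight z ω) ≡ false → ⊥
        absurd y Sy lt e rewrite Sy = subst BoolBase.T e (<⇒<ᵇ lt)
      descend zero z Sz le | true with anyV-elim _ e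
      ... | y , ey = ⊥-elim (n≮0 (≤-trans (<ᵇ⇒< (weight y ω) (weight z ω) (subst BoolBase.T (sym (proj₂ (∧-true {S y} ey))) tt)) le))
      descend (suc k) z Sz le | true with anyV-elim _ e
      ... | y , ey = descend k y (proj₁ (∧-true ey))
        (≤-pred (≤-trans (<ᵇ⇒< (weight y ω) (weight z ω) (subst BoolBase.T (sym (proj₂ (∧-true {S y} ey))) tt)) le))

    -- An element of the same weight as a minimal one is minimal too, and two minimal elements that
    -- differ at some position make it ambiguous.
    isolates : ∀ ω → isolating ω ≡ true → ∀ z → S z ≡ true →
      ∃[ y ] S y ≡ true × (∀ y′ → S y′ ≡ true → weight y′ ω ≡ weight y ω → y′ ≡ y)
    isolates ω iso z Sz with minimum ω z Sz
    ... | y , min@(Sy , le) = y , Sy , λ y′ Sy′ w≡ → agree y′ (Sy′ , λ x Sx → ≤-trans (≤-reflexive w≡) (le x Sx))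
      where
      never : ∀ j → ambiguous j ω ≡ false
      never j = anyFin-false (λ j → ambiguous j ω) (not-not iso) j
        where
        not-not : ∀ {b} → not b ≡ true → b ≡ false
        not-not {false} _ = refl
        anyFin-false : ∀ {m} (f : Fin m → Bool) → anyFin f ≡ false → ∀ j → f j ≡ false
        anyFin-false f e zero    = proj₁ (∨-false (f zero) e)
        anyFin-false f e (suc j) = anyFin-false (f ∘ suc) (proj₂ (∨-false (f zero) e)) j
      agree : ∀ y′ → Minimal ω y′ → y′ ≡ y
      agree y′ min′ = trans (sym (Vec.tabulate∘lookup y′)) (trans (Vec.tabulate-cong pointwise) (Vec.tabulate∘lookup y))
        where
        clash : ∀ j x x′ → Minimal ω x → Minimal ω x′ → lookup x j ≡ true → lookup x′ j ≡ false → ⊥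
        clash j x x′ m m′ l l′ with () ← trans (sym (never j)) (true-∧
          (anyV-intro _ x (true-∧ (minimal-intro ω x m) l))
          (anyV-intro _ x′ (true-∧ (minimal-intro ω x′ m′) (cong not l′))))
        pointwise : ∀ j → lookup y′ j ≡ lookup y j
        pointwise j with lookup y′ j in l′ | lookup y j in l
        ... | true  | true  = refl
        ... | false | false = refl
        ... | true  | false = ⊥-elim (clash j y′ y min′ min l′ l)
        ... | false | true  = ⊥-elim (clash j y y′ min min′ l l′)

    -- The product 3/4 · 2/3 = 1/2: `B` is the number of continuations of a choice of weights, and
    -- `G` counts the successful ones, at least 2/3 of them when the weights isolate. The cancelled
    -- factor 6 clears the denominators.
    isolation-count : 4 * n ≤ R → ∀ B (G : Vec Bool (n * c) → ℕ) →
      (∀ ω → isolating ω ≡ true → 2 * B ≤ 3 * G (Vec.concat ω)) → 2 ^ (n * c) * B ≤ 2 * sumV G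
    isolation-count 4n≤R B G le = *-cancelˡ-≤ 6 (begin
      6 * (2 ^ (n * c) * B)                 ≡⟨ cong (λ p → 6 * (p * B)) (sym everything≡) ⟩
      6 * (everything n * B)                ≡⟨ eq₁ (everything n) B ⟩
      2 * B * (3 * everything n)            ≤⟨ *-monoʳ-≤ (2 * B) (isolating-often 4n≤R) ⟩
      2 * B * (4 * I)                       ≡⟨ eq₂ B I ⟩
      4 * (2 * B * I)                       ≡⟨ cong (4 *_) (sumC-* {n} (2 * B) (λ ω → toNat (isolating ω))) ⟨
      4 * sumC {n} (λ ω → 2 * B * toNat (isolating ω)) ≤⟨ *-monoʳ-≤ 4 (sumC-mono {n} often) ⟩
      4 * sumC {n} (λ ω → 3 * G (Vec.concat ω))   ≡⟨ cong (4 *_) (sumC-* {n} 3 (λ ω → G (Vec.concat ω))) ⟩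
      4 * (3 * sumC {n} (λ ω → G (Vec.concat ω))) ≡⟨ cong (λ s → 4 * (3 * s)) (sumC-concat {n} G) ⟨
      4 * (3 * sumV G)                      ≡⟨ eq₃ (sumV G) ⟩
      6 * (2 * sumV G)                      ∎)
      where
      open ≤-Reasoning
      I = sumC {n} (λ ω → toNat (isolating ω))
      everything≡ : everything n ≡ 2 ^ (n * c)
      everything≡ = trans (sym (sumC-concat {n} (λ _ → 1))) (trans (sumV-const {n * c} 1) (*-identityˡ _))
      often : ∀ ω → 2 * B * toNat (isolating ω) ≤ 3 * G (Vec.concat ω)
      often ω with isolating ω in e
      ... | false = ≤-trans (≤-reflexive (*-zeroʳ (2 * B))) z≤n
      ... | true  = ≤-trans (≤-reflexive (*-identityʳ (2 * B))) (le ω e)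
      eq₁ : ∀ e b → 6 * (e * b) ≡ 2 * b * (3 * e)
      eq₁ = solve-∀
      eq₂ : ∀ b i → 2 * b * (4 * i) ≡ 4 * (2 * b * i)
      eq₂ = solve-∀
      eq₃ : ∀ s → 4 * (3 * s) ≡ 6 * (2 * s)
      eq₃ = solve-∀

-- Certificates of a given weight

drop-null : ∀ n (w : Word) → drop n w ≡ [] → length w ≤ n
drop-null n w eq = m∸n≡0⇒m≤n (trans (sym (List.length-drop n w)) (cong length eq))

null-drop : ∀ n (w : Word) → length w ≤ n → drop n w ≡ []
null-drop zero    []      le       = refl
null-drop (suc n) []      le       = refl
null-drop (suc n) (b ∷ w) (s≤s le) = null-drop n w le

drop-cons : ∀ n (w : Word) {x v} → drop n w ≡ x ∷ v → n < length w
drop-cons n w eq = ≰⇒> λ le → case trans (cong length (sym eq)) (trans (List.length-drop n w) (m≤n⇒m∸n≡0 le)) of λ ()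

-- Comparison of unary numbers: dropping `l` bits from `n` ones leaves nothing exactly if `n ≤ l`.
-- In this way programs decide the tests `≤ᵇ` of `rangeOf` and `valueOf`.
caseWord-drop : ∀ l n (v u : Word) →
  caseWord (drop l (ones n)) v (λ _ _ → u) ≡ (if n ≤ᵇ l then v else u)
caseWord-drop l n v u rewrite drop-ones l n with n ≤ᵇ l in e
... | true  rewrite m≤n⇒m∸n≡0 (≤ᵇ⇒≤ n l (subst BoolBase.T (sym e) tt)) = refl
... | false with n ∸ l in e′
... | zero  = ⊥-elim (subst BoolBase.T e (≤⇒≤ᵇ (m∸n≡0⇒m≤n {n} {l} e′)))
... | suc _ = refl

doubleFP : ∀ {k} → Fin k → FP (2 + k)
doubleFP l = caseOf (dropFP (var (suc (suc l))) (var zero ⊹ var zero)) (var zero ⊹ var zero) (λ _ → var 1F)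

fun-doubleFP : ∀ {k} (l : Fin k) r w ρ → fun (doubleFP l) (r ∷ w ∷ ρ) ≡
  caseWord (drop (length (lookup ρ l)) (r ++ r)) (r ++ r) (λ _ _ → r)
fun-doubleFP l r w ρ rewrite fun-dropFP (var (suc (suc l))) (var zero ⊹ var zero) (r ∷ w ∷ ρ) = refl

-- The starting value 1 is made an argument by `let′`, so that it counts in `total ρ` and the length
-- bound of the recursion holds even if all other arguments are empty.
rangeFP : ∀ {k} → Fin k → Fin k → FP k
rangeFP {k} n l = let′ (constant (ones 1)) (rec (var (suc n)) (var zero) (λ _ → doubleFP (suc l)) λ ρ w → ≤-trans (small ρ w) (m≤n+m _ (length w)))
  where
  small : ∀ (ρ : Vec Word (suc k)) w →
    length (recWord (lookup ρ zero) (λ _ r w → fun (doubleFP (suc l)) (r ∷ w ∷ ρ)) w) ≤ total ρ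
  small ρ []      = lookup≤total ρ zero
  small ρ (b ∷ w) = ≤-trans (≤-reflexive (cong length (fun-doubleFP (suc l) r w ρ))) (by (small ρ w))
    where
    r = recWord (lookup ρ zero) (λ _ r w → fun (doubleFP (suc l)) (r ∷ w ∷ ρ)) w
    by : length r ≤ total ρ → length (caseWord (drop (length (lookup ρ (suc l))) (r ++ r)) (r ++ r) (λ _ _ → r)) ≤ total ρ
    by r≤ with drop (length (lookup ρ (suc l))) (r ++ r) in e
    ... | []    = ≤-trans (drop-null _ (r ++ r) e) (lookup≤total ρ (suc l))
    ... | _ ∷ _ = r≤

fun-rangeFP : ∀ {k} (n l : Fin k) ρ → fun (rangeFP n l) ρ ≡ ones (rangeOf (length (lookup ρ l)) (length (lookup ρ n)))
fun-rangeFP n l ρ = by (lookup ρ n)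
  where
  L = length (lookup ρ l)
  R : Word → Word
  R = recWord (ones 1) (λ _ r w → fun (doubleFP (suc l)) (r ∷ w ∷ ones 1 ∷ ρ))
  by : ∀ w → R w ≡ ones (rangeOf L (length w))
  by []      = refl
  by (b ∷ w) = trans (fun-doubleFP (suc l) (R w) w (ones 1 ∷ ρ)) (trans (cong (λ r → caseWord (drop L (r ++ r)) (r ++ r) (λ _ _ → r)) (by w))
    (trans (cong (λ v → caseWord (drop L v) v (λ _ _ → ones r)) (sym (ones-++ r r)))
      (trans (caseWord-drop L (r + r) (ones (r + r)) (ones r)) (if-ones (r + r ≤ᵇ L)))))
    where
    r = rangeOf L (length w)
    if-ones : ∀ c → (if c then ones (r + r) else ones r) ≡ ones (if c then r + r else r)
    if-ones true  = refl
    if-ones false = refl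

valueArm : ∀ {k} → Fin k → Bool → FP (2 + k)
valueArm l b = let′ (rangeFP 1F (suc (suc l)))
  (caseOf (dropFP (var (suc (suc (suc l)))) (var zero ⊹ var zero)) (var 1F ⊹ var 1F ⊹ constant (ones (toNat b)))
    (λ _ → var 2F))

fun-valueArm : ∀ {k} (l : Fin k) b r w ρ → let g = rangeOf (length (lookup ρ l)) (length w) in
  fun (valueArm l b) (r ∷ w ∷ ρ) ≡ (if g + g ≤ᵇ length (lookup ρ l) then r ++ r ++ ones (toNat b) else r)
fun-valueArm l b r w ρ = begin
  body (fun (rangeFP 1F (suc (suc l))) (r ∷ w ∷ ρ)) ≡⟨ cong body (fun-rangeFP 1F (suc (suc l)) (r ∷ w ∷ ρ)) ⟩
  body (ones g)
    ≡⟨ cong₂ (λ u v → caseWord u (r ++ r ++ v) (λ _ _ → r))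
         (trans (fun-dropFP (var (suc (suc (suc l)))) (var zero ⊹ var zero) (ones g ∷ r ∷ w ∷ ρ)) (cong (drop L) (sym (ones-++ g g))))
         (fun-constant (ones (toNat b)) (ones g ∷ r ∷ w ∷ ρ)) ⟩
  caseWord (drop L (ones (g + g))) (r ++ r ++ ones (toNat b)) (λ _ _ → r) ≡⟨ caseWord-drop L (g + g) (r ++ r ++ ones (toNat b)) r ⟩
  (if g + g ≤ᵇ L then r ++ r ++ ones (toNat b) else r) ∎
  where
  open ≡-Reasoning
  L = length (lookup ρ l)
  g = rangeOf L (length w)
  body : Word → Word
  body u = fun (caseOf (dropFP (var (suc (suc (suc l)))) (var zero ⊹ var zero)) (var 1F ⊹ var 1F ⊹ constant (ones (toNat b)))
    (λ _ → var 2F)) (u ∷ r ∷ w ∷ ρ)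

rec-value : ∀ {k} (l : Fin k) ρ w →
  recWord [] (λ b r w → fun (valueArm l b) (r ∷ w ∷ ρ)) w ≡ ones (valueOf (length (lookup ρ l)) w)
rec-value l ρ []      = refl
rec-value l ρ (b ∷ w) = trans (fun-valueArm l b _ w ρ) (trans
  (cong (λ r → if c then r ++ r ++ ones (toNat b) else r) (rec-value l ρ w)) (by c))
  where
  L = length (lookup ρ l)
  v = valueOf L w
  c = rangeOf L (length w) + rangeOf L (length w) ≤ᵇ L
  by : ∀ c → (if c then ones v ++ ones v ++ ones (toNat b) else ones v) ≡ ones (if c then v + v + toNat b else v)
  by false = refl
  by true  = trans (cong (ones v ++_) (sym (ones-++ v (toNat b))))
    (trans (sym (ones-++ v (v + toNat b))) (cong ones (sym (+-assoc v v (toNat b)))))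

value≤ : ∀ L w → valueOf L w ≤ L
value≤ L w = ≤-pred (≤-trans (value<range L w) (range-small L (length w)))

valueFP : ∀ {k} → Fin k → Fin k → FP k
valueFP w l = rec (var w) nil (valueArm l) λ ρ v → begin
  length (recWord [] (λ b r w → fun (valueArm l b) (r ∷ w ∷ ρ)) v) ≡⟨ cong length (rec-value l ρ v) ⟩
  length (ones (valueOf (length (lookup ρ l)) v)) ≡⟨ length-ones (valueOf (length (lookup ρ l)) v) ⟩
  valueOf (length (lookup ρ l)) v                 ≤⟨ value≤ (length (lookup ρ l)) v ⟩
  length (lookup ρ l)                             ≤⟨ lookup≤total ρ l ⟩
  total ρ                                         ≤⟨ m≤n+m _ (length v) ⟩
  length v + total ρ                              ∎
  where open ≤-Reasoning

fun-valueFP : ∀ {k} (w l : Fin k) ρ → fun (valueFP w l) ρ ≡ ones (valueOf (length (lookup ρ l)) (lookup ρ w))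
fun-valueFP w l ρ = rec-value l ρ (lookup ρ w)

-- A loop body knows its position only by the suffix that follows. A bit belongs to the first `n`
-- exactly if at least as many bits follow it as `drop` leaves over.
takeFP : ∀ {k} → FP k → FP k → FP k
takeFP n t = let′ t (let′ (dropFP (wk n) (var zero))
  (loop (var 1F) (λ b → caseOf (dropFP (var zero) (var 1F)) (constant (b ∷ [])) (λ _ → nil))))

fun-takeFP : ∀ {k} (n t : FP k) ρ → fun (takeFP n t) ρ ≡ take (length (fun n ρ)) (fun t ρ)
fun-takeFP n t ρ rewrite fun-dropFP (wk n) (var zero) (fun t ρ ∷ ρ) =
  trans (by (drop (length (fun n ρ)) (fun t ρ)) (fun t ρ)) (trans
    (cong (λ m → take (length (fun t ρ) ∸ m) (fun t ρ)) (List.length-drop (length (fun n ρ)) (fun t ρ)))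
    (trim (length (fun n ρ)) (fun t ρ)))
  where
  by : ∀ u w → loopWord (λ b v → fun (caseOf (dropFP (var zero) (var 1F)) (constant (b ∷ [])) (λ _ → nil)) (v ∷ u ∷ fun t ρ ∷ ρ)) w ≡
    take (length w ∸ length u) w
  by u []      = sym (List.take-[] _)
  by u (b ∷ w) rewrite fun-dropFP (var zero) (var 1F) (w ∷ u ∷ fun t ρ ∷ ρ) | by u w with drop (length w) u in e
  ... | []    rewrite +-∸-assoc 1 (drop-null (length w) u e) = refl
  ... | _ ∷ _ rewrite m≤n⇒m∸n≡0 (drop-cons (length w) u e) | m≤n⇒m∸n≡0 (<⇒≤ (drop-cons (length w) u e)) = refl
  trim : ∀ n (w : Word) → take (length w ∸ (length w ∸ n)) w ≡ take n w
  trim zero    w       = cong (λ m → take m w) (n∸n≡0 (length w))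
  trim (suc n) []      = refl
  trim (suc n) (b ∷ w) = trans (cong (λ m → take m (b ∷ w)) (+-∸-assoc 1 (m∸n≤m (length w) n))) (cong (b ∷_) (trim n w))

wkAt : ∀ {k} → Fin (suc k) → FP k → FP (suc k)
wkAt j t = record
  { fun  = λ ρ → fun t (removeAt ρ j)
  ; code = at (suc j) (code t)
  ; cost = cost t
  ; spec = λ { (x ∷ ρ) w → at≤ refl (within (⟪⟫-mono (cost t) (total-removeAt (x ∷ ρ) j)) (spec t (removeAt (x ∷ ρ) j) w)) }
  }
  where
  total-removeAt : ∀ {k} (ρ : Vec Word (suc k)) j → total (removeAt ρ j) ≤ total ρ
  total-removeAt (x ∷ ρ)     zero    = m≤n+m _ (length x)
  total-removeAt (x ∷ y ∷ ρ) (suc j) = +-monoʳ-≤ (length x) (total-removeAt (y ∷ ρ) j)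

isTrue : Word → Bool
isTrue (true ∷ []) = true
isTrue _           = false

isTrue-elim : ∀ w → isTrue w ≡ true → w ≡ true ∷ []
isTrue-elim (true ∷ []) _ = refl

isTrue-intro : ∀ {w} → w ≡ true ∷ [] → isTrue w ≡ true
isTrue-intro refl = refl

truth : Bool → Word
truth true  = true ∷ []
truth false = []

isTrueFP : ∀ {k} → FP k → FP k
isTrueFP t = caseOf t nil arm
  where
  arm : ∀ {k} → Bool → FP (suc k)
  arm false = nil
  arm true  = caseOf (var zero) (constant (true ∷ [])) (λ _ → nil)

fun-isTrueFP : ∀ {k} (t : FP k) ρ → fun (isTrueFP t) ρ ≡ truth (isTrue (fun t ρ))
fun-isTrueFP t ρ with fun t ρ
... | []            = refl
... | false ∷ w     = refl
... | true ∷ []     = refl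
... | true ∷ _ ∷ _  = refl

-- Compares lengths, which for unary numbers is equality.
equalFP : ∀ {k} → FP k → FP k → FP k
equalFP t u = caseOf (dropFP t u) (caseOf (dropFP u t) (constant (true ∷ [])) (λ _ → nil)) (λ _ → nil)

equal-intro : ∀ {k} (t u : FP k) ρ → length (fun t ρ) ≡ length (fun u ρ) → fun (equalFP t u) ρ ≡ true ∷ []
equal-intro t u ρ eq
  rewrite fun-dropFP t u ρ | fun-dropFP u t ρ
        | null-drop (length (fun t ρ)) (fun u ρ) (≤-reflexive (sym eq))
        | null-drop (length (fun u ρ)) (fun t ρ) (≤-reflexive eq) = refl

toList-++ : ∀ {m n} (u : Vec Bool m) (v : Vec Bool n) → toList (u Vec.++ v) ≡ toList u ++ toList v
toList-++ []      v = refl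
toList-++ (x ∷ u) v = cong (x ∷_) (toList-++ u v)

drop-length-++ : ∀ (u v : Word) → drop (length u) (u ++ v) ≡ v
drop-length-++ []      v = refl
drop-length-++ (b ∷ u) v = drop-length-++ u v

take-toList : ∀ {n} (a : Vec Bool n) v → take n (toList a ++ v) ≡ toList a
take-toList []      v = refl
take-toList (x ∷ a) v = cong (x ∷_) (take-toList a v)

length-loop : ∀ (v : Word) w → length (loopWord (λ _ _ → v) w) ≡ length w * length v
length-loop v []      = refl
length-loop v (b ∷ w) = trans (List.length-++ v) (cong (length v +_) (length-loop v w))

-- The arguments of the verifier are a certificate, a target weight, random
-- bits, the chunk size, the length of the certificate and the input, in that order.
module Verify (M : PolyTimeTM) where
  weightArm : Bool → FP 7
  weightArm false = nil
  weightArm true  = let′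
    -- The position of the current certificate bit is known from the end only, by the suffix `w`; so
    -- the chunk is located from the end of the random bits, where it starts `(|w| + 1) · c` bits
    -- before the end. The nested `dropFP` computes the complement.
    (takeFP (var 4F)
      (dropFP (dropFP (mulFP (cons true (var zero)) (var 4F)) (var 3F)) (var 3F)))
    (valueFP zero 5F)

  sumFP : FP 6
  sumFP = loop (var zero) weightArm

  verifierFP : FP 6
  verifierFP = caseOf (isTrueFP (call M (var 5F) (var zero))) nil
    (λ _ → wk (equalFP sumFP (var 1F)))

  fun-weightArm : ∀ w z t r l σ → fun (weightArm true) (w ∷ z ∷ t ∷ r ∷ l ∷ σ) ≡
    ones (valueOf (length l) (take (length l) (drop (length r ∸ suc (length w) * length l) r)))
  fun-weightArm w z t r l σ = trans (fun-valueFP zero 5F (fun (takeFP (var 4F) (dropFP (dropFP m v) v)) env ∷ env))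
    (cong (λ v → ones (valueOf (length l) v)) (trans (fun-takeFP (var 4F) (dropFP (dropFP m v) v) env)
      (cong (take (length l)) (trans (fun-dropFP (dropFP m v) v env)
        (cong (λ n → drop n r) (trans (cong length (fun-dropFP m v env)) (trans (List.length-drop (length (fun m env)) r)
          (cong (length r ∸_) (length-loop l (true ∷ w))))))))))
    where
    env : Vec Word 7
    env = w ∷ z ∷ t ∷ r ∷ l ∷ σ
    m v : FP 7
    m = mulFP (cons true (var zero)) (var 4F)
    v = var 3F

  module _ {c : ℕ} where
    open Isolation c (rangeOf c c) (valueV c) (uniform c c) using (Chunks; weight)

    length-concat : ∀ {n} (ω : Chunks n) → length (toList (Vec.concat ω)) ≡ n * c
    length-concat ω = length-toList (Vec.concat ω)

    module _ (z₀ t r l : Word) (σ : Vec Word 2) (len-l : length l ≡ c) where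
      summand : Bool → Word → Word
      summand b w = fun (weightArm b) (w ∷ z₀ ∷ t ∷ r ∷ l ∷ σ)

      -- `pre` holds the chunks already passed: the program addresses each chunk within the whole of
      -- `r`, so the induction cannot shorten `r`.
      sum-weight : ∀ {n} (z : Vec Bool n) (ω : Chunks n) pre → r ≡ pre ++ toList (Vec.concat ω) →
        loopWord summand (toList z) ≡ ones (weight z ω)
      sum-weight []      []      pre eq = refl
      sum-weight {suc n} (b ∷ z) (a ∷ ω) pre eq = trans
        (cong₂ _++_ (head b) (sum-weight z ω (pre ++ toList a) (trans eq split))) (sym (ones-++ (if b then valueV c a else 0) (weight z ω)))
        where
        split : pre ++ toList (a Vec.++ Vec.concat ω) ≡ (pre ++ toList a) ++ toList (Vec.concat ω)
        split = trans (cong (pre ++_) (toList-++ a (Vec.concat ω))) (sym (List.++-assoc pre (toList a) _))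
        skip-pre : length r ∸ suc (length (toList z)) * c ≡ length pre
        skip-pre = trans (cong₂ _∸_ (trans (cong length eq) (trans (List.length-++ pre) (cong (length pre +_) (length-concat (a ∷ ω)))))
          (cong (λ n → suc n * c) (length-toList z))) (m+n∸n≡m (length pre) (suc n * c))
        head : ∀ b → summand b (toList z) ≡ ones (if b then valueV c a else 0)
        head false = refl
        head true  = trans (fun-weightArm (toList z) z₀ t r l σ) (cong ones (begin
          valueOf (length l) (take (length l) (drop (length r ∸ suc (length (toList z)) * length l) r))
            ≡⟨ cong (λ m → valueOf m (take m (drop (length r ∸ suc (length (toList z)) * m) r))) len-l ⟩
          valueOf c (take c (drop (length r ∸ suc (length (toList z)) * c) r))
            ≡⟨ cong₂ (λ m v → valueOf c (take c (drop m v))) skip-pre eq ⟩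
          valueOf c (take c (drop (length pre) (pre ++ toList (a Vec.++ Vec.concat ω))))
            ≡⟨ cong (λ v → valueOf c (take c v)) (trans (drop-length-++ pre _) (toList-++ a (Vec.concat ω))) ⟩
          valueOf c (take c (toList a ++ toList (Vec.concat ω)))
            ≡⟨ cong (valueOf c) (take-toList a _) ⟩
          valueOf c (toList a) ∎))
          where open ≡-Reasoning

    module _ {n} (x : Word) (ω : Chunks n) (t l w : Word) (len-l : length l ≡ c) where
      private
        env : Word → Vec Word 6
        env z = z ∷ t ∷ toList (Vec.concat ω) ∷ l ∷ w ∷ x ∷ []

      sum≡ : ∀ z → length (fun sumFP (env (toList z))) ≡ weight z ω
      sum≡ z = trans (cong length (sum-weight (toList z) t (toList (Vec.concat ω)) l (w ∷ x ∷ []) len-l z ω [] refl)) (length-ones _)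

      verifier-intro : ∀ (z : Vec Bool n) → isTrue (M ⟨ x , toList z ⟩) ≡ true → weight z ω ≡ length t →
        fun verifierFP (env (toList z)) ≡ true ∷ []
      verifier-intro z acc eq = trans
        (cong (λ v → caseWord v [] (λ _ _ → fun (equalFP sumFP (var 1F)) (env (toList z))))
          (trans (fun-isTrueFP (call M (var 5F) (var zero)) (env (toList z))) (cong truth acc)))
        (equal-intro sumFP (var 1F) (env (toList z)) (trans (sum≡ z) eq))

      verifier-weight : ∀ (z : Vec Bool n) → top (fun verifierFP (env (toList z))) ≡ just true → weight z ω ≡ length t
      verifier-weight z eq = trans (sym (sum≡ z)) (equal-elim (strip (fun (isTrueFP (call M (var 5F) (var zero))) (env (toList z))) eq))
        where
        u = fun sumFP (env (toList z))
        strip : ∀ v → top (caseWord v [] (λ _ _ → fun (equalFP sumFP (var 1F)) (env (toList z)))) ≡ just true →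
          top (fun (equalFP sumFP (var 1F)) (env (toList z))) ≡ just true
        strip (_ ∷ _) e = e
        equal-elim : top (fun (equalFP sumFP (var 1F)) (env (toList z))) ≡ just true → length u ≡ length t
        equal-elim e = both (drop (length u) t) (drop (length t) u) refl refl (trans (sym (cong₂ (λ v w → top (caseWord v (caseWord w (true ∷ []) (λ _ _ → [])) (λ _ _ → [])))
          (fun-dropFP sumFP (var 1F) (env (toList z))) (fun-dropFP (var 1F) sumFP (env (toList z))))) e)
          where
          both : ∀ v w → drop (length u) t ≡ v → drop (length t) u ≡ w →
            top (caseWord v (caseWord w (true ∷ []) (λ _ _ → [])) (λ _ _ → [])) ≡ just true → length u ≡ length t
          both [] [] e₁ e₂ _ = ≤-antisym (drop-null (length t) u e₂) (drop-null (length u) t e₁)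

  verifier-accepts : ∀ z t r l w x {b v} → fun verifierFP (z ∷ t ∷ r ∷ l ∷ w ∷ x ∷ []) ≡ b ∷ v → M ⟨ x , z ⟩ ≡ true ∷ []
  verifier-accepts z t r l w x {b} {v} eq = isTrue-elim (M ⟨ x , z ⟩) (by (isTrue (M ⟨ x , z ⟩)) (trans (cong (λ v → caseWord v [] (λ _ _ → fun (equalFP sumFP (var 1F)) env))
    (sym (fun-isTrueFP (call M (var 5F) (var zero)) env))) eq))
    where
    env : Vec Word 6
    env = z ∷ t ∷ r ∷ l ∷ w ∷ x ∷ []
    by : ∀ c → caseWord (truth c) [] (λ _ _ → fun (equalFP sumFP (var 1F)) env) ≡ b ∷ v → c ≡ true
    by true _ = refl

-- The randomized decision procedure

zeros : ℕ → Word
zeros n = replicate n false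

zerosFP : ∀ {k} → FP k → FP k
zerosFP t = loop t (λ _ → constant (false ∷ []))

loop-zeros : ∀ w → loopWord (λ _ _ → false ∷ []) w ≡ zeros (length w)
loop-zeros []      = refl
loop-zeros (b ∷ w) = cong (false ∷_) (loop-zeros w)

-- The assignment of X that selects the bit at position length u ∸ suc (length w).
queryWord : Word → Word → Word
queryWord u w = zeros (length u ∸ suc (length w)) ++ true ∷ zeros (length w) ++ false ∷ []

length-zeros : ∀ n → length (zeros n) ≡ n
length-zeros n = List.length-replicate n

no-true : ∀ b i → val (nth (zeros b ++ false ∷ []) i) ≡ false
no-true zero    zero          = refl
no-true zero    (suc zero)    = refl
no-true zero    (suc (suc i)) = refl
no-true (suc b) zero          = refl
no-true (suc b) (suc i)       = no-true b i

nth-one-hot : ∀ a b i → val (nth (zeros a ++ true ∷ zeros b ++ false ∷ []) i) ≡ true → i ≡ a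
nth-one-hot (suc a) b (suc i) e = cong suc (nth-one-hot a b i e)
nth-one-hot zero    b zero    e = refl
nth-one-hot zero    b (suc i) e with () ← trans (sym e) (no-true b i)

nth-++ : ∀ (u : Word) x v → nth (u ++ x ∷ v) (length u) ≡ just x
nth-++ []      x v = refl
nth-++ (b ∷ u) x v = nth-++ u x v

selected-one-hot : ∀ {n} (x : Vec Bool (suc n)) a b z → toList x ≡ zeros a ++ true ∷ zeros b ++ false ∷ [] →
  length z ≤ suc n → a < length z → selected x z ≡ val (nth z a)
selected-one-hot {n} x a b z eq z≤ a<z with val (nth z a) in e
... | true  = cong not (not-all (allBelow (length z) f) refl)
  where
  f : ℕ → Bool
  f i = not (lookup x (clamp i) ∧ val (nth z i))
  at-a : lookup x (clamp a) ≡ true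
  at-a = trans (cong val (sym (nth-toList x (clamp a)))) (trans (cong (λ i → val (nth (toList x) i)) small)
    (trans (cong (λ w → val (nth w a)) eq) (cong val (subst (λ i → nth (zeros a ++ true ∷ zeros b ++ false ∷ []) i ≡ just true) (length-zeros a) (nth-++ (zeros a) true _)))))
    where
    small : toℕ (clamp {n} a) ≡ a
    small = trans (toℕ-clamp a) (m≤n⇒m⊓n≡m (≤-pred (≤-trans a<z z≤)))
  not-all : ∀ c → allBelow (length z) f ≡ c → c ≡ false
  not-all false _ = refl
  not-all true  h with allBelow-elim (length z) f h a a<z
  ... | h′ rewrite at-a | e with () ← h′
... | false = cong not (allBelow-intro (length z) _ unselect)
  where
  unselect : ∀ i → i < length z → not (lookup x (clamp i) ∧ val (nth z i)) ≡ true
  unselect i i<z with lookup x (clamp i) in l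
  ... | false = refl
  ... | true  = cong not (trans (cong (λ j → val (nth z j)) (nth-one-hot a b i hit)) e)
    where
    small : toℕ (clamp {n} i) ≡ i
    small = trans (toℕ-clamp i) (m≤n⇒m⊓n≡m (≤-pred (≤-trans i<z z≤)))
    hit : val (nth (zeros a ++ true ∷ zeros b ++ false ∷ []) i) ≡ true
    hit = trans (cong (λ w → val (nth w i)) (sym eq)) (trans (cong (λ j → val (nth (toList x) j)) (sym small))
      (trans (cong val (nth-toList x (clamp i))) l))

fromWord : ∀ (w : Word) {n} → length w ≡ n → Σ[ v ∈ Vec Bool n ] toList v ≡ w
fromWord w refl = Vec.fromList w , Vec.toList∘fromList w

certificateWord : Word → Word → Word
certificateWord C u = loopWord (λ _ w → circuitWord C (queryWord u w)) u

-- True for every word `C`, circuit or not, so that an arbitrary reply still leads to a candidate of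
-- the right length.
length-certificateWord : ∀ C u → length (certificateWord C u) ≡ length u
length-certificateWord C u = by u
  where
  by : ∀ w → length (loopWord (λ _ w → circuitWord C (queryWord u w)) w) ≡ length w
  by []      = refl
  by (b ∷ w) = trans (List.length-++ (circuitWord C (queryWord u w))) (cong₂ _+_ (length-circuitWord C (queryWord u w)) (by w))

certificateWord-correct : ∀ u z (C : Circuit (suc (length u) + 0)) → length z ≡ length u →
  (∀ x → evalCircuit C (x Vec.++ []) ≡ selected x z) → certificateWord (encodeCircuit C) u ≡ z
certificateWord-correct u z C len-z answers = by u [] z refl (sym len-z)
  where
  by : ∀ w pre suf → z ≡ pre ++ suf → length w ≡ length suf →
    loopWord (λ _ w → circuitWord (encodeCircuit C) (queryWord u w)) w ≡ suf
  by []      pre []        eq same-length = refl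
  by (b ∷ w) pre (s ∷ suf) eq same-length = cong₂ _++_ bit-s (by w (pre ++ s ∷ []) suf (trans eq (sym (List.++-assoc pre (s ∷ []) suf))) (suc-injective same-length))
    where
    j = length u ∸ suc (length w)
    total-length : length u ≡ length pre + suc (length w)
    total-length = trans (sym len-z) (trans (cong length eq) (trans (List.length-++ pre) (cong (length pre +_) (sym same-length))))
    j≡ : j ≡ length pre
    j≡ = trans (cong (_∸ suc (length w)) total-length) (m+n∸n≡m (length pre) (suc (length w)))
    query-length : length (queryWord u w) ≡ suc (length u)
    query-length = begin
      length (zeros j ++ true ∷ zeros (length w) ++ false ∷ []) ≡⟨ List.length-++ (zeros j) ⟩
      length (zeros j) + suc (length (zeros (length w) ++ false ∷ []))
        ≡⟨ cong₂ (λ a b → a + suc b) (trans (length-zeros j) j≡) (trans (List.length-++ (zeros (length w))) (cong (_+ 1) (length-zeros (length w)))) ⟩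
      length pre + suc (length w + 1)   ≡⟨ cong (λ n → length pre + suc n) (+-comm (length w) 1) ⟩
      length pre + suc (suc (length w)) ≡⟨ +-suc (length pre) (suc (length w)) ⟩
      suc (length pre + suc (length w)) ≡⟨ cong suc total-length ⟨
      suc (length u)                    ∎
      where open ≡-Reasoning
    x = proj₁ (fromWord (queryWord u w) query-length)
    x≡ : toList x ≡ queryWord u w
    x≡ = proj₂ (fromWord (queryWord u w) query-length)
    bit-s : circuitWord (encodeCircuit C) (queryWord u w) ≡ s ∷ []
    bit-s = begin
      circuitWord (encodeCircuit C) (queryWord u w)
        ≡⟨ cong (circuitWord (encodeCircuit C)) (trans (toList-++ x []) (trans (List.++-identityʳ (toList x)) x≡)) ⟨
      circuitWord (encodeCircuit C) (toList (x Vec.++ [])) ≡⟨ circuitWord-encode C (x Vec.++ []) ⟩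
      evalCircuit C (x Vec.++ []) ∷ []                     ≡⟨ cong (_∷ []) (answers x) ⟩
      selected x z ∷ []
        ≡⟨ cong (_∷ []) (selected-one-hot x j (length w) z x≡ (≤-trans (≤-reflexive len-z) (n≤1+n _))
             (subst (_< length z) (sym j≡) (subst (length pre <_) (sym (trans len-z total-length)) (m<m+n (length pre) (s≤s z≤n))))) ⟩
      val (nth z j) ∷ []            ≡⟨ cong₂ (λ w i → val (nth w i) ∷ []) eq j≡ ⟩
      val (nth (pre ++ s ∷ suf) (length pre)) ∷ [] ≡⟨ cong (λ a → val a ∷ []) (nth-++ pre s suf) ⟩
      s ∷ [] ∎
      where open ≡-Reasoning

module Decide (requestFP verifierFP : FP 6) (q : Poly) (A : PolyTimeTM) (bits : Poly) where

  queryFP : FP 9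
  queryFP = zerosFP (dropFP (cons true (var zero)) (var 6F)) ⊹
    cons true (zerosFP (var zero) ⊹ constant (false ∷ []))

  certificateFP : FP 8
  certificateFP = loop (var 5F) λ _ → let′ queryFP (let′ (var 2F) circuitFP)

  -- The synthesizer's random bits are the last ones of `r`. Their number depends on the request, so
  -- the bits between them and the weights act as padding.
  bitsFP : FP 7
  bitsFP = dropFP (dropFP (polyFP (fromPoly bits) (var zero)) r) r
    where
    r : FP 7
    r = var 6F

  checkFP : FP 6
  -- `u` is copied to the front, where the certificate stands for the verifier; the full random
  -- string, at index 6, is hidden from the request.
  checkFP = let′ (let′ (var 3F) (wkAt 6F requestFP))
    (let′ (call A (var zero) bitsFP)
    (let′ certificateFP (wkAt 1F (wkAt 1F (wkAt 6F verifierFP)))))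

  mainFP : FP 2
  -- Chunks of `8ℓ` bits: twice the range of the weights exceeds `8ℓ`, so the range is at least the
  -- `4ℓ` that isolation requires.
  mainFP = let′ (polyFP (fromPoly q) (var zero)) (let′ (mulFP (constant (ones 8)) (var zero))
    (let′ (takeFP (mulFP (var 1F) (var zero)) (var 3F))
    -- The suffixes met by the loop are the unary targets `ℓ · chunk` down to 0, all possible
    -- weights. The verdicts are concatenated, so one nonempty verdict suffices for acceptance.
    (caseOf (loop (cons true (mulFP (var 2F) (var 1F))) (λ _ → checkFP)) nil (λ _ → constant (true ∷ [])))))

  module _ (t r₁ l u x r : Word) where
    request : Word
    request = fun requestFP (u ∷ t ∷ r₁ ∷ l ∷ u ∷ x ∷ [])

    reply : Word
    reply = A ⟨ request , drop (length r ∸ ⟦ bits ⟧ (length request)) r ⟩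

    checkWord : Word
    checkWord = fun verifierFP (certificateWord reply u ∷ t ∷ r₁ ∷ l ∷ u ∷ x ∷ [])

    fun-queryFP : ∀ C q w → fun queryFP (w ∷ C ∷ q ∷ t ∷ r₁ ∷ l ∷ u ∷ x ∷ r ∷ []) ≡ queryWord u w
    fun-queryFP C q w = cong₂ (λ v v′ → v ++ true ∷ v′ ++ false ∷ [])
      (trans (loop-zeros (fun (dropFP (cons true (var zero)) (var 6F)) env))
        (cong zeros (trans (cong length (fun-dropFP (cons true (var zero)) (var 6F) env))
          (List.length-drop (suc (length w)) u))))
      (loop-zeros w)
      where
      env : Vec Word 9
      env = w ∷ C ∷ q ∷ t ∷ r₁ ∷ l ∷ u ∷ x ∷ r ∷ []

    fun-certificateFP : ∀ C q → fun certificateFP (C ∷ q ∷ t ∷ r₁ ∷ l ∷ u ∷ x ∷ r ∷ []) ≡ certificateWord C u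
    fun-certificateFP C q = by u
      where
      by : ∀ v → loopWord (λ b w → fun (let′ queryFP (let′ (var 2F) circuitFP)) (w ∷ C ∷ q ∷ t ∷ r₁ ∷ l ∷ u ∷ x ∷ r ∷ [])) v ≡
        loopWord (λ _ w → circuitWord C (queryWord u w)) v
      by []      = refl
      by (b ∷ w) = cong₂ _++_
        (trans (fun-circuitFP C (fun queryFP env) env) (cong (circuitWord C) (fun-queryFP C q w))) (by w)
        where
        env : Vec Word 9
        env = w ∷ C ∷ q ∷ t ∷ r₁ ∷ l ∷ u ∷ x ∷ r ∷ []

    fun-checkFP : fun checkFP (t ∷ r₁ ∷ l ∷ u ∷ x ∷ r ∷ []) ≡ checkWord
    fun-checkFP = trans (cong verdict (fun-certificateFP (A ⟨ request , fun bitsFP env ⟩) request))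
      (cong (λ b → verdict (certificateWord (A ⟨ request , b ⟩) u)) fun-bitsFP)
      where
      env : Vec Word 7
      env = request ∷ t ∷ r₁ ∷ l ∷ u ∷ x ∷ r ∷ []
      verdict : Word → Word
      verdict z = fun verifierFP (z ∷ t ∷ r₁ ∷ l ∷ u ∷ x ∷ [])
      rᵥ : FP 7
      rᵥ = var 6F
      n : FP 7
      n = polyFP (fromPoly bits) (var zero)
      fun-bitsFP : fun bitsFP env ≡ drop (length r ∸ ⟦ bits ⟧ (length request)) r
      fun-bitsFP = trans (fun-dropFP (dropFP n rᵥ) rᵥ env) (cong (λ m → drop m r) (trans (cong length (fun-dropFP n rᵥ env))
        (trans (List.length-drop (length (fun n env)) r) (cong (length r ∸_) (trans (cong length (fun-polyFP (fromPoly bits) (var zero) env))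
          (trans (length-ones (⟪ fromPoly bits ⟫ (length request))) (⟪fromPoly⟫ bits (length request))))))))

  module _ (x r : Word) where
    ℓ chunk : ℕ
    ℓ = ⟦ q ⟧ (length x)
    chunk = 8 * ℓ

    random : Word
    random = take (ℓ * chunk) r

    verdicts : Word
    verdicts = loopWord (λ _ t → checkWord t random (ones chunk) (ones ℓ) x r) (ones (suc (ℓ * chunk)))

    fun-mainFP : fun mainFP (x ∷ r ∷ []) ≡ caseWord verdicts [] (λ _ _ → true ∷ [])
    fun-mainFP = begin
      body (fun u (x ∷ r ∷ [])) (fun l (fun u (x ∷ r ∷ []) ∷ x ∷ r ∷ [])) (fun r₁ (fun l (fun u (x ∷ r ∷ []) ∷ x ∷ r ∷ []) ∷ fun u (x ∷ r ∷ []) ∷ x ∷ r ∷ []))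
        ≡⟨ cong (λ v → body v (fun l (v ∷ x ∷ r ∷ [])) (fun r₁ (fun l (v ∷ x ∷ r ∷ []) ∷ v ∷ x ∷ r ∷ [])))
             (trans (fun-polyFP (fromPoly q) (var zero) (x ∷ r ∷ [])) (cong ones (⟪fromPoly⟫ q (length x)))) ⟩
      body (ones ℓ) (fun l (ones ℓ ∷ x ∷ r ∷ [])) (fun r₁ (fun l (ones ℓ ∷ x ∷ r ∷ []) ∷ ones ℓ ∷ x ∷ r ∷ []))
        ≡⟨ cong (λ v → body (ones ℓ) v (fun r₁ (v ∷ ones ℓ ∷ x ∷ r ∷ [])))
             (fun-mulFP (constant (ones 8)) (var zero) (ones ℓ ∷ x ∷ r ∷ []) {8} {ℓ} refl refl) ⟩
      body (ones ℓ) (ones chunk) (fun r₁ (ones chunk ∷ ones ℓ ∷ x ∷ r ∷ []))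
        ≡⟨ cong (body (ones ℓ) (ones chunk)) (trans (fun-takeFP (mulFP (var 1F) (var zero)) (var 3F) (ones chunk ∷ ones ℓ ∷ x ∷ r ∷ []))
             (cong (λ m → take m r) (trans (cong length (fun-mulFP (var 1F) (var zero) (ones chunk ∷ ones ℓ ∷ x ∷ r ∷ []) {ℓ} {chunk} refl refl))
               (length-ones (ℓ * chunk))))) ⟩
      body (ones ℓ) (ones chunk) random
        ≡⟨ cong (λ w → caseWord (loopWord (λ _ t → fun checkFP (t ∷ random ∷ ones chunk ∷ ones ℓ ∷ x ∷ r ∷ [])) (true ∷ w)) [] (λ _ _ → true ∷ []))
             (fun-mulFP (var 2F) (var 1F) (random ∷ ones chunk ∷ ones ℓ ∷ x ∷ r ∷ []) {ℓ} {chunk} refl refl) ⟩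
      caseWord (loopWord (λ _ t → fun checkFP (t ∷ random ∷ ones chunk ∷ ones ℓ ∷ x ∷ r ∷ [])) (ones (suc (ℓ * chunk)))) [] (λ _ _ → true ∷ [])
        ≡⟨ cong (λ v → caseWord v [] (λ _ _ → true ∷ [])) (loop-cong (ones (suc (ℓ * chunk)))) ⟩
      caseWord verdicts [] (λ _ _ → true ∷ []) ∎
      where
      open ≡-Reasoning
      u : FP 2
      u = polyFP (fromPoly q) (var zero)
      l : FP 3
      l = mulFP (constant (ones 8)) (var zero)
      r₁ : FP 4
      r₁ = takeFP (mulFP (var 1F) (var zero)) (var 3F)
      body : Word → Word → Word → Word
      body u l r₁ = fun (caseOf (loop (cons true (mulFP (var 2F) (var 1F))) (λ _ → checkFP)) nil (λ _ → constant (true ∷ [])))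
        (r₁ ∷ l ∷ u ∷ x ∷ r ∷ [])
      loop-cong : ∀ w → loopWord (λ _ t → fun checkFP (t ∷ random ∷ ones chunk ∷ ones ℓ ∷ x ∷ r ∷ [])) w ≡
        loopWord (λ _ t → checkWord t random (ones chunk) (ones ℓ) x r) w
      loop-cong []      = refl
      loop-cong (b ∷ w) = cong₂ _++_ (fun-checkFP w random (ones chunk) (ones ℓ) x r) (loop-cong w)

    main-intro : ∀ i → i ≤ ℓ * chunk → checkWord (ones i) random (ones chunk) (ones ℓ) x r ≡ true ∷ [] →
      fun mainFP (x ∷ r ∷ []) ≡ true ∷ []
    main-intro i i≤ hit = trans fun-mainFP (by (suc (ℓ * chunk)) (s≤s i≤))
      where
      g : Bool → Word → Word
      g _ t = checkWord t random (ones chunk) (ones ℓ) x r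
      nonempty : ∀ v w → caseWord w [] (λ _ _ → true ∷ []) ≡ true ∷ [] → caseWord (v ++ w) [] (λ _ _ → true ∷ []) ≡ true ∷ []
      nonempty []      w eq = eq
      nonempty (_ ∷ v) w eq = refl
      by : ∀ n → i < n → caseWord (loopWord g (ones n)) [] (λ _ _ → true ∷ []) ≡ true ∷ []
      by (suc n) (s≤s i≤n) with m≤n⇒m<n∨m≡n i≤n
      ... | inj₁ i<n  = nonempty (g true (ones n)) _ (by n i<n)
      ... | inj₂ refl rewrite hit = refl

    -- Nothing is assumed about the replies of `A`: whatever candidate they lead to has length `ℓ`
    -- and has itself passed the verifier.
    main-elim : fun mainFP (x ∷ r ∷ []) ≡ true ∷ [] →
      ∃₂ λ z t → length z ≡ ℓ × ∃₂ λ b v → fun verifierFP (z ∷ t ∷ random ∷ ones chunk ∷ ones ℓ ∷ x ∷ []) ≡ b ∷ v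
    main-elim eq = by (suc (ℓ * chunk)) (trans (sym fun-mainFP) eq)
      where
      g : Bool → Word → Word
      g _ t = checkWord t random (ones chunk) (ones ℓ) x r
      Goal : Set
      Goal = ∃₂ λ z t → length z ≡ ℓ × ∃₂ λ b v → fun verifierFP (z ∷ t ∷ random ∷ ones chunk ∷ ones ℓ ∷ x ∷ []) ≡ b ∷ v
      found : ∀ t {b v} → g true t ≡ b ∷ v → Goal
      found t e = let answer = reply t random (ones chunk) (ones ℓ) x r in
        certificateWord answer (ones ℓ) , t , trans (length-certificateWord answer (ones ℓ)) (length-ones ℓ) , _ , _ , e
      by : ∀ n → caseWord (loopWord g (ones n)) [] (λ _ _ → true ∷ []) ≡ true ∷ [] → Goal
      by (suc n) e = split (g true (ones n)) refl e
        where
        split : ∀ v → g true (ones n) ≡ v → caseWord (v ++ loopWord g (ones n)) [] (λ _ _ → true ∷ []) ≡ true ∷ [] → Goal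
        split []      _  e = by n e
        split (b ∷ v) e′ _ = found (ones n) e′

-- Success probability

satisfying : ∀ {n} → (Vec Bool n → Bool) → List (Vec Bool n)
satisfying {zero}  P = if P [] then [] ∷ [] else []
satisfying {suc n} P = List.map (true ∷_) (satisfying λ v → P (true ∷ v)) ++ List.map (false ∷_) (satisfying λ v → P (false ∷ v))

length-satisfying : ∀ {n} (P : Vec Bool n → Bool) → length (satisfying P) ≡ sumV (λ v → toNat (P v))
length-satisfying {zero}  P with P []
... | true  = refl
... | false = refl
length-satisfying {suc n} P = trans (List.length-++ (List.map (true ∷_) (satisfying λ v → P (true ∷ v))))
  (cong₂ _+_ (trans (List.length-map (true ∷_) (satisfying λ v → P (true ∷ v))) (length-satisfying λ v → P (true ∷ v)))
             (trans (List.length-map (false ∷_) (satisfying λ v → P (false ∷ v))) (length-satisfying λ v → P (false ∷ v))))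

all-satisfying : ∀ {n} (P : Vec Bool n → Bool) → All (λ v → P v ≡ true) (satisfying P)
all-satisfying {zero}  P with P [] in e
... | true  = e ∷ []
... | false = []
all-satisfying {suc n} P = AllP.++⁺ (AllP.map⁺ (all-satisfying λ v → P (true ∷ v))) (AllP.map⁺ (all-satisfying λ v → P (false ∷ v)))

unique-satisfying : ∀ {n} (P : Vec Bool n → Bool) → Unique (satisfying P)
unique-satisfying {zero}  P with P []
... | true  = [] ∷ []
... | false = []
unique-satisfying {suc n} P = UniqueP.++⁺ (UniqueP.map⁺ Vec.∷-injectiveʳ (unique-satisfying λ v → P (true ∷ v)))
  (UniqueP.map⁺ Vec.∷-injectiveʳ (unique-satisfying λ v → P (false ∷ v))) disjoint
  where
  disjoint : ∀ {v} → ¬ (v ∈ˡ List.map (true ∷_) (satisfying λ v → P (true ∷ v)) × v ∈ˡ List.map (false ∷_) (satisfying λ v → P (false ∷ v)))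
  disjoint (m , m′) with ∈-map⁻ (true ∷_) m | ∈-map⁻ (false ∷_) m′
  ... | _ , _ , refl | _ , _ , ()

eqV : ∀ {n} → Vec Bool n → Vec Bool n → Bool
eqV []      []      = true
eqV (a ∷ v) (b ∷ w) = iffB a b ∧ eqV v w

eqV-sound : ∀ {n} (v w : Vec Bool n) → eqV v w ≡ true → v ≡ w
eqV-sound []      []      _ = refl
eqV-sound (a ∷ v) (b ∷ w) e = cong₂ _∷_ (iffB-elim (proj₁ (∧-true e))) (eqV-sound v w (proj₂ (∧-true {iffB a b} e)))

sumV-remove : ∀ {n} (P : Vec Bool n → Bool) r → P r ≡ true →
  sumV (λ v → toNat (P v)) ≡ suc (sumV (λ v → toNat (P v ∧ not (eqV v r))))
sumV-remove P []          e rewrite e = refl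
sumV-remove P (true ∷ r)  e = cong₂ _+_ (sumV-remove (λ v → P (true ∷ v)) r e)
  (sumV-cong λ v → cong toNat (sym (Bool.∧-identityʳ (P (false ∷ v)))))
sumV-remove P (false ∷ r) e = trans (cong₂ _+_
  (sumV-cong λ v → cong toNat (sym (Bool.∧-identityʳ (P (true ∷ v))))) (sumV-remove (λ v → P (false ∷ v)) r e))
  (+-suc (sumV λ v → toNat (P (true ∷ v) ∧ true)) _)

-- Each listed element is struck from `P` as it is counted; freedom from duplicates keeps the others
-- in the remaining set.
unique-length : ∀ {n} (P : Vec Bool n → Bool) rs → Unique rs → All (λ v → P v ≡ true) rs →
  length rs ≤ sumV (λ v → toNat (P v))
unique-length P []       _       _       = z≤n
unique-length P (r ∷ rs) (r∉ ∷ u) (p ∷ ps) = ≤-trans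
  (s≤s (unique-length (λ v → P v ∧ not (eqV v r)) rs u (All.zipWith kept (r∉ , ps))))
  (≤-reflexive (sym (sumV-remove P r p)))
  where
  kept : ∀ {v} → r ≢ v × P v ≡ true → P v ∧ not (eqV v r) ≡ true
  kept {v} (r≢v , pv) with eqV v r in e
  ... | true  = ⊥-elim (r≢v (sym (eqV-sound v r e)))
  ... | false = true-∧ pv refl

-- `Q` is an arbitrary predicate and cannot be counted directly. A Boolean test replaces it, one
-- that implies `Q` here and one implied by `Q` in `Pr-elim`.
Pr-intro : ∀ {n} (P : Vec Bool n → Bool) {Q : Pred (Vec Bool n) 0ℓ} a b → (∀ v → P v ≡ true → Q v) →
  a * 2 ^ n ≤ b * sumV (λ v → toNat (P v)) → Pr[ Q ]≥ a / b
Pr-intro P a b PQ le = satisfying P , unique-satisfying P , All.map (PQ _) (all-satisfying P) ,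
  ≤-trans le (≤-reflexive (cong (b *_) (sym (length-satisfying P))))

Pr-elim : ∀ {n} (P : Vec Bool n → Bool) {Q : Pred (Vec Bool n) 0ℓ} a b → (∀ v → Q v → P v ≡ true) →
  Pr[ Q ]≥ a / b → a * 2 ^ n ≤ b * sumV (λ v → toNat (P v))
Pr-elim P a b QP (rs , u , qs , le) = ≤-trans le (*-monoʳ-≤ b (unique-length P rs u (All.map (QP _) qs)))

-- The number `m` of bits that the synthesizer consumes varies with the weights, whereas `b` must
-- not. A success rate valid for every padding is valid for the whole string.
suffix-count : ∀ a m b → b ≡ a + m → ∀ (g : Word → ℕ) c d →
  (∀ (pad : Vec Bool a) → c * 2 ^ m ≤ d * sumV {m} (λ v → g (toList pad ++ toList v))) →
  c * 2 ^ b ≤ d * sumV {b} (λ v → g (toList v))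
suffix-count a m _ refl g c d le = begin
  c * 2 ^ (a + m)                                 ≡⟨ cong (c *_) (^-distribˡ-+-* 2 a m) ⟩
  c * (2 ^ a * 2 ^ m)                             ≡⟨ eq c (2 ^ a) (2 ^ m) ⟩
  c * 2 ^ m * 2 ^ a                               ≡⟨ sumV-const {a} (c * 2 ^ m) ⟨
  sumV {a} (λ _ → c * 2 ^ m)                      ≤⟨ sumV-mono le ⟩
  sumV {a} (λ u → d * sumV {m} (λ v → g (toList u ++ toList v))) ≡⟨ sumV-* {a} d _ ⟩
  d * sumV {a} (λ u → sumV {m} (λ v → g (toList u ++ toList v)))
    ≡⟨ cong (d *_) (sumV-cong {a} λ u → sumV-cong {m} λ v → cong g (sym (toList-++ u v))) ⟩
  d * sumV {a} (λ u → sumV {m} (λ v → g (toList (u Vec.++ v)))) ≡⟨ cong (d *_) (sumV-++ a {m} (λ v → g (toList v))) ⟨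
  d * sumV {a + m} (λ v → g (toList v))           ∎
  where
  open ≤-Reasoning
  eq : ∀ c x y → c * (x * y) ≡ c * y * x
  eq = solve-∀

split-count : ∀ a b (g : Word → ℕ) →
  2 ^ a * 2 ^ b ≤ 2 * sumV {a} (λ u → sumV {b} (λ v → g (toList u ++ toList v))) →
  1 * 2 ^ (a + b) ≤ 2 * sumV {a + b} (λ v → g (toList v))
split-count a b g le = begin
  1 * 2 ^ (a + b) ≡⟨ *-identityˡ _ ⟩
  2 ^ (a + b)     ≡⟨ ^-distribˡ-+-* 2 a b ⟩
  2 ^ a * 2 ^ b   ≤⟨ le ⟩
  2 * sumV {a} (λ u → sumV {b} (λ v → g (toList u ++ toList v)))
    ≡⟨ cong (2 *_) (sumV-cong {a} λ u → sumV-cong {b} λ v → cong g (sym (toList-++ u v))) ⟩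
  2 * sumV {a} (λ u → sumV {b} (λ v → g (toList (u Vec.++ v)))) ≡⟨ cong (2 *_) (sumV-++ a {b} (λ v → g (toList v))) ⟨
  2 * sumV {a + b} (λ v → g (toList v)) ∎
  where open ≤-Reasoning

-- The probability argument takes this record as a parameter. The programs for verifier and request
-- are then mere variables to it and are never unfolded.
record VerifierSpec (M A : PolyTimeTM) (bits : Poly) : Set where
  field
    verifierFP requestFP : FP 6
    intro : ∀ {c n} x (ω : Isolation.Chunks c (rangeOf c c) (valueV c) (uniform c c) n) t l w → length l ≡ c →
      ∀ (z : Vec Bool n) → isTrue (M ⟨ x , toList z ⟩) ≡ true →
      Isolation.weight c (rangeOf c c) (valueV c) (uniform c c) z ω ≡ length t →
      fun verifierFP (toList z ∷ t ∷ toList (Vec.concat ω) ∷ l ∷ w ∷ x ∷ []) ≡ true ∷ []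
    weighs : ∀ {c n} x (ω : Isolation.Chunks c (rangeOf c c) (valueV c) (uniform c c) n) t l w → length l ≡ c →
      ∀ (z : Vec Bool n) → top (fun verifierFP (toList z ∷ t ∷ toList (Vec.concat ω) ∷ l ∷ w ∷ x ∷ [])) ≡ just true →
      Isolation.weight c (rangeOf c c) (valueV c) (uniform c c) z ω ≡ length t
    accepts : ∀ z t r l w x {b v} → fun verifierFP (z ∷ t ∷ r ∷ l ∷ w ∷ x ∷ []) ≡ b ∷ v → M ⟨ x , z ⟩ ≡ true ∷ []
    synthesis : ∀ u (ρ : Vec Word 5) z → length z ≡ length u → top (fun verifierFP (z ∷ ρ)) ≡ just true →
      (∀ z′ → length z′ ≡ length u → top (fun verifierFP (z′ ∷ ρ)) ≡ just true → z′ ≡ z) →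
      Pr[ (λ (r : Vec Bool (⟦ bits ⟧ (length (fun requestFP (u ∷ ρ))))) →
        certificateWord (A ⟨ fun requestFP (u ∷ ρ) , toList r ⟩) u ≡ z) ]≥ 2 / 3

module _ (R : RandomizedSynthesizer (toPoly N)) where
  open RandomizedSynthesizer R

  -- A good answer need not be a particular circuit: any Skolem function has the prescribed values
  -- at the unit vectors, so all good answers decode to the same `z`.
  request-synthesis : ∀ {k} (V : FP (suc k)) u (ρ : Vec Word k) z → length z ≡ length u → top (fun V (z ∷ ρ)) ≡ just true →
    (∀ z′ → length z′ ≡ length u → top (fun V (z′ ∷ ρ)) ≡ just true → z′ ≡ z) →
    Pr[ (λ (r : Vec Bool (⟦ randomBits ⟧ (length (fun (Verifier.requestFP V) (u ∷ ρ))))) →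
      certificateWord (algorithm ⟨ fun (Verifier.requestFP V) (u ∷ ρ) , toList r ⟩) u ≡ z) ]≥ 2 / 3
  request-synthesis V u ρ z len-z acc unique = subst
    (λ w → Pr[ (λ (r : Vec Bool (⟦ randomBits ⟧ (length w))) → certificateWord (algorithm ⟨ w , toList r ⟩) u ≡ z) ]≥ 2 / 3)
    (sym (fun-requestFP u ρ)) (rs , uniq , All.map recover good , le)
    where
    open Verifier V
    F = question u ρ
    unique′ : ∀ z′ → Accepted u ρ z′ → z′ ≡ z
    unique′ z′ (len-z′ , acc′) = unique z′ len-z′ acc′
    small : UniquelyDefinedBySize≤ F zero (⟦ toPoly N ⟧ ∣ F ∣)
    small = subst (UniquelyDefinedBySize≤ F zero) (sym (⟦toPoly⟧ N ∣ F ∣)) (question-unique u ρ z (len-z , acc) unique′)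
    found = correct F zero (question-total u ρ z (len-z , acc)) small
    rs = proj₁ found
    uniq = proj₁ (proj₂ found)
    good = proj₁ (proj₂ (proj₂ found))
    le = proj₂ (proj₂ (proj₂ found))
    recover : ∀ {r : Vec Bool (⟦ randomBits ⟧ (length (encodeInput F zero)))} →
      (∃[ C ] IsSkolem F zero C × algorithm ⟨ encodeInput F zero , toList r ⟩ ≡ encodeCircuit C) →
      certificateWord (algorithm ⟨ encodeInput F zero , toList r ⟩) u ≡ z
    recover (C , skolem , reply≡) = trans (cong (λ w → certificateWord w u) reply≡)
      (certificateWord-correct u z C len-z (skolem-value u ρ z (len-z , acc) unique′ C skolem))

  verifierSpec : ∀ M → VerifierSpec M algorithm randomBits
  verifierSpec M = record
    { verifierFP = Verify.verifierFP M
    ; requestFP  = Verifier.requestFP (Verify.verifierFP M)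
    ; intro      = Verify.verifier-intro M
    ; weighs     = Verify.verifier-weight M
    ; accepts    = Verify.verifier-accepts M
    ; synthesis  = request-synthesis (Verify.verifierFP M)
    }

-- Random bits and success probability of the resulting machine

module Amplify {M A : PolyTimeTM} {bits : Poly} (V : VerifierSpec M A bits) (q : Poly) where
  open VerifierSpec V
  open Decide requestFP verifierFP q A bits

  -- The number of random bits may depend on the length of `x` only, while the request depends on
  -- the weights and the target; `e-rest` bounds the synthesizer's demand over all of them.
  e-ℓ e-chunk e-random e-total e-request e-rest : PolyExpr
  e-ℓ       = fromPoly q
  e-chunk   = K 8 ⊗ e-ℓ
  e-random  = e-ℓ ⊗ e-chunk
  e-total   = e-ℓ ⊕ (e-random ⊕ (e-random ⊕ (e-chunk ⊕ (e-ℓ ⊕ N))))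
  e-request = cost requestFP ⟨∘⟩ e-total
  e-rest    = fromPoly bits ⟨∘⟩ e-request

  randomLength : Poly
  randomLength = toPoly (e-random ⊕ e-rest)

  -- Opaque, so that the compiled machine is never unfolded; the rest of the argument goes through
  -- `algorithm-computes`.
  abstract
    algorithm : PolyTimeTM
    algorithm = Machine.polyTimeTM mainFP

    algorithm-computes : ∀ x r → algorithm ⟨ x , r ⟩ ≡ fun mainFP (x ∷ r ∷ [])
    algorithm-computes = Machine.computes mainFP

  module _ (x : Word) where
    n c b : ℕ
    n = ⟦ q ⟧ (length x)
    c = 8 * n
    b = ⟪ e-rest ⟫ (length x)

    open Isolation c (rangeOf c c) (valueV c) (uniform c c)

    weight≤ : ∀ {m} (z : Vec Bool m) ω → weight z ω ≤ m * c
    weight≤ []      []      = z≤n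
    weight≤ (b ∷ z) (a ∷ ω) = +-mono-≤ (one b) (weight≤ z ω)
      where
      one : ∀ b → (if b then valueV c a else 0) ≤ c
      one true  = value≤ c (toList a)
      one false = z≤n

    accepting : Vec Bool n → Bool
    accepting z = isTrue (M ⟨ x , toList z ⟩)

    accepted : Word → ℕ
    accepted r = toNat (isTrue (fun mainFP (x ∷ r ∷ [])))

    module _ (ω : Chunks n) (z : Vec Bool n) (Sz : accepting z ≡ true)
      (unique : ∀ z′ → accepting z′ ≡ true → weight z′ ω ≡ weight z ω → z′ ≡ z) where
      i : ℕ
      i = weight z ω

      ρ : Vec Word 5
      ρ = ones i ∷ toList (Vec.concat ω) ∷ ones c ∷ ones n ∷ x ∷ []

      asked : Word
      asked = fun requestFP (ones n ∷ ρ)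

      m : ℕ
      m = ⟦ bits ⟧ (length asked)

      only : fun verifierFP (toList z ∷ ρ) ≡ true ∷ []
      only = intro x ω (ones i) (ones c) (ones n) (length-ones c) z Sz (sym (length-ones i))

      unique′ : ∀ z′ → length z′ ≡ length (ones n) → top (fun verifierFP (z′ ∷ ρ)) ≡ just true → z′ ≡ toList z
      unique′ z′ same-length acc with fromWord z′ (trans same-length (length-ones n))
      ... | v , refl = cong toList (unique v (isTrue-intro (nonempty (fun verifierFP (toList v ∷ ρ)) refl acc))
        (trans (weighs x ω (ones i) (ones c) (ones n) (length-ones c) v acc) (length-ones i)))
        where
        nonempty : ∀ w → fun verifierFP (toList v ∷ ρ) ≡ w → top w ≡ just true → M ⟨ x , toList v ⟩ ≡ true ∷ []
        nonempty (_ ∷ _) e _ = accepts (toList v) (ones i) (toList (Vec.concat ω)) (ones c) (ones n) x e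

      m≤b : m ≤ b
      m≤b = begin
        ⟦ bits ⟧ (length asked)            ≡⟨ ⟪fromPoly⟫ bits (length asked) ⟨
        ⟪ fromPoly bits ⟫ (length asked)   ≤⟨ ⟪⟫-mono (fromPoly bits) (begin
          length asked                                       ≤⟨ fun-length requestFP (ones n ∷ ρ) ⟩
          ⟪ cost requestFP ⟫ (total (ones n ∷ ρ))            ≤⟨ ⟪⟫-mono (cost requestFP) total≤ ⟩
          ⟪ cost requestFP ⟫ (⟪ e-total ⟫ (length x))        ≡⟨ ⟪∘⟫ (cost requestFP) e-total (length x) ⟨
          ⟪ e-request ⟫ (length x)                           ∎) ⟩
        ⟪ fromPoly bits ⟫ (⟪ e-request ⟫ (length x)) ≡⟨ ⟪∘⟫ (fromPoly bits) e-request (length x) ⟨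
        b ∎
        where
        open ≤-Reasoning
        q≡ : n ≡ ⟪ e-ℓ ⟫ (length x)
        q≡ = sym (⟪fromPoly⟫ q (length x))
        c≡ : c ≡ ⟪ e-chunk ⟫ (length x)
        c≡ = cong (8 *_) q≡
        nc≡ : n * c ≡ ⟪ e-random ⟫ (length x)
        nc≡ = cong₂ _*_ q≡ c≡
        total≤ : total (ones n ∷ ρ) ≤ ⟪ e-total ⟫ (length x)
        total≤ = +-mono-≤ (≤-reflexive (trans (length-ones n) q≡))
          (+-mono-≤ (≤-trans (≤-reflexive (length-ones i)) (≤-trans (weight≤ z ω) (≤-reflexive nc≡)))
          (+-mono-≤ (≤-reflexive (trans (length-toList (Vec.concat ω)) nc≡))
          (+-mono-≤ (≤-reflexive (trans (length-ones c) c≡))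
          (+-mono-≤ (≤-reflexive (trans (length-ones n) q≡)) (≤-reflexive (+-identityʳ (length x)))))))

      -- The weight `i` of the isolated certificate is among the targets tried. In that round the
      -- promise holds, and the synthesizer reads the last `m` bits, which are uniform for every
      -- padding.
      isolated-count : 2 * 2 ^ b ≤ 3 * sumV {b} (λ v → accepted (toList (Vec.concat ω) ++ toList v))
      isolated-count = suffix-count (b ∸ m) m b (sym (m∸n+n≡m m≤b)) (λ v → accepted (toList (Vec.concat ω) ++ v)) 2 3 λ pad →
        Pr-elim (λ v → isTrue (fun mainFP (x ∷ (toList (Vec.concat ω) ++ toList pad ++ toList v) ∷ []))) 2 3 (hit pad)
          (synthesis (ones n) ρ (toList z) (trans (length-toList z) (sym (length-ones n))) (cong top only) unique′)
        where
        hit : ∀ (pad : Vec Bool (b ∸ m)) (v : Vec Bool m) → certificateWord (A ⟨ asked , toList v ⟩) (ones n) ≡ toList z →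
          isTrue (fun mainFP (x ∷ (toList (Vec.concat ω) ++ toList pad ++ toList v) ∷ [])) ≡ true
        hit pad v eq = isTrue-intro (main-intro x r i (weight≤ z ω) (subst
          (λ r₁ → checkWord (ones i) r₁ (ones c) (ones n) x r ≡ true ∷ []) (sym (take-toList (Vec.concat ω) (toList pad ++ toList v)))
          (trans (cong (λ w → fun verifierFP (w ∷ ρ)) (trans (cong (λ v → certificateWord (A ⟨ asked , v ⟩) (ones n)) suffix) eq)) only)))
          where
          r : Word
          r = toList (Vec.concat ω) ++ toList pad ++ toList v
          front : Word
          front = toList (Vec.concat ω) ++ toList pad
          r≡ : r ≡ front ++ toList v
          r≡ = sym (List.++-assoc (toList (Vec.concat ω)) (toList pad) (toList v))
          suffix : drop (length r ∸ m) r ≡ toList v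
          suffix = trans (cong₂ drop (trans (cong (_∸ m) (trans (cong length r≡) (trans (List.length-++ front) (cong (length front +_) (length-toList v)))))
            (m+n∸n≡m (length front) m)) r≡) (drop-length-++ front (toList v))

    -- Half of `8 * n < R + R`, which is `range-large` at `c = 8 * n`.
    4n≤R : 4 * n ≤ rangeOf c c
    4n≤R = *-cancelˡ-≤ 2 (≤-trans (≤-reflexive (eq n)) (≤-trans (<⇒≤ (range-large c c ≤-refl)) (≤-reflexive (eq′ (rangeOf c c)))))
      where
      eq : ∀ n → 2 * (4 * n) ≡ 8 * n
      eq = solve-∀
      eq′ : ∀ r → r + r ≡ 2 * r
      eq′ = solve-∀

    half-accepted : ∀ (w : Vec Bool n) → accepting w ≡ true → 1 * 2 ^ (n * c + b) ≤ 2 * sumV {n * c + b} (λ v → accepted (toList v))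
    half-accepted w Sw = split-count (n * c) b accepted (isolation-count accepting 4n≤R (2 ^ b)
      (λ u → sumV {b} (λ v → accepted (toList u ++ toList v)))
      λ ω e → let (z , Sz , unique) = isolates accepting ω e w Sw in isolated-count ω z Sz unique)

    length≡ : ⟦ randomLength ⟧ (length x) ≡ n * c + b
    length≡ = trans (⟦toPoly⟧ (e-random ⊕ e-rest) (length x))
      (cong (λ l → l * (8 * l) + b) (⟪fromPoly⟫ q (length x)))

    often-accepts : ∀ (w : Vec Bool n) → Accepts M x (toList w) →
      Pr[ (λ (r : Vec Bool (⟦ randomLength ⟧ (length x))) → Accepts algorithm x (toList r)) ]≥ 1 / 2
    often-accepts w acc = subst (λ l → Pr[ (λ (r : Vec Bool l) → Accepts algorithm x (toList r)) ]≥ 1 / 2) (sym length≡)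
      (Pr-intro (λ r → isTrue (fun mainFP (x ∷ toList r ∷ []))) 1 2
        (λ r e → trans (algorithm-computes x (toList r)) (isTrue-elim (fun mainFP (x ∷ toList r ∷ [])) e)) (half-accepted w (isTrue-intro acc)))

    accepts-sound : ∀ r → Accepts algorithm x r → ∃[ w ] Accepts M x (toList {n = n} w)
    accepts-sound r acc =
      let (z , t , len-z , _ , _ , e) = main-elim x r (trans (sym (algorithm-computes x r)) acc)
          (w , w≡z) = fromWord z len-z
      in w , subst (λ z → M ⟨ x , z ⟩ ≡ true ∷ []) (sym w≡z) (accepts z t (random x r) (ones c) (ones n) x e)

-- The synthesizer is invoked at the identity polynomial, since the circuit is no larger than the
-- question.
NP⊆RP : (∀ (p : Poly) → RandomizedSynthesizer p) → ∀ {L} → NP L → RP L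
NP⊆RP synthesizer {L} (M , q , verifies) = algorithm , randomLength , λ x →
  (λ x∈L → let (w , acc) = Equivalence.to (verifies x) x∈L in often-accepts x w acc) ,
  (λ r acc → Equivalence.from (verifies x) (accepts-sound x (toList r) acc))
  where open Amplify (verifierSpec (synthesizer (toPoly N)) M) q

-- An accepted random string is itself a certificate, for the same machine and length.
RP⊆NP : ∀ {L} → RP L → NP L
RP⊆NP {L} (M , q , decides) = M , q , λ x → mk⇔ (witness x (proj₁ (decides x))) (λ (r , acc) → proj₂ (decides x) r acc)
  where
  witness : ∀ x → (L x → Pr[ (λ (r : Vec Bool (⟦ q ⟧ (length x))) → Accepts M x (toList r)) ]≥ 1 / 2) → L x →
    Σ[ w ∈ Vec Bool (⟦ q ⟧ (length x)) ] Accepts M x (toList w)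
  witness x often x∈L with often x∈L
  -- An empty list of accepted strings would give `2 ^ ℓ ≤ 0`.
  ... | []     , _ , _       , le = ⊥-elim (<⇒≱ (m^n>0 2 (⟦ q ⟧ (length x))) (≤-trans (≤-reflexive (sym (*-identityˡ _))) le))
  ... | r ∷ rs , _ , acc ∷ _ , _  = r , acc

theorem6 : (∀ (p : Poly) → RandomizedSynthesizer p) → NP ≐ RP
theorem6 synthesizer = NP⊆RP synthesizer , RP⊆NP
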